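{- Let $G$ be a connected cubic outerplanar graph (half-edges allowed). Then $G$ is edge-reflexive if and only if $G$ is triangle-free.
   Context: All graphs are finite. A 3-coloring of a graph $X$ is an unordered partition $\{V_1,V_2,V_3\}$ of $V(X)$ into three independent sets (a part may be empty); the $V_i$ are the color classes of the coloring. For a 3-colorable graph $X$, the 3-coloring complex $B(X)$ is the graph whose vertices are all color classes of all 3-colorings of $X$, with two vertices $C\neq D$ joined by an edge if $C$ and $D$ are color classes of a common 3-coloring of $X$. If $X$ is a 3-colorable graph without isolated vertices, then $B(X)$ is 3-colorable and the canonical map $\phi_X(v)=\{C\in V(B(X)) : v\in C\}$, $v\in V(X)$, is a graph homomorphism $X\to B(B(X))$. The graph $X$ is reflexive if $\phi_X$ is an isomorphism. A cubic graph is a graph without loops or parallel edges in which half-edges (edges incident with only one vertex) are allowed, and in which every vertex is incident with exactly three edges (full edges or half-edges). The line graph $L(G)$ of a cubic graph $G$ has as vertices all edges of $G$ (full edges and half-edges), two distinct ones being adjacent if they are incident with a common vertex. A cubic graph $G$ is 3-edge-colorable if $L(G)$ is 3-colorable, and edge-reflexive if it is 3-edge-colorable and $L(G)$ is reflexive. A graph is outerplanar if it has a planar drawing in which all of its vertices lie on the unbounded face. -}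

module Defs where

open import Data.Fin using (Fin)
open import Data.Fin.Properties using (_≟_; all?; any?)
open import Data.Fin.Subset using (Subset; inside; outside; _∈_; ∣_∣; _∪_; _∩_; ⊤; ⁅_⁆; Empty)
open import Data.Fin.Subset.Properties using (_∈?_; nonempty?; anySubset?)
open import Data.Bool.Properties using () renaming (_≟_ to _≟ᵇ_)
open import Data.List using (List; []; _∷_; _++_; map; filter; length)
open import Data.List.Base using () renaming (lookup to lookupᴸ)
open import Data.Nat using (ℕ; zero; suc; _+_; NonZero)
open import Data.Nat.Properties using () renaming (_≟_ to _≟ⁿ_)
open import Data.Product using (∃-syntax; Σ-syntax; _×_; _,_)
open import Data.Sum using (_⊎_)
open import Data.Vec using ([]; _∷_; tabulate; lookup)
open import Data.Vec.Properties using (≡-dec)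
open import Function.Bundles using (_⇔_)
open import Function.Definitions using (Bijective)
open import Relation.Binary.Construct.Closure.Equivalence using (EqClosure)
open import Relation.Binary.Construct.Closure.ReflexiveTransitive using (Star)
open import Relation.Binary.Definitions using (Decidable; Symmetric; Irreflexive)
open import Relation.Binary.PropositionalEquality using (_≡_; _≢_; refl; sym)
open import Relation.Nullary using (Dec; ¬_; does)
open import Relation.Nullary.Decidable using (¬?; map′; _×-dec_; _→-dec_)

------------------------------------------------------------------------
-- Finite simple graphs, 3-colorings and the 3-coloring complex

record Graph : Set₁ where
  field
    order  : ℕ
    Adj    : Fin order → Fin order → Set
    adj?   : Decidable Adj
    symm   : Symmetric Adj
    irrefl : Irreflexive _≡_ Adj

open Graph public

VertexSet : Graph → Set
VertexSet X = Subset (order X)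

_≟ˢ_ : ∀ {n} → Decidable {A = Subset n} _≡_
_≟ˢ_ = ≡-dec _≟ᵇ_

Independent : (X : Graph) → VertexSet X → Set
Independent X C = ∀ u v → u ∈ C → v ∈ C → ¬ Adj X u v

independent? : (X : Graph) (C : VertexSet X) → Dec (Independent X C)
independent? X C =
  all? λ u → all? λ v → (u ∈? C) →-dec ((v ∈? C) →-dec ¬? (adj? X u v))

-- {C, D, E} is a 3-coloring of X.  The condition is invariant under
-- permuting C, D and E, so unordered partitions need no quotient.
record IsColoring (X : Graph) (C D E : VertexSet X) : Set where
  constructor coloring
  field
    indep₁ : Independent X C
    indep₂ : Independent X D
    indep₃ : Independent X E
    disj₁₂ : Empty (C ∩ D)
    disj₁₃ : Empty (C ∩ E)
    disj₂₃ : Empty (D ∩ E)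
    cover  : C ∪ D ∪ E ≡ ⊤

isColoring? : (X : Graph) (C D E : VertexSet X) → Dec (IsColoring X C D E)
isColoring? X C D E = map′
  (λ { (a , b , c , d , e , f , g) → coloring a b c d e f g })
  (λ { (coloring a b c d e f g) → a , b , c , d , e , f , g })
  (independent? X C ×-dec independent? X D ×-dec independent? X E ×-dec
   ¬? (nonempty? (C ∩ D)) ×-dec ¬? (nonempty? (C ∩ E)) ×-dec
   ¬? (nonempty? (D ∩ E)) ×-dec ((C ∪ D ∪ E) ≟ˢ ⊤))

ThreeColorable : Graph → Set
ThreeColorable X = ∃[ C ] ∃[ D ] ∃[ E ] IsColoring X C D E

ColorClass : (X : Graph) → VertexSet X → Set
ColorClass X C = ∃[ D ] ∃[ E ] IsColoring X C D E

colorClass? : (X : Graph) (C : VertexSet X) → Dec (ColorClass X C)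
colorClass? X C = anySubset? λ D → anySubset? λ E → isColoring? X C D E

-- C and D are distinct color classes of a common 3-coloring.
Compatible : (X : Graph) → VertexSet X → VertexSet X → Set
Compatible X C D = C ≢ D × (∃[ E ] IsColoring X C D E)

compatible? : (X : Graph) → Decidable (Compatible X)
compatible? X C D = ¬? (C ≟ˢ D) ×-dec anySubset? λ E → isColoring? X C D E

compatible-sym : (X : Graph) → Symmetric (Compatible X)
compatible-sym X {C} {D} (C≢D , E , coloring i₁ i₂ i₃ d₁₂ d₁₃ d₂₃ cov) =
  (λ D≡C → C≢D (sym D≡C)) , E ,
  coloring i₂ i₁ i₃
    (λ { (v , v∈) → d₁₂ (v , ≡.subst (v ∈_) (∩-comm D C) v∈) }) d₂₃ d₁₃
    (≡.trans (≡.trans (≡.sym (∪-assoc D C E))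
               (≡.trans (≡.cong (_∪ E) (∪-comm D C)) (∪-assoc C D E))) cov)
  where
  open import Data.Fin.Subset.Properties using (∩-comm; ∪-comm; ∪-assoc)
  import Relation.Binary.PropositionalEquality as ≡

allSubsets : ∀ n → List (Subset n)
allSubsets zero    = [] ∷ []
allSubsets (suc n) = map (outside ∷_) (allSubsets n) ++ map (inside ∷_) (allSubsets n)

-- Every color class occurs exactly once in this list.
colorClasses : (X : Graph) → List (VertexSet X)
colorClasses X = filter (colorClass? X) (allSubsets (order X))

-- The color class of X named by a vertex of B X.
class : (X : Graph) → Fin (length (colorClasses X)) → VertexSet X
class X = lookupᴸ (colorClasses X)

B : Graph → Graph
B X = record
  { order  = length (colorClasses X)
  ; Adj    = λ i j → Compatible X (class X i) (class X j)
  ; adj?   = λ i j → compatible? X (class X i) (class X j)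
  ; symm   = compatible-sym X
  ; irrefl = λ { refl (C≢C , _) → C≢C refl }
  }

φ : (X : Graph) → Fin (order X) → VertexSet (B X)
φ X v = tabulate λ i → lookup (class X i) v

IsIsomorphism : (X Y : Graph) → (Fin (order X) → Fin (order Y)) → Set
IsIsomorphism X Y f =
  Bijective _≡_ _≡_ f × (∀ u v → Adj X u v ⇔ Adj Y (f u) (f v))

-- φ X takes values in the color classes of B X, and the resulting map into
-- the vertices of B (B X) is an isomorphism.
Reflexive : Graph → Set
Reflexive X =
  Σ[ f ∈ (Fin (order X) → Fin (order (B (B X)))) ]
    (∀ v → class (B X) (f v) ≡ φ X v) × IsIsomorphism X (B (B X)) f

------------------------------------------------------------------------
-- Cubic graphs with half-edges

-- An edge is full if it has two ends and a half-edge if it has one; a loop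
-- cannot be represented.  Several half-edges may share their end.
record CubicGraph : Set where
  field
    #vertices  : ℕ
    #edges     : ℕ
    ends       : Fin #edges → Subset #vertices
    arity      : ∀ e → ∣ ends e ∣ ≡ 1 ⊎ ∣ ends e ∣ ≡ 2
    noParallel : ∀ e f → ∣ ends e ∣ ≡ 2 → ends e ≡ ends f → e ≡ f

  Vertex : Set
  Vertex = Fin #vertices

  Edge : Set
  Edge = Fin #edges

  edgesAt : Vertex → Subset #edges
  edgesAt v = tabulate λ e → lookup (ends e) v

  field
    cubic : ∀ v → ∣ edgesAt v ∣ ≡ 3

  fullEdges : Subset #edges
  fullEdges = tabulate λ e → does (∣ ends e ∣ ≟ⁿ 2)

  Adjacent : Vertex → Vertex → Set
  Adjacent u v = u ≢ v × (∃[ e ] u ∈ ends e × v ∈ ends e)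

  Connected : Set
  Connected = NonZero #vertices × (∀ u v → Star Adjacent u v)

  TriangleFree : Set
  TriangleFree = ∀ u v w → ¬ (Adjacent u v × Adjacent v w × Adjacent u w)

open CubicGraph public using (Connected; TriangleFree)

L : CubicGraph → Graph
L G = record
  { order  = #edges
  ; Adj    = λ e f → e ≢ f × (∃[ v ] v ∈ ends e × v ∈ ends f)
  ; adj?   = λ e f → ¬? (e ≟ f) ×-dec any? λ v → (v ∈? ends e) ×-dec (v ∈? ends f)
  ; symm   = λ { (e≢f , v , v∈e , v∈f) → (λ f≡e → e≢f (sym f≡e)) , v , v∈f , v∈e }
  ; irrefl = λ { refl (e≢e , _) → e≢e refl }
  }
  where open CubicGraph G

EdgeReflexive : CubicGraph → Set
EdgeReflexive G = ThreeColorable (L G) × Reflexive (L G)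

------------------------------------------------------------------------
-- Planar drawings

-- A drawing of a connected graph in the sphere, up to homeomorphism, is a
-- rotation system of Euler characteristic 2 (Heffter–Edmonds).  A dart is an
-- incident pair (v , e), read as leaving v along e.
record PlanarDrawing (G : CubicGraph) : Set where
  open CubicGraph G

  IsDart : Vertex × Edge → Set
  IsDart (v , e) = v ∈ ends e

  field
    -- next v e follows e in the cyclic order of the edges around v.
    next       : Vertex → Edge → Edge
    next-dart  : ∀ {v e} → v ∈ ends e → v ∈ ends (next v e)
    cyclic     : ∀ {v e f} → v ∈ ends e → v ∈ ends f →
                 Star (λ g h → next v g ≡ h) e f

  -- Walking along the boundary of a face: traverse e from v to its other end
  -- w, then turn into the next edge at w.  For a half-edge the equation forces
  -- w ≡ v: the walk goes to the free end and back.
  FaceStep : Vertex × Edge → Vertex × Edge → Set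
  FaceStep (v , e) (w , f) = ends e ≡ ⁅ v ⁆ ∪ ⁅ w ⁆ × f ≡ next w e

  -- Faces are the orbits of FaceStep on darts; `face` is meaningful on darts
  -- only.
  field
    #faces     : ℕ
    face       : Vertex × Edge → Fin #faces
    face-orbit : ∀ {d d′} → IsDart d → IsDart d′ →
                 (face d ≡ face d′) ⇔ EqClosure FaceStep d d′
    face-onto  : ∀ i → ∃[ d ] IsDart d × face d ≡ i
    -- V - E + F = 2.  A half-edge together with its free end contributes 0.
    euler      : #vertices + #faces ≡ 2 + ∣ fullEdges ∣

  OnFace : Fin #faces → Vertex → Set
  OnFace i v = ∃[ e ] IsDart (v , e) × face (v , e) ≡ i

-- Any face of a drawing in the sphere can be taken as the unbounded face of a
-- drawing in the plane.  The definition is meant for connected G, for which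
-- `euler` expresses that the surface is a sphere.
Outerplanar : CubicGraph → Set
Outerplanar G =
  Σ[ D ∈ PlanarDrawing G ]
    let open PlanarDrawing D in
    Σ[ outer ∈ Fin #faces ] (∀ v → OnFace outer v)

-- A proper 3-edge-colouring and its classes restrict to every vertex set W.  Say that W is represented
-- if every proper 3-colouring of the classes near W is given by a vertex y of W: the class containing the
-- edge z at y always has the same colour, for each of the three edges z.  Such a colouring of all of G is
-- one of the complex B(L(G)), and its colour classes are then the images of the edges at y under φ.
-- In an outerplanar graph K₂,₃ is excluded as a minor: by Euler's formula a theta graph carries a
-- nonzero flow that is the coboundary of a function on the faces vanishing on the outer face, while
-- every vertex is on the outer face.  Hence, if there are no triangles, V(G) is built up from a vertex or
-- an edge by adding pendant vertices and ears that close cycles of length at least 4 with an edge, and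
-- represented sets stay so along the way.  Injectivity of φ is carried along as well: any two edges
-- receive different colours in some colouring.
-- Conversely, in a triangle abc the edge ab and the third edge at c have equal colours in all colourings,
-- so that φ is not injective.
module Submission where

open import Defs
open import Data.Bool.Base using (Bool; true; false; not)
open import Data.Bool.Properties using () renaming (_≟_ to _≟ᵇ_)
open import Data.Empty using (⊥; ⊥-elim)
open import Data.Fin using (Fin; zero; suc; inject₁; fromℕ; fromℕ<; toℕ; punchIn; splitAt; _↑ˡ_; _↑ʳ_)
open import Data.Fin.Patterns using (0F; 1F; 2F)
open import Data.Fin.Properties using (_≟_; all?; any?; punchInᵢ≢i; suc-injective; splitAt⁻¹-↑ˡ; splitAt⁻¹-↑ʳ; toℕ<n; toℕ-injective; toℕ-inject₁; toℕ-fromℕ; toℕ-fromℕ<)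
open import Data.Fin.Relation.Unary.Top using (View; view; ‵fromℕ; ‵inject₁)
open import Data.Fin.Subset using (Subset; inside; outside; _∈_; _∉_; _⊆_; ∣_∣; _∪_; _∩_; ⊤; ⁅_⁆; Empty)
open import Data.Fin.Subset.Properties using (_∈?_; anySubset?; x∈⁅x⁆; x∈⁅y⁆⇒x≡y; x∈p∪q⁻; x∈p∪q⁺; x∈p∩q⁻; x∈p∩q⁺; ⊆-antisym; ⊆⊤; ∈⊤; p⊂q⇒∣p∣<∣q∣)
open import Data.Integer.Base as ℤ using (ℤ; 0ℤ; 1ℤ; _+_; _*_; _-_; -_)
import Data.Integer.Properties as ℤₚ
open import Algebra.Properties.CommutativeMonoid.Sum ℤₚ.+-0-commutativeMonoid using (sum; sum-cong-≗; ∑-distrib-+; ∑-comm; sum-remove; sum-replicate-zero)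
open import Algebra.Properties.Semiring.Sum ℤₚ.+-*-semiring using (*-distribˡ-sum)
open import Data.Integer.Tactic.RingSolver using (solve-∀)
open import Data.List.Base using (List; []; _∷_; _++_) renaming (lookup to lookupᴸ)
open import Data.List.Membership.Propositional using () renaming (_∈_ to _∈ᴸ_)
open import Data.List.Membership.Propositional.Properties using (∈-filter⁺; ∈-filter⁻; ∈-map⁺; ∈-map⁻; ∈-++⁺ˡ; ∈-++⁺ʳ; ∈-lookup)
import Data.List.Relation.Unary.All as All
open import Data.List.Relation.Unary.AllPairs using ([]; _∷_)
import Data.List.Relation.Unary.Any as Any
open import Data.List.Relation.Unary.Any.Properties using (lookup-index)
open import Data.List.Relation.Unary.Unique.Propositional using (Unique)
import Data.List.Relation.Unary.Unique.Propositional.Properties as Uniqueₚ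
open import Data.Nat using (ℕ; zero; suc; _≤_; _<_; z≤n; s≤s)
import Data.Nat as ℕ
import Data.Nat.Properties as ℕₚ
open import Data.Product using (Σ-syntax; ∃-syntax; _×_; _,_; proj₁; proj₂)
open import Data.Sum using (_⊎_; inj₁; inj₂; [_,_]′)
open import Data.Vec using ([]; _∷_; tabulate; lookup; here; there)
open import Data.Vec.Functional using (insertAt)
open import Data.Vec.Functional.Properties using (insertAt-lookup; insertAt-punchIn)
open import Data.Vec.Properties using (lookup∘tabulate; []=⇒lookup; lookup⇒[]=)
open import Function.Base using (_∘_; id)
open import Function.Bundles using (_⇔_; mk⇔; Equivalence)
open import Relation.Binary.Construct.Closure.ReflexiveTransitive using (Star; ε; _◅_; _◅◅_; gmap; reverse)
open import Relation.Binary.Construct.Closure.Symmetric using (fwd)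
open import Relation.Binary.Definitions using (tri<; tri≈; tri>)
open import Relation.Binary.PropositionalEquality using (_≡_; _≢_; refl; sym; trans; cong; cong₂; subst; subst₂; ≢-sym; module ≡-Reasoning)
open import Relation.Nullary using (Dec; yes; no; ¬_; does)
open import Relation.Nullary.Decidable using (¬?; _→-dec_; _×-dec_; _⊎-dec_; toWitness; dec-true; decidable-stable; ¬¬-excluded-middle)

-- Colours and walks in the triangle K₃

-- The ear is the hard case. Once the edge uv and the first edge of the ear have the colours 0 and
-- 1, a colouring near the larger set is a pair: a colouring near the smaller set and a walk in K₃
-- along the ear. A 3-colouring of the classes is then a function of two variables, and the aim is
-- to show that it depends on one of them only. If it does not depend on the walk, it restricts to
-- the smaller set and is represented there. If it does not depend on the colouring, it is a
-- 3-colouring of the classes of a cycle, and on a cycle with at least four edges only the vertices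
-- provide such colourings. To rule out mixtures, values must be carried between any two colourings
-- in which the two end edges of the ear have equal colours; this is why the same vertex set is
-- built up a second time, starting from uv. Neither ears nor representing vertices are computed:
-- their existence is stated under a double negation, which is removed at the end because the
-- statements about the finite complex are decidable.

Colour : Set
Colour = Fin 3

infix 3 _⇆_
_⇆_ : Set → Set → Set
A ⇆ B = (A → B) × (B → A)

third : Colour → Colour → Colour
third 0F 1F = 2F
third 0F _  = 1F
third 1F 0F = 2F
third 1F _  = 0F
third 2F 0F = 1F
third 2F _  = 0F

infix 4 _≟ᶜ_
_≟ᶜ_ : (x y : Colour) → Dec (x ≡ y)
_≟ᶜ_ = _≟_

abstract
  third≢ˡ : ∀ a b → third a b ≢ a
  third≢ˡ = toWitness {a? = all? λ a → all? λ b → ¬? (third a b ≟ a)} _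

  third≢ʳ : ∀ a b → third a b ≢ b
  third≢ʳ = toWitness {a? = all? λ a → all? λ b → ¬? (third a b ≟ b)} _

  remaining-colour : ∀ (x y z w : Colour) → x ≢ y → x ≢ z → y ≢ z → w ≢ x → w ≢ y → w ≡ z
  remaining-colour = toWitness
    {a? = all? λ x → all? λ y → all? λ z → all? λ w → ¬? (x ≟ y) →-dec (¬? (x ≟ z) →-dec
      (¬? (y ≟ z) →-dec (¬? (w ≟ x) →-dec (¬? (w ≟ y) →-dec (w ≟ z)))))} _

Injective₃ : (Colour → Colour) → Set
Injective₃ f = ∀ {i j} → f i ≡ f j → i ≡ j

≢⇒≢ : ∀ {f} → Injective₃ f → ∀ {i j} → i ≢ j → f i ≢ f j
≢⇒≢ inj i≢j eq = i≢j (inj eq)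

agree₃ : ∀ {f g} → Injective₃ f → Injective₃ g → ∀ {i j} → i ≢ j →
         f i ≡ g i → f j ≡ g j → ∀ k → f k ≡ g k
agree₃ {f} {g} f-inj g-inj {i} {j} i≢j fi fj k with k ≟ᶜ i | k ≟ᶜ j
... | yes refl | _        = fi
... | no _     | yes refl = fj
... | no k≢i   | no k≢j   = sym (remaining-colour (f i) (f j) (f k) (g k)
  (≢⇒≢ f-inj i≢j) (≢⇒≢ f-inj (≢-sym k≢i)) (≢⇒≢ f-inj (≢-sym k≢j))
  (λ eq → k≢i (g-inj (trans eq fi))) (λ eq → k≢j (g-inj (trans eq fj))))

-- A walk of length `n` is the same as a proper 3-colouring of `n + 1` consecutive edges of a path
-- with prescribed colours at both ends.
data Walk : Colour → Colour → ℕ → Set where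
  stop : ∀ {a} → Walk a a 0
  step : ∀ {a b n} x → a ≢ x → Walk x b n → Walk a b (suc n)

at : ∀ {a b n} → Walk a b n → Fin (suc n) → Colour
at {a} _            zero    = a
at     (step _ _ ω) (suc k) = at ω k

at-last : ∀ {a b n} (ω : Walk a b n) → at ω (fromℕ n) ≡ b
at-last stop         = refl
at-last (step _ _ ω) = at-last ω

at-≢ : ∀ {a b n} (ω : Walk a b n) (k : Fin n) → at ω (inject₁ k) ≢ at ω (suc k)
at-≢ (step x a≢x ω) zero    = a≢x
at-≢ (step x a≢x ω) (suc k) = at-≢ ω k

fromFunction : ∀ {n} (ξ : Fin (suc n) → Colour) → (∀ k → ξ (inject₁ k) ≢ ξ (suc k)) →
               Σ[ ω ∈ Walk (ξ zero) (ξ (fromℕ n)) n ] (∀ k → at ω k ≡ ξ k)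
fromFunction {zero}  ξ ξ-≢ = stop , λ { zero → refl }
fromFunction {suc n} ξ ξ-≢ with ω , eq ← fromFunction (ξ ∘ suc) (ξ-≢ ∘ suc) =
  step (ξ 1F′) (ξ-≢ zero) ω , λ { zero → refl ; (suc k) → eq k }
  where 1F′ = suc zero

Same : ∀ {a b a′ b′ n} → Colour → Walk a b n → Walk a′ b′ n → Set
Same i ω ω′ = ∀ k → at ω k ≡ i ⇆ at ω′ k ≡ i

keep : ∀ {x i : Colour} → x ≡ i ⇆ x ≡ i
keep = id , id

same-refl : ∀ {i a b n} {ω : Walk a b n} → Same i ω ω
same-refl k = id , id

same-sym : ∀ {i a b a′ b′ n} {ω : Walk a b n} {ω′ : Walk a′ b′ n} → Same i ω ω′ → Same i ω′ ω
same-sym s k = proj₂ (s k) , proj₁ (s k)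

off : ∀ {x y i : Colour} → x ≢ i → y ≢ i → x ≡ i ⇆ y ≡ i
off x≢i y≢i = (λ eq → ⊥-elim (x≢i eq)) , (λ eq → ⊥-elim (y≢i eq))

same-step : ∀ {i a b a′ b′ n x x′} {p : a ≢ x} {p′ : a′ ≢ x′} {ω : Walk x b n} {ω′ : Walk x′ b′ n} →
            a ≡ i ⇆ a′ ≡ i → Same i ω ω′ → Same i (step x p ω) (step x′ p′ ω′)
same-step h s zero    = h
same-step h s (suc k) = s k

-- One colour is excluded because the later comparisons of values succeed only along a common class
-- of one of the two others.
Move : ∀ {a b n} → Colour → Walk a b n → Walk a b n → Set
Move e ω ω′ = ∃[ i ] i ≢ e × Same i ω ω′

move-sym : ∀ {e a b n} {ω ω′ : Walk a b n} → Move e ω ω′ → Move e ω′ ω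
move-sym (i , i≢e , s) = i , i≢e , same-sym s

moves-step : ∀ {e a b n x} {p : a ≢ x} {ω ω′ : Walk x b n} →
             Star (Move e) ω ω′ → Star (Move e) (step x p ω) (step x p ω′)
moves-step = gmap (step _ _) λ (i , i≢e , s) → i , i≢e , same-step keep s

-- A walk between two colours other than e can be moved so that it avoids e in
-- its second position; then the first step can be split off.
module _ {e a : Colour} (a≢e : a ≢ e) where
  private
    d : Colour
    d = third a e
    d≢a : d ≢ a
    d≢a = third≢ˡ a e
    d≢e : d ≢ e
    d≢e = third≢ʳ a e
    a≢d : a ≢ d
    a≢d = ≢-sym d≢a
    e≢a : e ≢ a
    e≢a = ≢-sym a≢e
    e≢d : e ≢ d
    e≢d = ≢-sym d≢e

  AllConnected : Colour → ℕ → Set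
  AllConnected b n = (ω ω′ : Walk a b n) → Star (Move e) ω ω′

  Avoiding : ∀ {b n} → Walk a b (suc n) → Set
  Avoiding {b} {n} ω = Σ[ τ ∈ Walk d b n ] Star (Move e) ω (step d a≢d τ)

  normalise₄ : ∀ {b n} (p : a ≢ e) (q : e ≢ d) (r : d ≢ e) z (s : e ≢ z) (τ : Walk z b n) →
               Avoiding (step e p (step d q (step e r (step z s τ))))
  normalise₄ p q r z s τ with z ≟ᶜ a
  ... | yes refl = step e d≢e (step d e≢d (step a d≢a τ)) ,
    (a , a≢e , same-step keep (same-step (off e≢a d≢a) (same-step (off d≢a e≢a)
      (same-step (off e≢a d≢a) same-refl)))) ◅ ε
  -- The walk a e d e d becomes a e d a d and then a d e a d; the class of `d` is kept first, that
  -- of `a` afterwards.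
  ... | no z≢a with refl ← remaining-colour e a d z e≢a e≢d a≢d (≢-sym s) z≢a =
    step e d≢e (step a e≢a (step d a≢d τ)) ,
    _◅_ {j = step e p (step d q (step a d≢a (step d a≢d τ)))}
      (d , d≢e , same-step keep (same-step keep (same-step keep (same-step (off e≢d a≢d) same-refl))))
      ((a , a≢e , same-step keep (same-step (off e≢a d≢a) (same-step (off d≢a e≢a) same-refl))) ◅ ε)

  normalise₃ : ∀ {b n} → b ≢ e → (p : a ≢ e) (q : e ≢ d) (τ : Walk d b n) →
               AllConnected b (suc (suc n)) ⊎ Avoiding (step e p (step d q τ))
  -- Here `b` is `d` and the length is 2, so the middle colour of every such walk is forced to be
  -- `e`.
  normalise₃ b≢e p q stop = inj₁ λ where
    (step x a≢x (step _ x≢d stop)) (step x′ a≢x′ (step _ x′≢d stop)) →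
      (a , a≢e , same-step keep (same-step (off (≢-sym a≢x) (≢-sym a≢x′)) same-refl)) ◅ ε
  normalise₃ b≢e p q (step z d≢z τ) with z ≟ᶜ a
  ... | yes refl = inj₂ (step e d≢e (step a e≢a τ) ,
    (a , a≢e , same-step keep (same-step (off e≢a d≢a) (same-step (off d≢a e≢a) same-refl))) ◅ ε)
  ... | no z≢a with refl ← remaining-colour a d e z a≢d a≢e d≢e z≢a (≢-sym d≢z) = last τ
    where
    last : ∀ {n} (τ : Walk e _ n) → AllConnected _ (suc (suc (suc n))) ⊎ Avoiding (step e p (step d q (step e d≢z τ)))
    last stop           = ⊥-elim (b≢e refl)
    last (step w e≢w τ) = inj₂ (normalise₄ p q d≢z w e≢w τ)

  normalise : ∀ {b n} → b ≢ e → (ω : Walk a b (suc (suc n))) → AllConnected b (suc (suc n)) ⊎ Avoiding ω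
  normalise b≢e (step x a≢x τ) with x ≟ᶜ e
  ... | no x≢e with refl ← remaining-colour a e d x a≢e a≢d e≢d (≢-sym a≢x) x≢e =
    inj₂ (τ , (a , a≢e , same-step keep same-refl) ◅ ε)
  normalise b≢e (step _ a≢x (step y e≢y τ)) | yes refl with y ≟ᶜ a
  ... | yes refl = inj₂ (step a d≢a τ , (a , a≢e , same-step keep (same-step (off e≢a d≢a) same-refl)) ◅ ε)
  ... | no y≢a with refl ← remaining-colour a e d y a≢e a≢d e≢d y≢a (≢-sym e≢y) = normalise₃ b≢e a≢x e≢y τ

connect : ∀ n {e a b} → a ≢ e → b ≢ e → (ω ω′ : Walk a b n) → Star (Move e) ω ω′
connect 0 a≢e b≢e stop stop = ε
connect 1 a≢e b≢e (step _ p stop) (step _ q stop) = (_ , a≢e , same-step keep same-refl) ◅ ε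
connect (suc (suc n)) {e} {a} {b} a≢e b≢e ω ω′ =
  helper (connect (suc n) (third≢ʳ a e) b≢e) (normalise a≢e b≢e ω) (normalise a≢e b≢e ω′)
  where
  helper : AllConnected {e} (third≢ʳ a e) b (suc n) →
           AllConnected a≢e _ (suc (suc n)) ⊎ Avoiding a≢e ω → AllConnected a≢e _ (suc (suc n)) ⊎ Avoiding a≢e ω′ → Star (Move e) ω ω′
  helper ih (inj₁ short)   _               = short ω ω′
  helper ih (inj₂ _)       (inj₁ short)    = short ω ω′
  helper ih (inj₂ (τ , r)) (inj₂ (τ′ , r′)) =
    r ◅◅ moves-step (ih τ τ′) ◅◅ reverse (λ {ω} {ω′} → move-sym {ω = ω} {ω′}) r′

Has : ∀ {a b n} → Colour → Walk a b n → Set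
Has i ω = ∃[ k ] at ω k ≡ i

has? : ∀ {a b n} i (ω : Walk a b n) → Dec (Has i ω)
has? i ω = any? λ k → at ω k ≟ i

anyWalk : ∀ n a b → Walk a b (suc (suc n))
anyWalk zero    a b = step (third a b) (≢-sym (third≢ˡ a b)) (step b (third≢ʳ a b) stop)
anyWalk (suc n) a b = step (third a b) (≢-sym (third≢ˡ a b)) (anyWalk n (third a b) b)

walkTo : ∀ n {i b} → b ≢ i → ∃[ a ] a ≢ i × Σ[ ω ∈ Walk a b n ] ¬ Has i ω
walkTo zero    {b = b} b≢i = b , b≢i , stop , λ { (zero , eq) → b≢i eq }
walkTo (suc n) {i} b≢i with a , a≢i , ω , avoids ← walkTo n b≢i =
  third a i , third≢ʳ a i , step a (third≢ˡ a i) ω ,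
  λ { (zero , eq) → third≢ʳ a i eq ; (suc k , eq) → avoids (k , eq) }

walkFrom : ∀ n {i a} → a ≢ i → ∃[ b ] b ≢ i × Σ[ ω ∈ Walk a b n ] ¬ Has i ω
walkFrom zero    {a = a} a≢i = a , a≢i , stop , λ { (zero , eq) → a≢i eq }
walkFrom (suc n) {i} {a} a≢i with b , b≢i , ω , avoids ← walkFrom n (third≢ʳ a i) =
  b , b≢i , step (third a i) (≢-sym (third≢ˡ a i)) ω ,
  λ { (zero , eq) → a≢i eq ; (suc k , eq) → avoids (k , eq) }

same-avoiding : ∀ {i a b a′ b′ n} {ω : Walk a b n} {ω′ : Walk a′ b′ n} → ¬ Has i ω → ¬ Has i ω′ → Same i ω ω′
same-avoiding av av′ k = off (λ eq → av (k , eq)) (λ eq → av′ (k , eq))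

-- The colour `i` is used at position 1 only; from there on the two other colours alternate, in the
-- phase that leads to the required end.
forkedWalks : ∀ n {i a b b′} → a ≢ i → b ≢ i → b′ ≢ i →
              Σ[ ω ∈ Walk a b (suc (suc n)) ] Σ[ ω′ ∈ Walk a b′ (suc (suc n)) ] Same i ω ω′ × Has i ω
forkedWalks n a≢i b≢i b′≢i
  with c , c≢i , ω , av ← walkTo n b≢i | c′ , c′≢i , ω′ , av′ ← walkTo n b′≢i =
  step _ a≢i (step c (≢-sym c≢i) ω) , step _ a≢i (step c′ (≢-sym c′≢i) ω′) ,
  same-step keep (same-step keep (same-avoiding av av′)) , suc zero , refl

-- Everything after the last `i` is replaced by an alternation of the other two colours that ends at
-- `b′`. This needs an `i` in the walk, since the start stays fixed.
retarget : ∀ {n i a b b′} → b ≢ i → b′ ≢ i → (ω : Walk a b n) → Has i ω →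
           Σ[ ω′ ∈ Walk a b′ n ] Same i ω ω′
retarget b≢i b′≢i stop (zero , eq) = ⊥-elim (b≢i eq)
retarget {suc n} {i} {a} b≢i b′≢i (step x p ω) (k , eq) with has? i ω
... | yes h with ω′ , s ← retarget b≢i b′≢i ω h = step x p ω′ , same-step keep s
... | no avoids with k
...   | suc k′ = ⊥-elim (avoids (k′ , eq))
...   | zero with c , c≢i , ω′ , av ← walkTo n b′≢i =
  step c (λ a≡c → c≢i (trans (sym a≡c) eq)) ω′ , same-step keep (same-avoiding avoids av)

insert : ∀ {n e a b} (ω : Walk a b (suc (suc n))) → ¬ Has e ω → (l : Fin (suc n)) →
         Σ[ ω′ ∈ Walk a b (suc (suc n)) ] at ω′ (suc (inject₁ l)) ≡ e
insert (step x p (step y q ω)) avoids zero =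
  step _ (λ eq → avoids (zero , eq)) (step y (λ eq → avoids (suc (suc zero) , sym eq)) ω) , refl
insert {suc n} (step x p ω) avoids (suc l)
  with ω′ , eq ← insert ω (λ (k , eq) → avoids (suc k , eq)) l = step x p ω′ , eq

insertKeepingStart : ∀ {n e a b} (ω : Walk a b (suc (suc n))) → ¬ Has e ω →
                     Σ[ ω′ ∈ Walk a b (suc (suc n)) ] Same a ω ω′ × Has e ω′
insertKeepingStart {e = e} (step x p (step y q ω)) avoids =
  step e (λ eq → avoids (zero , eq)) (step y (λ eq → avoids (suc (suc zero) , sym eq)) ω) ,
  same-step keep (same-step (off (≢-sym p) (λ eq → avoids (zero , sym eq))) same-refl) , suc zero , refl

-- A walk without `e` alternates between `a` and `b`, so position 1 is `b` and position 2 is `a`.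
-- The latter is replaced by `e`; it is not the end, which has colour `b`.
insertKeepingEnd : ∀ {n e a b} → a ≢ b → (ω : Walk a b (suc (suc n))) → ¬ Has e ω →
                   Σ[ ω′ ∈ Walk a b (suc (suc n)) ] Same b ω ω′ × Has e ω′
insertKeepingEnd {e = e} {a} {b} a≢b (step x p (step y q ω)) avoids =
  go ω (λ k eq → avoids (suc (suc k) , eq))
    (remaining-colour a e b x (λ eq → avoids (zero , eq)) a≢b (≢-sym b≢e) (≢-sym p) (λ eq → avoids (suc zero , eq)))
  where
  b≢e : b ≢ e
  b≢e eq = avoids (fromℕ _ , trans (at-last (step x p (step y q ω))) eq)
  go : ∀ {n} (τ : Walk y b n) → (∀ k → at τ k ≢ e) → x ≡ b →
       Σ[ ω′ ∈ Walk a b (suc (suc n)) ] Same b (step x p (step y q τ)) ω′ × Has e ω′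
  go stop           av x≡b  = ⊥-elim (q x≡b)
  go (step z y≢z τ) av refl = step b p (step e b≢e (step z (≢-sym (av (suc zero))) τ)) ,
    same-step keep (same-step keep (same-step (off (≢-sym q) (≢-sym b≢e)) same-refl)) , suc (suc zero) , refl

snoc : ∀ {a b e n} → Walk a b n → b ≢ e → Walk a e (suc n)
snoc stop         b≢e = step _ b≢e stop
snoc (step x p ω) b≢e = step x p (snoc ω b≢e)

at-snoc : ∀ {a b e n} (ω : Walk a b n) (b≢e : b ≢ e) k → at (snoc ω b≢e) (inject₁ k) ≡ at ω k
at-snoc stop         b≢e zero    = refl
at-snoc (step x p ω) b≢e zero    = refl
at-snoc (step x p ω) b≢e (suc k) = at-snoc ω b≢e k

unsnoc : ∀ {a e n} (ω̂ : Walk a e (suc n)) →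
         ∃[ b ] b ≢ e × Σ[ ω ∈ Walk a b n ] (∀ k → at ω̂ (inject₁ k) ≡ at ω k)
unsnoc (step x p stop) = _ , p , stop , λ { zero → refl }
unsnoc (step x p ω̂@(step _ _ _)) with b , b≢e , ω , eqs ← unsnoc ω̂ =
  b , b≢e , step x p ω , λ { zero → refl ; (suc k) → eqs k }

-- Colourings of the edge set of a cycle, two consecutive edges of which have the
-- prescribed colours e and a, are the walks from a to e: the rest of the cycle.
record CycleSystem (m : ℕ) (e a : Colour) : Set where
  field
    value     : Walk a e (suc m) → Colour → Colour
    injective : ∀ ω → Injective₃ (value ω)
    shared    : ∀ {ω ω′} i → Same i ω ω′ → value ω i ≡ value ω′ i

  -- `Constant` means that the values are given by the vertex of the cycle between the two
  -- prescribed edges, `PinnedAt k` that they are given by the vertex between the edges at the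
  -- positions `k` and `k + 1`.
  Constant : Set
  Constant = Σ[ A ∈ (Colour → Colour) ] (∀ ω i → value ω i ≡ A i)

  PinnedAt : Fin (suc m) → Colour → Colour → Set
  PinnedAt k s s′ = ∀ ω → value ω (at ω (inject₁ k)) ≡ s × value ω (at ω (suc k)) ≡ s′

  Pinned : Set
  Pinned = ∃[ k ] ∃[ s ] ∃[ s′ ] PinnedAt k s s′

module CycleBase {e a : Colour} (a≢e : a ≢ e) (S : CycleSystem 2 e a) where
  open CycleSystem

  private
    d : Colour
    d = third a e
    e≢a : e ≢ a
    e≢a = ≢-sym a≢e
    a≢d : a ≢ d
    a≢d = ≢-sym (third≢ˡ a e)
    d≢a : d ≢ a
    d≢a = third≢ˡ a e
    d≢e : d ≢ e
    d≢e = third≢ʳ a e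
    e≢d : e ≢ d
    e≢d = ≢-sym d≢e
    c : Walk a e 3 → Colour → Colour
    c = value S
    aea ada aed : Walk a e 3
    aea = step e a≢e (step a e≢a (step e a≢e stop))
    ada = step d a≢d (step a d≢a (step e a≢e stop))
    aed = step e a≢e (step d e≢d (step e d≢e stop))
    inj : ∀ {ω} → Injective₃ (c ω)
    inj {ω} = injective S ω

  data Shape (ω : Walk a e 3) : Set where
    is-aea : (∀ k → at ω k ≡ at aea k) → Shape ω
    is-ada : (∀ k → at ω k ≡ at ada k) → Shape ω
    is-aed : (∀ k → at ω k ≡ at aed k) → Shape ω

  shape : ∀ ω → Shape ω
  shape (step x p (step y q (step _ r stop))) with x ≟ᶜ e | y ≟ᶜ a
  ... | yes refl | yes refl = is-aea λ { 0F → refl ; 1F → refl ; 2F → refl ; (suc (suc (suc zero))) → refl }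
  ... | yes refl | no y≢a
    with refl ← remaining-colour a e d y a≢e a≢d e≢d y≢a r =
    is-aed λ { 0F → refl ; 1F → refl ; 2F → refl ; (suc (suc (suc zero))) → refl }
  ... | no x≢e | _ with refl ← remaining-colour a e d x a≢e a≢d e≢d (≢-sym p) x≢e
                   with refl ← remaining-colour d e a y d≢e d≢a e≢a (≢-sym q) r =
    is-ada λ { 0F → refl ; 1F → refl ; 2F → refl ; (suc (suc (suc zero))) → refl }

  ≗-value : ∀ {ω ω′} → (∀ k → at ω k ≡ at ω′ k) → ∀ i → c ω i ≡ c ω′ i
  ≗-value eq i = shared S i λ k → trans (sym (eq k)) , trans (eq k)

  ada-a : c ada a ≡ c aea a
  ada-a = shared S a (same-step keep (same-step (off d≢a e≢a) same-refl))

  aed-e : c aed e ≡ c aea e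
  aed-e = shared S e (same-step keep (same-step keep (same-step (off d≢e a≢e) same-refl)))

  pinned : ∀ k {s s′} → (∀ ω → ω ≡ aea ⊎ ω ≡ ada ⊎ ω ≡ aed →
             c ω (at ω (inject₁ k)) ≡ s × c ω (at ω (suc k)) ≡ s′) → PinnedAt S k s s′
  pinned k h ω with shape ω
  ... | is-aea eq = trans (cong (c ω) (eq (inject₁ k))) (trans (≗-value {ω} {aea} eq _) (proj₁ (h aea (inj₁ refl)))) ,
                    trans (cong (c ω) (eq (suc k))) (trans (≗-value {ω} {aea} eq _) (proj₂ (h aea (inj₁ refl))))
  ... | is-ada eq = trans (cong (c ω) (eq (inject₁ k))) (trans (≗-value {ω} {ada} eq _) (proj₁ (h ada (inj₂ (inj₁ refl))))) ,
                    trans (cong (c ω) (eq (suc k))) (trans (≗-value {ω} {ada} eq _) (proj₂ (h ada (inj₂ (inj₁ refl)))))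
  ... | is-aed eq = trans (cong (c ω) (eq (inject₁ k))) (trans (≗-value {ω} {aed} eq _) (proj₁ (h aed (inj₂ (inj₂ refl))))) ,
                    trans (cong (c ω) (eq (suc k))) (trans (≗-value {ω} {aed} eq _) (proj₂ (h aed (inj₂ (inj₂ refl)))))

  swapped : ∀ {ω ω′ x y z} → x ≢ y → x ≢ z → y ≢ z → c ω x ≡ c ω′ x → c ω y ≢ c ω′ y → c ω z ≡ c ω′ y × c ω y ≡ c ω′ z
  swapped {ω} {ω′} {x} {y} {z} x≢y x≢z y≢z eq neq =
    remaining-colour (c ω x) (c ω y) (c ω′ y) (c ω z) (≢⇒≢ inj x≢y)
      (λ q → x≢y (inj (trans (sym eq) q))) neq (≢⇒≢ inj (≢-sym x≢z)) (≢⇒≢ inj (≢-sym y≢z)) ,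
    remaining-colour (c ω′ x) (c ω′ y) (c ω′ z) (c ω y) (≢⇒≢ inj x≢y) (≢⇒≢ inj x≢z) (≢⇒≢ inj y≢z)
      (λ q → x≢y (inj (trans eq (sym q)))) neq

  -- A 4-cycle has only three walks. The walk `aea` shares the class of `a` with `ada` and that of
  -- `e` with `aed`, and in passing to either of them the two other values are kept or exchanged.
  -- The four combinations belong to the four vertices of the cycle.
  base : Constant S ⊎ Pinned S
  base with c ada e ≟ᶜ c aea e | c aed a ≟ᶜ c aea a
  ... | yes p | yes q = inj₁ (c aea , λ ω i → constant ω i (shape ω))
    where
    constant : ∀ ω i → Shape ω → c ω i ≡ c aea i
    constant ω i (is-aea eq) = ≗-value {ω} {aea} eq i
    constant ω i (is-ada eq) = trans (≗-value {ω} {ada} eq i) (agree₃ inj inj a≢e ada-a p i)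
    constant ω i (is-aed eq) = trans (≗-value {ω} {aed} eq i) (agree₃ inj inj a≢e q aed-e i)
  ... | no p | yes q with de , _ ← swapped a≢e a≢d e≢d ada-a p =
    inj₂ (0F , _ , _ , pinned 0F λ where
      _ (inj₁ refl) → refl , refl
      _ (inj₂ (inj₁ refl)) → ada-a , de
      _ (inj₂ (inj₂ refl)) → q , aed-e)
  ... | yes p | no q with da , _ ← swapped e≢a e≢d a≢d aed-e q =
    inj₂ (2F , _ , _ , pinned 2F λ where
      _ (inj₁ refl) → refl , refl
      _ (inj₂ (inj₁ refl)) → ada-a , p
      _ (inj₂ (inj₂ refl)) → da , aed-e)
  ... | no p | no q with de , _ ← swapped a≢e a≢d e≢d ada-a p | da , _ ← swapped e≢a e≢d a≢d aed-e q =
    inj₂ (1F , _ , _ , pinned 1F λ where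
      _ (inj₁ refl) → refl , refl
      _ (inj₂ (inj₁ refl)) → de , ada-a
      _ (inj₂ (inj₂ refl)) → aed-e , da)

-- Induction step: the walks a, d, … form a cycle system of one edge less.  On the
-- remaining walks a, e, … the values are compared with those by moves.
module CycleStep {n : ℕ} {e a : Colour} (a≢e : a ≢ e) (S : CycleSystem (3 ℕ.+ n) e a) where
  open CycleSystem

  private
    d : Colour
    d = third a e
    e≢a : e ≢ a
    e≢a = ≢-sym a≢e
    a≢d : a ≢ d
    a≢d = ≢-sym (third≢ˡ a e)
    d≢a : d ≢ a
    d≢a = third≢ˡ a e
    d≢e : d ≢ e
    d≢e = third≢ʳ a e
    e≢d : e ≢ d
    e≢d = ≢-sym d≢e
    Near Far : Set
    Near = Walk d e (3 ℕ.+ n)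
    Far  = Walk e e (3 ℕ.+ n)
    near : Near → Walk a e (4 ℕ.+ n)
    near τ = step d a≢d τ
    far : Far → Walk a e (4 ℕ.+ n)
    far τ = step e a≢e τ
    cⁿ : Near → Colour → Colour
    cⁿ τ = value S (near τ)
    cᶠ : Far → Colour → Colour
    cᶠ τ = value S (far τ)
    injᶠ : ∀ {τ} → Injective₃ (cᶠ τ)
    injᶠ {τ} = injective S (far τ)
    sharedᶠ : ∀ {τ τ′} i → Same i τ τ′ → cᶠ τ i ≡ cᶠ τ′ i
    sharedᶠ i s = shared S i (same-step keep s)

  contracted : CycleSystem (2 ℕ.+ n) e d
  contracted = record
    { value = cⁿ ; injective = λ τ → injective S (near τ) ; shared = λ i s → shared S i (same-step keep s) }

  near-or-far : ∀ {P : Walk a e (4 ℕ.+ n) → Set} → (∀ p τ → P (step d p τ)) → (∀ p τ → P (step e p τ)) → ∀ ω → P ω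
  near-or-far N F (step x p τ) with x ≟ᶜ e
  ... | yes refl = F p τ
  ... | no x≢e with refl ← remaining-colour a e d x a≢e a≢d e≢d (≢-sym p) x≢e = N p τ

  Flip : Far → Set
  Flip τ = Σ[ τ′ ∈ Near ] Same a τ τ′

  flipped : ∀ {τ} ((τ′ , _) : Flip τ) → cᶠ τ a ≡ cⁿ τ′ a
  flipped (_ , s) = shared S a (same-step keep s)

  flip-a : ∀ (p : e ≢ a) τ → Flip (step a p τ)
  flip-a p τ = step a d≢a τ , same-step (off e≢a d≢a) same-refl

  flip-da : ∀ (p : e ≢ d) (q : d ≢ a) τ → Flip (step d p (step a q τ))
  flip-da p q τ = step e d≢e (step a e≢a τ) , same-step (off e≢a d≢a) (same-step (off d≢a e≢a) same-refl)

  flip-dea : ∀ (p : e ≢ d) (q : d ≢ e) (r : e ≢ a) τ → Flip (step d p (step e q (step a r τ)))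
  flip-dea p q r τ = step e d≢e (step d e≢d (step a d≢a τ)) ,
    same-step (off e≢a d≢a) (same-step (off d≢a e≢a) (same-step (off e≢a d≢a) same-refl))

  -- As much of a far walk after its initial `e` as is needed to compare it. If an `a` occurs,
  -- exchanging `e` and `d` in front of it leads to a near walk with the same class of `a`; a walk
  -- of pattern `ded` is compared with other far walks instead.
  data Pattern : Far → Set where
    ad  : ∀ p q τ → Pattern (step a p (step d q τ))
    da  : ∀ p q τ → Pattern (step d p (step a q τ))
    aed : ∀ p q r τ → Pattern (step a p (step e q (step d r τ)))
    dea : ∀ p q r τ → Pattern (step d p (step e q (step a r τ)))
    aea : ∀ p q r τ → Pattern (step a p (step e q (step a r τ)))
    ded : ∀ p q r τ → Pattern (step d p (step e q (step d r τ)))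

  pattern? : ∀ τ → Pattern τ
  pattern? (step x p (step y q τ)) with x ≟ᶜ a
  ... | yes refl with y ≟ᶜ e
  ...   | no y≢e with refl ← remaining-colour a e d y a≢e a≢d e≢d (≢-sym q) y≢e = ad p q τ
  pattern? (step x p (step y q (step z r τ))) | yes refl | yes refl with z ≟ᶜ a
  ...     | yes refl = aea p q r τ
  ...     | no z≢a with refl ← remaining-colour a e d z a≢e a≢d e≢d z≢a (≢-sym r) = aed p q r τ
  pattern? (step x p (step y q τ)) | no x≢a
    with refl ← remaining-colour a e d x a≢e a≢d e≢d x≢a (≢-sym p) with y ≟ᶜ a
  ...   | yes refl = da p q τ
  ...   | no y≢a with refl ← remaining-colour a d e y a≢d a≢e d≢e y≢a (≢-sym q) with τ
  ...     | step z r τ′ with z ≟ᶜ a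
  ...       | yes refl = dea p q r τ′
  ...       | no z≢a with refl ← remaining-colour a e d z a≢e a≢d e≢d z≢a (≢-sym r) = ded p q r τ′

  module ConstantCase (A : Colour → Colour) (A-const : ∀ τ i → cⁿ τ i ≡ A i) where
    flip⇒A : ∀ {τ} → Flip τ → cᶠ τ a ≡ A a
    flip⇒A f = trans (flipped f) (A-const (proj₁ f) a)

    at-a : ∀ τ → cᶠ τ a ≡ A a
    at-a τ with pattern? τ
    ... | ad p q σ    = flip⇒A (flip-a p _)
    ... | da p q σ    = flip⇒A (flip-da p q σ)
    ... | aed p q r σ = flip⇒A (flip-a p _)
    ... | dea p q r σ = flip⇒A (flip-dea p q r σ)
    ... | aea p q r σ = flip⇒A (flip-a p _)
    -- The far walks `τ₁` and `τ₂` share the classes of `e` and `d`, respectively, with `τ`. Both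
    -- have the value `A a` at `a`, so `τ` takes this value neither at `e` nor at `d`.
    ... | ded p q r σ = sym (remaining-colour (cᶠ τ e) (cᶠ τ d) (cᶠ τ a) (A a)
        (≢⇒≢ injᶠ e≢d) (≢⇒≢ injᶠ e≢a) (≢⇒≢ injᶠ d≢a)
        (λ eq → ≢⇒≢ (injᶠ {τ₁}) a≢e (trans (at-τ₁) (trans eq (sharedᶠ e same₁))))
        (λ eq → ≢⇒≢ (injᶠ {τ₂}) a≢d (trans (at-τ₂) (trans eq (sharedᶠ d same₂)))))
      where
      τ₁ τ₂ : Far
      τ₁ = step a e≢a (step e a≢e (step d r σ))
      τ₂ = step d p (step a d≢a (step d a≢d σ))
      at-τ₁ : cᶠ τ₁ a ≡ A a
      at-τ₁ = flip⇒A (flip-a e≢a _)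
      at-τ₂ : cᶠ τ₂ a ≡ A a
      at-τ₂ = flip⇒A (flip-da p d≢a _)
      same₁ : Same e (step d p (step e q (step d r σ))) τ₁
      same₁ = same-step keep (same-step (off d≢e a≢e) same-refl)
      same₂ : Same d (step d p (step e q (step d r σ))) τ₂
      same₂ = same-step keep (same-step keep (same-step (off e≢d a≢d) same-refl))

    -- The value at `a` is known, so one further common class determines all values. As the far
    -- walks are connected by moves of this kind, their values do not vary.
    at-e-move : ∀ {τ τ′} → Move a τ τ′ → cᶠ τ e ≡ cᶠ τ′ e
    at-e-move {τ} {τ′} (i , i≢a , s) =
      agree₃ injᶠ injᶠ (≢-sym i≢a) (trans (at-a τ) (sym (at-a τ′))) (sharedᶠ i s) e

    at-e : ∀ {τ τ′} → Star (Move a) τ τ′ → cᶠ τ e ≡ cᶠ τ′ e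
    at-e ε       = refl
    at-e (m ◅ r) = trans (at-e-move m) (at-e r)

    τ₀ : Far
    τ₀ = anyWalk (suc n) e e

    at-e-τ₀ : ∀ τ → cᶠ τ e ≡ cᶠ τ₀ e
    at-e-τ₀ τ = at-e (connect _ e≢a e≢a τ τ₀)

    A-inj : Injective₃ A
    A-inj {i} {j} eq = injective S (near τ) (trans (A-const τ i) (trans eq (sym (A-const τ j))))
      where
      τ : Near
      τ = anyWalk (suc n) d e

    result : Constant S ⊎ Pinned S
    result with cᶠ τ₀ e ≟ᶜ A e
    ... | yes eq = inj₁ (A , near-or-far (λ p τ i → trans (shared S i (same-step keep same-refl)) (A-const τ i))
            (λ p τ i → trans (shared S i (same-step keep same-refl))
              (agree₃ injᶠ A-inj a≢e (at-a τ) (trans (at-e-τ₀ τ) eq) i)))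
    -- The far values arise from `A` by exchanging those of `e` and `d`. The second edge has colour
    -- `d` in near and `e` in far walks, so its class always has the value `A d`.
    ... | no neq = inj₂ (zero , A a , A d , near-or-far
            (λ p τ → trans (shared S a (same-step keep same-refl)) (A-const τ a) ,
                     trans (shared S d (same-step keep same-refl)) (A-const τ d))
            (λ p τ → trans (shared S a (same-step keep same-refl)) (at-a τ) ,
                     trans (shared S e (same-step keep same-refl))
                       (remaining-colour (A a) (A e) (A d) (cᶠ τ e) (≢⇒≢ A-inj a≢e) (≢⇒≢ A-inj a≢d) (≢⇒≢ A-inj e≢d)
                         (λ q → ≢⇒≢ (injᶠ {τ}) e≢a (trans q (sym (at-a τ))))
                         (λ q → neq (trans (sym (at-e-τ₀ τ)) q)))))

  module PinnedCase (k : Fin (3 ℕ.+ n)) (s s′ : Colour) (pin : PinnedAt contracted k s s′) where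
    s≢s′ : s ≢ s′
    s≢s′ eq = at-≢ τ k (injective S (near τ) (trans (proj₁ (pin τ)) (trans eq (sym (proj₂ (pin τ))))))
      where
      τ : Near
      τ = anyWalk (suc n) d e

    -- If the pinned edges have the colours `x` and `y`, injectivity forces these values on all
    -- three classes. Extending the definition to far walks gives the candidate with which their
    -- values are compared.
    θ : Colour → Colour → Colour → Colour
    θ x y i with i ≟ᶜ x | i ≟ᶜ y
    ... | yes _ | _     = s
    ... | no _  | yes _ = s′
    ... | no _  | no _  = third s s′

    θ-x : ∀ x y → θ x y x ≡ s
    θ-x x y with x ≟ᶜ x | x ≟ᶜ y
    ... | yes _ | _ = refl
    ... | no ¬p | _ = ⊥-elim (¬p refl)

    θ-y : ∀ x y → x ≢ y → θ x y y ≡ s′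
    θ-y x y x≢y with y ≟ᶜ x | y ≟ᶜ y
    ... | yes p | _     = ⊥-elim (x≢y (sym p))
    ... | no _  | yes _ = refl
    ... | no _  | no ¬p = ⊥-elim (¬p refl)

    θ-cong : ∀ {x y x′ y′ i j} → x ≡ i ⇆ x′ ≡ j → y ≡ i ⇆ y′ ≡ j → θ x y i ≡ θ x′ y′ j
    θ-cong {x} {y} {x′} {y′} {i} {j} (f , f⁻) (g , g⁻) with i ≟ᶜ x | i ≟ᶜ y | j ≟ᶜ x′ | j ≟ᶜ y′
    ... | yes p | _     | yes _ | _     = refl
    ... | yes p | _     | no q  | _     = ⊥-elim (q (sym (f (sym p))))
    ... | no p  | _     | yes q | _     = ⊥-elim (p (sym (f⁻ (sym q))))
    ... | no _  | yes _ | no _  | yes _ = refl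
    ... | no _  | yes p | no _  | no q  = ⊥-elim (q (sym (g (sym p))))
    ... | no _  | no p  | no _  | yes q = ⊥-elim (p (sym (g⁻ (sym q))))
    ... | no _  | no _  | no _  | no _  = refl

    θ-injective : ∀ {x y} → x ≢ y → Injective₃ (θ x y)
    θ-injective {x} {y} x≢y {i} {j} eq with i ≟ᶜ x | i ≟ᶜ y | j ≟ᶜ x | j ≟ᶜ y
    ... | yes p | _     | yes q | _     = trans p (sym q)
    ... | yes _ | _     | no _  | yes _ = ⊥-elim (s≢s′ eq)
    ... | yes _ | _     | no _  | no _  = ⊥-elim (third≢ˡ s s′ (sym eq))
    ... | no _  | yes _ | yes _ | _     = ⊥-elim (s≢s′ (sym eq))
    ... | no _  | yes p | no _  | yes q = trans p (sym q)
    ... | no _  | yes _ | no _  | no _  = ⊥-elim (third≢ʳ s s′ (sym eq))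
    ... | no _  | no _  | yes _ | _     = ⊥-elim (third≢ˡ s s′ eq)
    ... | no _  | no _  | no _  | yes _ = ⊥-elim (third≢ʳ s s′ eq)
    ... | no p  | no p′ | no q  | no q′ =
      trans (remaining-colour x y (third x y) i x≢y (≢-sym (third≢ˡ x y)) (≢-sym (third≢ʳ x y)) p p′)
        (sym (remaining-colour x y (third x y) j x≢y (≢-sym (third≢ˡ x y)) (≢-sym (third≢ʳ x y)) q q′))

    Θ : ∀ {b} → Walk b e (3 ℕ.+ n) → Colour → Colour
    Θ τ = θ (at τ (inject₁ k)) (at τ (suc k))

    Θ-start : ∀ {b} (τ : Walk b e (3 ℕ.+ n)) → Θ τ (at τ (inject₁ k)) ≡ s
    Θ-start τ = θ-x (at τ (inject₁ k)) (at τ (suc k))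

    Θ-end : ∀ {b} (τ : Walk b e (3 ℕ.+ n)) → Θ τ (at τ (suc k)) ≡ s′
    Θ-end τ = θ-y (at τ (inject₁ k)) (at τ (suc k)) (at-≢ τ k)

    Θ-same : ∀ {b b′} {τ : Walk b e _} {τ′ : Walk b′ e _} i → Same i τ τ′ → Θ τ i ≡ Θ τ′ i
    Θ-same i s = θ-cong (s (inject₁ k)) (s (suc k))

    Θ-inj : ∀ {b} {τ : Walk b e (3 ℕ.+ n)} → Injective₃ (Θ τ)
    Θ-inj {τ = τ} = θ-injective (at-≢ τ k)

    Θ-near : ∀ τ i → cⁿ τ i ≡ Θ τ i
    Θ-near τ = agree₃ (injective S (near τ)) (Θ-inj {τ = τ}) (at-≢ τ k)
      (trans (proj₁ (pin τ)) (sym (Θ-start τ))) (trans (proj₂ (pin τ)) (sym (Θ-end τ)))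

    Agree : Far → Set
    Agree τ = ∀ i → cᶠ τ i ≡ Θ τ i

    flip⇒Θ : ∀ {τ} → Flip τ → cᶠ τ a ≡ Θ τ a
    flip⇒Θ {τ} f@(τ′ , s) = trans (flipped f) (trans (Θ-near τ′ a) (sym (Θ-same {τ = τ} {τ′ = τ′} a s)))

    same⇒Θ : ∀ {τ τ′} i → Same i τ τ′ → Agree τ′ → cᶠ τ i ≡ Θ τ i
    same⇒Θ {τ} {τ′} i s agree = trans (sharedᶠ i s) (trans (agree i) (sym (Θ-same {τ = τ} {τ′ = τ′} i s)))

    two⇒Agree : ∀ {τ i j} → i ≢ j → cᶠ τ i ≡ Θ τ i → cᶠ τ j ≡ Θ τ j → Agree τ
    two⇒Agree {τ} = agree₃ injᶠ (Θ-inj {τ = τ})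

    swap : Colour → Colour
    swap x with x ≟ᶜ a | x ≟ᶜ d
    ... | yes _ | _     = d
    ... | no _  | yes _ = a
    ... | no _  | no _  = e

    swap-a : swap a ≡ d
    swap-a with a ≟ᶜ a | a ≟ᶜ d
    ... | yes _ | _ = refl
    ... | no ¬p | _ = ⊥-elim (¬p refl)

    swap-d : swap d ≡ a
    swap-d with d ≟ᶜ a | d ≟ᶜ d
    ... | yes p | _     = ⊥-elim (d≢a p)
    ... | no _  | yes _ = refl
    ... | no _  | no ¬p = ⊥-elim (¬p refl)

    swap-e : swap e ≡ e
    swap-e with e ≟ᶜ a | e ≟ᶜ d
    ... | yes p | _     = ⊥-elim (e≢a p)
    ... | no _  | yes p = ⊥-elim (e≢d p)
    ... | no _  | no _  = refl

    swap-swap : ∀ x → swap (swap x) ≡ x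
    swap-swap x with x ≟ᶜ a | x ≟ᶜ d
    ... | yes refl | _        = swap-d
    ... | no _     | yes refl = swap-a
    ... | no p     | no q     = trans swap-e (sym (remaining-colour a d e x a≢d a≢e d≢e p q))

    swap-inj : Injective₃ swap
    swap-inj {i} {j} eq = trans (sym (swap-swap i)) (trans (cong swap eq) (swap-swap j))

    swapWalk : ∀ {b c m} → swap b ≡ c → (τ : Walk b e m) → Σ[ τ′ ∈ Walk c e m ] (∀ j → at τ′ j ≡ swap (at τ j))
    swapWalk eq stop with refl ← trans (sym eq) swap-e = stop , λ { zero → sym eq }
    swapWalk eq (step x p τ) with τ′ , eqs ← swapWalk refl τ =
      step (swap x) (λ q → p (swap-inj (trans eq q))) τ′ , λ { zero → sym eq ; (suc j) → eqs j }

    -- τ and τ′ differ by exchanging a and d, which changes the values Θ, but not that at e.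
    swapped⇒Agree : ∀ {τ τ′} → Flip τ → Flip τ′ → (∀ j → at τ′ j ≡ swap (at τ j)) → Agree τ × Agree τ′
    swapped⇒Agree {τ} {τ′} f f′ sw = agree , two⇒Agree {τ′} a≢e (flip⇒Θ f′)
        (trans (sym (sharedᶠ e same)) (trans (agree e) (Θ-same {τ = τ} {τ′ = τ′} e same)))
      where
      same : Same e τ τ′
      same j = (λ eq → trans (sw j) (trans (cong swap eq) swap-e)) ,
               (λ eq → swap-inj (trans (trans (sym (sw j)) eq) (sym swap-e)))
      Θ-swap : Θ τ′ a ≡ Θ τ d
      Θ-swap = θ-cong (⇆ (inject₁ k)) (⇆ (suc k))
        where
        ⇆ : ∀ j → at τ′ j ≡ a ⇆ at τ j ≡ d
        ⇆ j = (λ eq → swap-inj (trans (trans (sym (sw j)) eq) (sym swap-d))) ,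
              (λ eq → trans (sw j) (trans (cong swap eq) swap-d))
      agree : Agree τ
      agree = two⇒Agree {τ} a≢e (flip⇒Θ f)
        (remaining-colour (Θ τ a) (Θ τ d) (Θ τ e) (cᶠ τ e)
          (≢⇒≢ (Θ-inj {τ = τ}) a≢d) (≢⇒≢ (Θ-inj {τ = τ}) a≢e) (≢⇒≢ (Θ-inj {τ = τ}) d≢e)
          (λ eq → ≢⇒≢ (injᶠ {τ}) e≢a (trans eq (sym (flip⇒Θ f))))
          (λ eq → ≢⇒≢ (injᶠ {τ′}) e≢a (trans (sym (sharedᶠ e same)) (trans eq (trans (sym Θ-swap) (sym (flip⇒Θ f′)))))))

    agree-ad-da : ∀ p q σ p′ q′ σ′ → (∀ j → at σ′ j ≡ swap (at σ j)) →
                  Agree (step a p (step d q σ)) × Agree (step d p′ (step a q′ σ′))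
    agree-ad-da p q σ p′ q′ σ′ eqs = swapped⇒Agree (flip-a p _) (flip-da p′ q′ σ′)
      λ { zero → sym swap-e ; (suc zero) → sym swap-a ; (suc (suc j)) → eqs j }

    agree-aed-dea : ∀ p q r σ p′ q′ r′ σ′ → (∀ j → at σ′ j ≡ swap (at σ j)) →
                    Agree (step a p (step e q (step d r σ))) × Agree (step d p′ (step e q′ (step a r′ σ′)))
    agree-aed-dea p q r σ p′ q′ r′ σ′ eqs = swapped⇒Agree (flip-a p _) (flip-dea p′ q′ r′ σ′)
      λ { zero → sym swap-e ; (suc zero) → sym swap-a ; (suc (suc zero)) → sym swap-e ; (suc (suc (suc j))) → eqs j }

    swap-back : ∀ {b c m} {τ : Walk b e m} {τ′ : Walk c e m} →
                (∀ j → at τ′ j ≡ swap (at τ j)) → (∀ j → at τ j ≡ swap (at τ′ j))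
    swap-back eqs j = trans (sym (swap-swap _)) (cong swap (sym (eqs j)))

    agree-da : ∀ p q σ → Agree (step d p (step a q σ))
    agree-da p q σ with σ′ , eqs ← swapWalk swap-a σ =
      proj₂ (agree-ad-da e≢a a≢d σ′ p q σ (swap-back {τ = σ} {τ′ = σ′} eqs))

    agree-aed : ∀ p q r σ → Agree (step a p (step e q (step d r σ)))
    agree-aed p q r σ with σ′ , eqs ← swapWalk swap-d σ = proj₁ (agree-aed-dea p q r σ e≢d d≢e e≢a σ′ eqs)

    agree-dea : ∀ p q r σ → Agree (step d p (step e q (step a r σ)))
    agree-dea p q r σ with σ′ , eqs ← swapWalk swap-a σ =
      proj₂ (agree-aed-dea e≢a a≢e e≢d σ′ p q r σ (swap-back {τ = σ} {τ′ = σ′} eqs))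

    agree : ∀ τ → Agree τ
    agree τ with pattern? τ
    ... | ad p q σ with σ′ , eqs ← swapWalk swap-d σ = proj₁ (agree-ad-da p q σ e≢d d≢a σ′ eqs)
    ... | da p q σ    = agree-da p q σ
    ... | aed p q r σ = agree-aed p q r σ
    ... | dea p q r σ = agree-dea p q r σ
    -- The last two patterns are reduced to settled ones: `aea` shares a class with `dea`, and `ded`
    -- shares one with `aed` and another with `da`.
    ... | aea p q r σ = two⇒Agree {τ} a≢e (flip⇒Θ (flip-a p _))
      (same⇒Θ {τ} {step d e≢d (step e d≢e (step a r σ))} e
        (same-step keep (same-step (off a≢e d≢e) same-refl)) (agree-dea e≢d d≢e r σ))
    ... | ded p q r σ = two⇒Agree {τ} e≢d
      (same⇒Θ {τ} {step a e≢a (step e a≢e (step d r σ))} e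
        (same-step keep (same-step (off d≢e a≢e) same-refl)) (agree-aed e≢a a≢e r σ))
      (same⇒Θ {τ} {step d p (step a d≢a (step d a≢d σ))} d
        (same-step keep (same-step keep (same-step (off e≢d a≢d) same-refl))) (agree-da p d≢a (step d a≢d σ)))

    result : Pinned S
    result = suc k , s , s′ , near-or-far
      (λ p τ → trans (shared S _ (same-step keep same-refl)) (proj₁ (pin τ)) ,
               trans (shared S _ (same-step keep same-refl)) (proj₂ (pin τ)))
      (λ p τ → trans (shared S _ (same-step keep same-refl)) (trans (agree τ _) (Θ-start τ)) ,
               trans (shared S _ (same-step keep same-refl)) (trans (agree τ _) (Θ-end τ)))

constant-or-pinned : ∀ m {e a} → a ≢ e → (S : CycleSystem (suc (suc m)) e a) →
                     CycleSystem.Constant S ⊎ CycleSystem.Pinned S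
constant-or-pinned zero    a≢e S = CycleBase.base a≢e S
constant-or-pinned (suc m) {e} {a} a≢e S with constant-or-pinned m (third≢ʳ a e) (CycleStep.contracted a≢e S)
... | inj₁ (A , A-const)       = CycleStep.ConstantCase.result a≢e S A A-const
... | inj₂ (k , s , s′ , pin) = inj₂ (CycleStep.PinnedCase.result a≢e S k s s′ pin)

-- Homogeneous linear systems over ℤ

dot : ∀ {n} → (Fin n → ℤ) → (Fin n → ℤ) → ℤ
dot a x = sum (λ j → a j * x j)

sum-zero : ∀ {n} (f : Fin n → ℤ) → (∀ i → f i ≡ 0ℤ) → sum f ≡ 0ℤ
sum-zero {n} f f≡0 = trans (sum-cong-≗ f≡0) (sum-replicate-zero n)

sum-single : ∀ {n} (f : Fin n → ℤ) i → (∀ j → j ≢ i → f j ≡ 0ℤ) → sum f ≡ f i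
sum-single {suc n} f i f≡0 = trans (sum-remove {i = i} f)
  (trans (cong (f i +_) (sum-zero (f ∘ punchIn i) λ j → f≡0 _ (punchInᵢ≢i i j))) (ℤₚ.+-identityʳ (f i)))

sum-neg : ∀ {n} (f : Fin n → ℤ) → sum (λ i → - f i) ≡ - sum f
sum-neg {zero}  f = refl
sum-neg {suc n} f = trans (cong (- f zero +_) (sum-neg (f ∘ suc))) (sym (ℤₚ.neg-distrib-+ (f zero) _))

module Elimination {n : ℕ} (r : Fin (suc n) → ℤ) (j : Fin (suc n)) where
  reduce : (Fin (suc n) → ℤ) → Fin n → ℤ
  reduce a l = r j * a (punchIn j l) - a j * r (punchIn j l)

  -- Solving for the pivot coordinate would need a division by `r j`. Instead all other coordinates
  -- are multiplied by it, which keeps a nonzero solution nonzero as long as the pivot is nonzero.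
  extend : (Fin n → ℤ) → Fin (suc n) → ℤ
  extend x = insertAt (λ l → r j * x l) j (- sum (λ l → r (punchIn j l) * x l))

  dot-extend : ∀ a x → dot a (extend x) ≡ dot (reduce a) x
  dot-extend a x = begin
    dot a (extend x)
      ≡⟨ sum-remove {i = j} (λ k → a k * extend x k) ⟩
    a j * extend x j + sum (λ l → a (punchIn j l) * extend x (punchIn j l))
      ≡⟨ cong₂ _+_ (cong (a j *_) (insertAt-lookup _ j _))
                   (sum-cong-≗ λ l → cong (a (punchIn j l) *_) (insertAt-punchIn _ j _ l)) ⟩
    a j * - R + sum (λ l → a (punchIn j l) * (r j * x l))
      ≡⟨ cong (_+ sum (λ l → a (punchIn j l) * (r j * x l)))
           (trans (sym (ℤₚ.neg-distribʳ-* (a j) R)) (trans (cong -_ (*-distribˡ-sum (a j) (λ l → r (punchIn j l) * x l))) (sym (sum-neg {n} (λ l → a j * (r (punchIn j l) * x l)))))) ⟩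
    sum (λ l → - (a j * (r (punchIn j l) * x l))) + sum (λ l → a (punchIn j l) * (r j * x l))
      ≡⟨ ∑-distrib-+ (λ l → - (a j * (r (punchIn j l) * x l))) _ ⟨
    sum (λ l → - (a j * (r (punchIn j l) * x l)) + a (punchIn j l) * (r j * x l))
      ≡⟨ sum-cong-≗ (λ l → rearrange (r j) (a j) (a (punchIn j l)) (r (punchIn j l)) (x l)) ⟩
    dot (reduce a) x ∎
    where
    open ≡-Reasoning
    R : ℤ
    R = sum (λ l → r (punchIn j l) * x l)
    rearrange : ∀ p q s t u → - (q * (t * u)) + s * (p * u) ≡ (p * s - q * t) * u
    rearrange = solve-∀

  dot-pivot : ∀ x → dot r (extend x) ≡ 0ℤ
  dot-pivot x = trans (dot-extend r x) (sum-zero _ λ l → cancel (r j) (r (punchIn j l)) (x l))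
    where
    cancel : ∀ p q u → (p * q - p * q) * u ≡ 0ℤ
    cancel = solve-∀

abstract
  -- Gaussian elimination with more unknowns than equations. Only the rows in `p` are imposed, so
  -- that the rows of half-edges can be left out without renumbering the edges.
  nontrivial-solution : ∀ {k} (p : Subset k) {n} (A : Fin k → Fin n → ℤ) → ∣ p ∣ < n →
                        Σ[ x ∈ (Fin n → ℤ) ] (∃[ j ] x j ≢ 0ℤ) × (∀ i → i ∈ p → dot (A i) x ≡ 0ℤ)
  nontrivial-solution [] {suc n} A _ = (λ _ → 1ℤ) , (zero , λ ()) , λ ()
  nontrivial-solution (outside ∷ p) A p<n with x , x≢0 , solves ← nontrivial-solution p (A ∘ suc) p<n =
    x , x≢0 , λ { (suc i) (there i∈p) → solves i i∈p }
  nontrivial-solution (inside ∷ p) {suc n} A (s≤s p<n) with any? (λ j → ¬? (A zero j ℤₚ.≟ 0ℤ))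
  ... | no ¬pivot with x , x≢0 , solves ← nontrivial-solution p (A ∘ suc) (ℕₚ.m≤n⇒m≤1+n p<n) =
    x , x≢0 , λ where
      zero    _           → sum-zero _ λ j → cong (_* x j)
        (decidable-stable (A zero j ℤₚ.≟ 0ℤ) (λ neq → ¬pivot (j , neq)))
      (suc i) (there i∈p) → solves i i∈p
  ... | yes (j , r≢0) with x , (l , x≢0) , solves ← nontrivial-solution p (λ i → Elimination.reduce (A zero) j (A (suc i))) p<n =
    extend x , (punchIn j l , extend≢0) , λ where
      zero    _           → dot-pivot x
      (suc i) (there i∈p) → trans (dot-extend (A (suc i)) x) (solves i i∈p)
    where
    open Elimination (A zero) j using (extend; dot-extend; dot-pivot)
    extend≢0 : extend x (punchIn j l) ≢ 0ℤ
    extend≢0 eq with ℤₚ.i*j≡0⇒i≡0∨j≡0 (A zero j) (trans (sym (insertAt-punchIn _ j _ l)) eq)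
    ... | inj₁ p = r≢0 p
    ... | inj₂ q = x≢0 q

sum-squares≡0 : ∀ {n} (f : Fin n → ℤ) → sum (λ i → f i * f i) ≡ 0ℤ → ∀ i → f i ≡ 0ℤ
sum-squares≡0 {suc n} f eq = λ where
    zero    → [ id , id ]′ (ℤₚ.i*j≡0⇒i≡0∨j≡0 (f zero) (proj₁ both≡0))
    (suc i) → sum-squares≡0 (f ∘ suc) (proj₂ both≡0) i
  where
  square≥0 : ∀ i → 0ℤ ℤ.≤ i * i
  square≥0 (ℤ.+ n)    = subst (0ℤ ℤ.≤_) (ℤₚ.pos-* n n) (ℤ.+≤+ z≤n)
  square≥0 ℤ.-[1+ n ] = ℤ.+≤+ z≤n
  nonneg : ∀ {n} (g : Fin n → ℤ) → 0ℤ ℤ.≤ sum (λ i → g i * g i)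
  nonneg {zero}  g = ℤₚ.≤-refl
  nonneg {suc n} g = ℤₚ.+-mono-≤ (square≥0 (g zero)) (nonneg (g ∘ suc))
  nonneg-sum≡0 : ∀ {a b} → 0ℤ ℤ.≤ a → 0ℤ ℤ.≤ b → a + b ≡ 0ℤ → a ≡ 0ℤ × b ≡ 0ℤ
  nonneg-sum≡0 {ℤ.+ zero} {ℤ.+ zero} _ _ _ = refl , refl
  both≡0 : f zero * f zero ≡ 0ℤ × sum (λ i → f (suc i) * f (suc i)) ≡ 0ℤ
  both≡0 = nonneg-sum≡0 (square≥0 (f zero)) (nonneg (f ∘ suc)) eq

-- Vertices and edges of a cubic graph

record Enumeration {n} (p : Subset n) (k : ℕ) : Set where
  field
    elem      : Fin k → Fin n
    elem∈     : ∀ i → elem i ∈ p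
    injective : ∀ {i j} → elem i ≡ elem j → i ≡ j
    complete  : ∀ {x} → x ∈ p → ∃[ i ] elem i ≡ x

enumerate : ∀ {n} (p : Subset n) → Enumeration p ∣ p ∣
enumerate [] = record { elem = λ () ; elem∈ = λ () ; injective = λ { {()} } ; complete = λ () }
enumerate (outside ∷ p) = record
  { elem      = suc ∘ elem
  ; elem∈     = there ∘ elem∈
  ; injective = injective ∘ suc-injective
  ; complete  = λ { (there x∈p) → proj₁ (complete x∈p) , cong suc (proj₂ (complete x∈p)) }
  }
  where open Enumeration (enumerate p)
enumerate (inside ∷ p) = record
  { elem      = λ { zero → zero ; (suc i) → suc (elem i) }
  ; elem∈     = λ { zero → here ; (suc i) → there (elem∈ i) }
  ; injective = λ { {zero} {zero} _ → refl ; {suc i} {suc j} eq → cong suc (injective (suc-injective eq)) }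
  ; complete  = λ { here → zero , refl ; (there x∈p) → suc (proj₁ (complete x∈p)) , cong suc (proj₂ (complete x∈p)) }
  }
  where open Enumeration (enumerate p)

⟦_⟧ : ∀ {n} {P : Fin n → Set} → (∀ i → Dec (P i)) → Subset n
⟦ P? ⟧ = tabulate (does ∘ P?)

∈⟦⟧⁺ : ∀ {n} {P : Fin n → Set} (P? : ∀ i → Dec (P i)) {i} → P i → i ∈ ⟦ P? ⟧
∈⟦⟧⁺ P? {i} Pi = lookup⇒[]= i _ (trans (lookup∘tabulate _ i) (dec-true (P? i) Pi))

∈⟦⟧⁻ : ∀ {n} {P : Fin n → Set} (P? : ∀ i → Dec (P i)) {i} → i ∈ ⟦ P? ⟧ → P i
∈⟦⟧⁻ P? {i} i∈ with P? i | trans (sym (lookup∘tabulate (does ∘ P?) i)) ([]=⇒lookup i∈)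
... | yes Pi | _ = Pi
... | no _   | ()

module GraphKit (G : CubicGraph) where
  open CubicGraph G public hiding (Connected; TriangleFree)

  infix 4 _∼_
  _∼_ : Vertex → Edge → Set
  v ∼ e = v ∈ ends e

  record Claw (v : Vertex) (a b c : Edge) : Set where
    field
      a≢b  : a ≢ b
      a≢c  : a ≢ c
      b≢c  : b ≢ c
      v∼a  : v ∼ a
      v∼b  : v ∼ b
      v∼c  : v ∼ c
      only : ∀ {e} → v ∼ e → e ≡ a ⊎ e ≡ b ⊎ e ≡ c

  ∈edgesAt : ∀ {v e} → v ∼ e → e ∈ edgesAt v
  ∈edgesAt {v} {e} v∼e = lookup⇒[]= e (edgesAt v) (trans (lookup∘tabulate _ e) ([]=⇒lookup v∼e))

  ∈edgesAt⁻ : ∀ {v e} → e ∈ edgesAt v → v ∼ e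
  ∈edgesAt⁻ {v} {e} e∈ = lookup⇒[]= v (ends e) (trans (sym (lookup∘tabulate _ e)) ([]=⇒lookup e∈))

  abstract
    claw : ∀ v → ∃[ a ] ∃[ b ] ∃[ c ] Claw v a b c
    claw v with E ← subst (Enumeration (edgesAt v)) (cubic v) (enumerate (edgesAt v)) = elem 0F , elem 1F , elem 2F , record
      { a≢b = λ eq → 0≢1 (injective eq) ; a≢c = λ eq → 0≢2 (injective eq) ; b≢c = λ eq → 1≢2 (injective eq)
      ; v∼a = ∈edgesAt⁻ (elem∈ 0F) ; v∼b = ∈edgesAt⁻ (elem∈ 1F) ; v∼c = ∈edgesAt⁻ (elem∈ 2F)
      ; only = λ v∼e → cases (complete (∈edgesAt v∼e)) }
      where
      open Enumeration E
      0≢1 : _≢_ {A = Fin 3} 0F 1F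
      0≢1 ()
      0≢2 : _≢_ {A = Fin 3} 0F 2F
      0≢2 ()
      1≢2 : _≢_ {A = Fin 3} 1F 2F
      1≢2 ()
      cases : ∀ {e} → ∃[ i ] elem i ≡ e → e ≡ elem 0F ⊎ e ≡ elem 1F ⊎ e ≡ elem 2F
      cases (0F , refl) = inj₁ refl
      cases (1F , refl) = inj₂ (inj₁ refl)
      cases (2F , refl) = inj₂ (inj₂ refl)

    rotate : ∀ {v a b c} → Claw v a b c → Claw v b c a
    rotate K = record
      { a≢b = b≢c ; a≢c = ≢-sym a≢b ; b≢c = ≢-sym a≢c ; v∼a = v∼b ; v∼b = v∼c ; v∼c = v∼a
      ; only = λ v∼e → [ inj₂ ∘ inj₂ , [ inj₁ , inj₂ ∘ inj₁ ]′ ]′ (only v∼e) }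
      where open Claw K

    transpose : ∀ {v a b c} → Claw v a b c → Claw v b a c
    transpose K = record
      { a≢b = ≢-sym a≢b ; a≢c = b≢c ; b≢c = a≢c ; v∼a = v∼b ; v∼b = v∼a ; v∼c = v∼c
      ; only = λ v∼e → [ inj₂ ∘ inj₁ , [ inj₁ , inj₂ ∘ inj₂ ]′ ]′ (only v∼e) }
      where open Claw K

    clawFrom : ∀ {v a} → v ∼ a → ∃[ b ] ∃[ c ] Claw v a b c
    clawFrom {v} v∼a with a , b , c , K ← claw v with Claw.only K v∼a
    ... | inj₁ refl        = _ , _ , K
    ... | inj₂ (inj₁ refl) = _ , _ , rotate K
    ... | inj₂ (inj₂ refl) = _ , _ , rotate (rotate K)

    thirdEdge : ∀ {v a b} → v ∼ a → v ∼ b → a ≢ b → ∃[ c ] Claw v a b c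
    thirdEdge v∼a v∼b a≢b with b , c , K ← clawFrom v∼a with Claw.only K v∼b
    ... | inj₁ refl        = ⊥-elim (a≢b refl)
    ... | inj₂ (inj₁ refl) = _ , K
    ... | inj₂ (inj₂ refl) = _ , transpose (rotate (rotate K))

    ends-two : ∀ {u v w e} → u ∼ e → v ∼ e → w ∼ e → u ≢ v → w ≡ u ⊎ w ≡ v
    ends-two {e = e} u∼e v∼e w∼e u≢v with arity e
    ... | inj₁ eq with E ← subst (Enumeration (ends e)) eq (enumerate (ends e))
      with Enumeration.complete E u∼e | Enumeration.complete E v∼e
    ...   | 0F , refl | 0F , refl = ⊥-elim (u≢v refl)
    ends-two {e = e} u∼e v∼e w∼e u≢v | inj₂ eq with E ← subst (Enumeration (ends e)) eq (enumerate (ends e))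
      with Enumeration.complete E u∼e | Enumeration.complete E v∼e | Enumeration.complete E w∼e
    ... | 0F , refl | 0F , refl | _         = ⊥-elim (u≢v refl)
    ... | 1F , refl | 1F , refl | _         = ⊥-elim (u≢v refl)
    ... | 0F , refl | 1F , refl | 0F , refl = inj₁ refl
    ... | 0F , refl | 1F , refl | 1F , refl = inj₂ refl
    ... | 1F , refl | 0F , refl | 0F , refl = inj₂ refl
    ... | 1F , refl | 0F , refl | 1F , refl = inj₁ refl

    full : ∀ {u v e} → u ∼ e → v ∼ e → u ≢ v → ∣ ends e ∣ ≡ 2
    full {e = e} u∼e v∼e u≢v with arity e
    ... | inj₂ eq = eq
    ... | inj₁ eq with E ← subst (Enumeration (ends e)) eq (enumerate (ends e))
      with Enumeration.complete E u∼e | Enumeration.complete E v∼e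
    ...   | 0F , refl | 0F , refl = ⊥-elim (u≢v refl)

    same-ends : ∀ {u v e f} → u ∼ e → v ∼ e → u ∼ f → v ∼ f → u ≢ v → e ≡ f
    same-ends u∼e v∼e u∼f v∼f u≢v = noParallel _ _ (full u∼e v∼e u≢v) (⊆-antisym
      (λ w∼e → [ (λ { refl → u∼f }) , (λ { refl → v∼f }) ]′ (ends-two u∼e v∼e w∼e u≢v))
      (λ w∼f → [ (λ { refl → u∼e }) , (λ { refl → v∼e }) ]′ (ends-two u∼f v∼f w∼f u≢v)))

  adjacent : ∀ {u v e} → u ≢ v → u ∼ e → v ∼ e → Adjacent u v
  adjacent u≢v u∼e v∼e = u≢v , _ , u∼e , v∼e

  adj-sym : ∀ {u v} → Adjacent u v → Adjacent v u
  adj-sym (u≢v , e , u∼e , v∼e) = ≢-sym u≢v , e , v∼e , u∼e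

  Reach : (Vertex → Set) → Vertex → Vertex → Set
  Reach P = Star (λ a b → Adjacent a b × P a × P b)

  reach-sym : ∀ {P a b} → Reach P a b → Reach P b a
  reach-sym = reverse λ (ab , Pa , Pb) → adj-sym ab , Pb , Pa

  reach-map : ∀ {P Q a b} → (∀ {x} → P x → Q x) → Reach P a b → Reach Q a b
  reach-map P⊆Q = gmap id λ (ab , Pa , Pb) → ab , P⊆Q Pa , P⊆Q Pb

  -- The vertices other than s, p₁, p₂ and p₃ provide the sixth branch set of a K₂,₃ minor.
  NoK₂₃ : Set
  NoK₂₃ = ∀ {s p₁ p₂ p₃ o₁ o₂ o₃} → Adjacent s p₁ → Adjacent s p₂ → Adjacent s p₃ → p₁ ≢ p₂ → p₁ ≢ p₃ → p₂ ≢ p₃ →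
          Adjacent p₁ o₁ → Adjacent p₂ o₂ → Adjacent p₃ o₃ →
          let P = λ v → v ≢ s × v ≢ p₁ × v ≢ p₂ × v ≢ p₃ in
          P o₁ → P o₂ → P o₃ → Reach P o₂ o₁ → Reach P o₃ o₁ → ⊥

-- Outerplanar graphs contain no K₂,₃

δ : ∀ {P : Set} → Dec P → ℤ → ℤ
δ (yes _) c = c
δ (no _)  c = 0ℤ

sum-pair : ∀ {n} (f : Fin n → ℤ) {a b} → a ≢ b → (∀ j → j ≢ a → j ≢ b → f j ≡ 0ℤ) → sum f ≡ f a + f b
sum-pair f {a} {b} a≢b f≡0 = begin
  sum f                                                     ≡⟨ sum-cong-≗ split ⟩
  sum (λ j → δ (j ≟ a) (f j) + δ (j ≟ b) (f j))             ≡⟨ ∑-distrib-+ (λ j → δ (j ≟ a) (f j)) _ ⟩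
  sum (λ j → δ (j ≟ a) (f j)) + sum (λ j → δ (j ≟ b) (f j)) ≡⟨ cong₂ _+_ (single a) (single b) ⟩
  f a + f b                                                 ∎
  where
  open ≡-Reasoning
  split : ∀ j → f j ≡ δ (j ≟ a) (f j) + δ (j ≟ b) (f j)
  split j with j ≟ a | j ≟ b
  ... | yes p | yes q = ⊥-elim (a≢b (trans (sym p) q))
  ... | yes _ | no _  = sym (ℤₚ.+-identityʳ _)
  ... | no _  | yes _ = sym (ℤₚ.+-identityˡ _)
  ... | no p  | no q  = f≡0 j p q
  single : ∀ a → sum (λ j → δ (j ≟ a) (f j)) ≡ f a
  single a = trans (sum-single _ a off-a) on-a
    where
    off-a : ∀ j → j ≢ a → δ (j ≟ a) (f j) ≡ 0ℤ
    off-a j j≢a with j ≟ a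
    ... | yes p = ⊥-elim (j≢a p)
    ... | no _  = refl
    on-a : δ (a ≟ a) (f a) ≡ f a
    on-a with a ≟ a
    ... | yes _ = refl
    ... | no ¬p = ⊥-elim (¬p refl)

sum-triple : ∀ {n} (f : Fin n → ℤ) {a b c} → a ≢ b → a ≢ c → b ≢ c →
             (∀ j → j ≢ a → j ≢ b → j ≢ c → f j ≡ 0ℤ) → sum f ≡ f a + (f b + f c)
sum-triple f {a} {b} {c} a≢b a≢c b≢c f≡0 = begin
  sum f                                       ≡⟨ sum-cong-≗ split ⟩
  sum (λ j → δ (j ≟ a) (f j) + rest j)        ≡⟨ ∑-distrib-+ (λ j → δ (j ≟ a) (f j)) rest ⟩
  sum (λ j → δ (j ≟ a) (f j)) + sum rest      ≡⟨ cong₂ _+_ (trans (sum-single _ a off-a) on-a) (sum-pair rest b≢c off-bc) ⟩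
  f a + (rest b + rest c)                     ≡⟨ cong₂ (λ x y → f a + (x + y)) (rest≡ b (≢-sym a≢b)) (rest≡ c (≢-sym a≢c)) ⟩
  f a + (f b + f c)                           ∎
  where
  open ≡-Reasoning
  rest : _ → ℤ
  rest j = δ (¬? (j ≟ a)) (f j)
  split : ∀ j → f j ≡ δ (j ≟ a) (f j) + rest j
  split j with j ≟ a
  ... | yes _ = sym (ℤₚ.+-identityʳ _)
  ... | no _  = sym (ℤₚ.+-identityˡ _)
  off-a : ∀ j → j ≢ a → δ (j ≟ a) (f j) ≡ 0ℤ
  off-a j j≢a with j ≟ a
  ... | yes p = ⊥-elim (j≢a p)
  ... | no _  = refl
  on-a : δ (a ≟ a) (f a) ≡ f a
  on-a with a ≟ a
  ... | yes _ = refl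
  ... | no ¬p = ⊥-elim (¬p refl)
  off-bc : ∀ j → j ≢ b → j ≢ c → rest j ≡ 0ℤ
  off-bc j j≢b j≢c with j ≟ a
  ... | yes _   = refl
  ... | no j≢a  = f≡0 j j≢a j≢b j≢c
  rest≡ : ∀ j → j ≢ a → rest j ≡ f j
  rest≡ j j≢a with j ≟ a
  ... | yes p = ⊥-elim (j≢a p)
  ... | no _  = refl

-- A list allows repeated indices, whose coefficients add up; this happens for an edge with the same
-- face on both sides.
LinearForm : ℕ → Set
LinearForm n = List (ℤ × Fin n)

eval : ∀ {n} → LinearForm n → (Fin n → ℤ) → ℤ
eval []            x = 0ℤ
eval ((c , k) ∷ l) x = c * x k + eval l x

coefficient : ∀ {n} → LinearForm n → Fin n → ℤ
coefficient []            j = 0ℤ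
coefficient ((c , k) ∷ l) j = δ (j ≟ k) c + coefficient l j

dot-coefficient : ∀ {n} (l : LinearForm n) x → dot (coefficient l) x ≡ eval l x
dot-coefficient {n} [] x = sum-zero {n} (λ j → 0ℤ * x j) λ _ → refl
dot-coefficient {n} ((c , k) ∷ l) x = begin
  sum (λ j → (δ (j ≟ k) c + coefficient l j) * x j)          ≡⟨ sum-cong-≗ (λ j → ℤₚ.*-distribʳ-+ (x j) (δ (j ≟ k) c) _) ⟩
  sum (λ j → δ (j ≟ k) c * x j + coefficient l j * x j)      ≡⟨ ∑-distrib-+ (λ j → δ (j ≟ k) c * x j) _ ⟩
  sum (λ j → δ (j ≟ k) c * x j) + dot (coefficient l) x      ≡⟨ cong₂ _+_ (trans (sum-single _ k off-k) on-k) (dot-coefficient l x) ⟩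
  c * x k + eval l x                                         ∎
  where
  open ≡-Reasoning
  off-k : ∀ j → j ≢ k → δ (j ≟ k) c * x j ≡ 0ℤ
  off-k j j≢k with j ≟ k
  ... | yes p = ⊥-elim (j≢k p)
  ... | no _  = refl
  on-k : δ (k ≟ k) c * x k ≡ c * x k
  on-k with k ≟ k
  ... | yes _ = refl
  ... | no ¬p = ⊥-elim (¬p refl)

-- Faces, flows and potentials of a planar drawing

module Planarity (G : CubicGraph) (D : PlanarDrawing G) where
  open GraphKit G
  open PlanarDrawing D

  Rotation : Vertex → Edge → Edge → Edge → Set
  Rotation v a b c = Claw v a b c × next v a ≡ b × next v b ≡ c × next v c ≡ a

  cyclic-closed : ∀ {v e f} (P : Edge → Set) → (∀ g → v ∼ g → P g → P (next v g)) → v ∼ e → v ∼ f → P e → P f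
  cyclic-closed {v} P closed v∼e v∼f = go (cyclic v∼e v∼f) v∼e
    where
    go : ∀ {e f} → Star (λ g h → next v g ≡ h) e f → v ∼ e → P e → P f
    go ε          v∼e Pe = Pe
    go (refl ◅ r) v∼e Pe = go r (next-dart v∼e) (closed _ v∼e Pe)

  rotationFrom : ∀ {v a b c} → Claw v a b c → next v a ≡ b → Rotation v a b c
  rotationFrom {v} {a} {b} {c} K na≡b = K , na≡b , nb≡c , nc≡a
    where
    open Claw K
    nb≡c : next v b ≡ c
    nb≡c with only (next-dart v∼b)
    ... | inj₂ (inj₂ eq) = eq
    ... | inj₂ (inj₁ eq) = ⊥-elim (b≢c (sym (cyclic-closed (_≡ b) (λ { _ _ refl → eq }) v∼b v∼c refl)))
    ... | inj₁ eq with cyclic-closed (λ g → g ≡ a ⊎ g ≡ b)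
                         (λ { _ _ (inj₁ refl) → inj₂ na≡b ; _ _ (inj₂ refl) → inj₁ eq }) v∼a v∼c (inj₁ refl)
    ...   | inj₁ c≡a = ⊥-elim (a≢c (sym c≡a))
    ...   | inj₂ c≡b = ⊥-elim (b≢c (sym c≡b))
    nc≡a : next v c ≡ a
    nc≡a with only (next-dart v∼c)
    ... | inj₁ eq = eq
    ... | inj₂ (inj₂ eq) = ⊥-elim (a≢c (cyclic-closed (_≡ c) (λ { _ _ refl → eq }) v∼c v∼a refl))
    ... | inj₂ (inj₁ eq) with cyclic-closed (λ g → g ≡ b ⊎ g ≡ c)
                         (λ { _ _ (inj₁ refl) → inj₂ nb≡c ; _ _ (inj₂ refl) → inj₁ eq }) v∼b v∼a (inj₁ refl)
    ...   | inj₁ a≡b = ⊥-elim (a≢b a≡b)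
    ...   | inj₂ a≡c = ⊥-elim (a≢c a≡c)

  rotation : ∀ {v a b c} → Claw v a b c → Rotation v a b c ⊎ Rotation v a c b
  rotation {v} {a} {b} {c} K with Claw.only K (next-dart (Claw.v∼a K))
  ... | inj₁ eq = ⊥-elim (Claw.a≢b K (sym (cyclic-closed (_≡ a) (λ { _ _ refl → eq }) (Claw.v∼a K) (Claw.v∼b K) refl)))
  ... | inj₂ (inj₁ eq) = inj₁ (rotationFrom K eq)
  ... | inj₂ (inj₂ eq) = inj₂ (rotationFrom (transpose (rotate (rotate K))) eq)

  -- For a half-edge both `v` and `w` are its only end: the boundary walk turns back at the free
  -- end, so both sides of a half-edge lie on the same face.
  face-turn : ∀ {v w e} → v ∼ e → w ∼ e → (∀ {x} → x ∼ e → x ≡ v ⊎ x ≡ w) → face (v , e) ≡ face (w , next w e)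
  face-turn {v} {w} {e} v∼e w∼e only = Equivalence.from (face-orbit v∼e (next-dart w∼e)) (fwd (ends≡ , refl) ◅ ε)
    where
    ends≡ : ends e ≡ ⁅ v ⁆ ∪ ⁅ w ⁆
    ends≡ = ⊆-antisym
      (λ x∼e → x∈p∪q⁺ ([ (λ { refl → inj₁ (x∈⁅x⁆ _) }) , (λ { refl → inj₂ (x∈⁅x⁆ _) }) ]′ (only x∼e)))
      (λ x∈ → [ (λ x∈v → subst (_∼ e) (sym (x∈⁅y⁆⇒x≡y v x∈v)) v∼e) ,
                (λ x∈w → subst (_∼ e) (sym (x∈⁅y⁆⇒x≡y w x∈w)) w∼e) ]′ (x∈p∪q⁻ ⁅ v ⁆ ⁅ w ⁆ x∈))

  data Ends (e : Edge) (s t : Vertex) : Set where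
    one-end : s ≡ t → s ∼ e → (∀ {x} → x ∼ e → x ≡ s) → Ends e s t
    two-ends : s ≢ t → s ∼ e → t ∼ e → e ∈ fullEdges → Ends e s t

  endsOf : ∀ e → ∃[ s ] ∃[ t ] Ends e s t
  endsOf e with arity e
  ... | inj₁ eq with E ← subst (Enumeration (ends e)) eq (enumerate (ends e)) =
    elem 0F , elem 0F , one-end refl (elem∈ 0F) λ x∼e → cases (complete x∼e)
    where
    open Enumeration E
    cases : ∀ {x} → ∃[ i ] elem i ≡ x → x ≡ elem 0F
    cases (0F , refl) = refl
  ... | inj₂ eq with E ← subst (Enumeration (ends e)) eq (enumerate (ends e)) =
    elem 0F , elem 1F , two-ends (λ p → 0≢1 (injective p)) (elem∈ 0F) (elem∈ 1F)
      (lookup⇒[]= e fullEdges (trans (lookup∘tabulate _ e) (dec-true (∣ ends e ∣ ℕₚ.≟ 2) eq)))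
    where
    open Enumeration E
    0≢1 : _≢_ {A = Fin 2} 0F 1F
    0≢1 ()

  src tgt : Edge → Vertex
  src e = proj₁ (endsOf e)
  tgt e = proj₁ (proj₂ (endsOf e))

  endsAre : ∀ e → Ends e (src e) (tgt e)
  endsAre e = proj₂ (proj₂ (endsOf e))

  is-end : ∀ {u v e} → u ∼ e → v ∼ e → u ≢ v → (u ≡ src e × v ≡ tgt e) ⊎ (u ≡ tgt e × v ≡ src e)
  is-end {e = e} u∼e v∼e u≢v with endsAre e
  ... | one-end s≡t _ only = ⊥-elim (u≢v (trans (only u∼e) (sym (only v∼e))))
  ... | two-ends s≢t s∼e t∼e _ with ends-two s∼e t∼e u∼e s≢t | ends-two s∼e t∼e v∼e s≢t
  ...   | inj₁ p | inj₂ q = inj₁ (p , q)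
  ...   | inj₂ p | inj₁ q = inj₂ (p , q)
  ...   | inj₁ p | inj₁ q = ⊥-elim (u≢v (trans p (sym q)))
  ...   | inj₂ p | inj₂ q = ⊥-elim (u≢v (trans p (sym q)))

  module _ (S : Fin #faces → ℤ) where
    -- By `face-turn` the second face is that of the opposite dart, so this is the difference of `S`
    -- across `e`, with the sign that belongs to `v`.
    ∂ : Vertex → Edge → ℤ
    ∂ v e = S (face (v , e)) - S (face (v , next v e))

    -- Summation by parts: the coboundary of S is orthogonal to that of y.
    orthogonal : (y : Vertex → ℤ) → sum (λ e → (y (src e) - y (tgt e)) * ∂ (src e) e) ≡ 0ℤ
    orthogonal y = begin
      sum (λ e → (y (src e) - y (tgt e)) * ∂ (src e) e) ≡⟨ sum-cong-≗ (λ e → sym (column e)) ⟩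
      sum (λ e → sum (λ v → F v e))                     ≡⟨ ∑-comm (λ e v → F v e) ⟩
      sum (λ v → sum (λ e → F v e))                     ≡⟨ sum-zero _ row ⟩
      0ℤ                                                ∎
      where
      open ≡-Reasoning
      -- The sum runs over all darts and is evaluated twice: around a vertex the differences
      -- telescope to zero, while along an edge its two darts contribute opposite differences.
      F : Vertex → Edge → ℤ
      F v e = δ (v ∈? ends e) (y v * ∂ v e)
      F-on : ∀ {v e} → v ∼ e → F v e ≡ y v * ∂ v e
      F-on {v} {e} v∼e with v ∈? ends e
      ... | yes _ = refl
      ... | no ¬p = ⊥-elim (¬p v∼e)
      F-off : ∀ {v e} → ¬ (v ∼ e) → F v e ≡ 0ℤ
      F-off {v} {e} ¬v∼e with v ∈? ends e
      ... | yes p = ⊥-elim (¬v∼e p)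
      ... | no _  = refl
      row : ∀ v → sum (λ e → F v e) ≡ 0ℤ
      row v with a , b , c , K₀ ← claw v = [ around , around ]′ (rotation K₀)
        where
        around : ∀ {a b c} → Rotation v a b c → sum (λ e → F v e) ≡ 0ℤ
        around {a} {b} {c} (K , refl , refl , nc≡a) = begin
          sum (λ e → F v e)       ≡⟨ sum-triple (F v) a≢b a≢c b≢c
                                       (λ j p q r → F-off λ v∼j → [ p , [ q , r ]′ ]′ (only v∼j)) ⟩
          F v a + (F v b + F v c) ≡⟨ cong₂ _+_ (F-on v∼a) (cong₂ _+_ (F-on v∼b) (trans (F-on v∼c)
                                       (cong (λ e → y v * (S (face (v , c)) - S (face (v , e)))) nc≡a))) ⟩
          _                       ≡⟨ telescope (y v) (S (face (v , a))) (S (face (v , b))) (S (face (v , c))) ⟩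
          0ℤ                      ∎
          where
          open Claw K
          telescope : ∀ y p q r → y * (p - q) + (y * (q - r) + y * (r - p)) ≡ 0ℤ
          telescope = solve-∀
      column : ∀ e → sum (λ v → F v e) ≡ (y (src e) - y (tgt e)) * ∂ (src e) e
      column e with src e | tgt e | endsAre e
      ... | s | t | one-end refl s∼e only = begin
        sum (λ v → F v e)        ≡⟨ sum-single (λ v → F v e) s (λ v v≢s → F-off (v≢s ∘ only)) ⟩
        F s e                    ≡⟨ F-on s∼e ⟩
        y s * ∂ s e              ≡⟨ cong (λ f → y s * (f - S (face (s , next s e)))) (cong S (face-turn s∼e s∼e (inj₁ ∘ only))) ⟩
        y s * (S (face (s , next s e)) - S (face (s , next s e)))
                                 ≡⟨ vanish (y s) (S (face (s , next s e))) (∂ s e) ⟩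
        (y s - y s) * ∂ s e      ∎
        where
        vanish : ∀ y f g → y * (f - f) ≡ (y - y) * g
        vanish = solve-∀
      ... | s | t | two-ends s≢t s∼e t∼e _ = begin
        sum (λ v → F v e)           ≡⟨ sum-pair (λ v → F v e) s≢t
                                         (λ v v≢s v≢t → F-off λ v∼e → [ v≢s , v≢t ]′ (ends-two s∼e t∼e v∼e s≢t)) ⟩
        F s e + F t e               ≡⟨ cong₂ _+_ (F-on s∼e) (F-on t∼e) ⟩
        y s * ∂ s e + y t * ∂ t e   ≡⟨ cong (λ z → y s * ∂ s e + y t * z) (cong₂ _-_
                                         (cong S (face-turn t∼e s∼e (λ x → ends-two t∼e s∼e x (≢-sym s≢t))))
                                         (cong S (sym (face-turn s∼e t∼e (λ x → ends-two s∼e t∼e x s≢t))))) ⟩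
        y s * ∂ s e + y t * (S (face (s , next s e)) - S (face (s , e)))
                                    ≡⟨ factor (y s) (y t) (S (face (s , e))) (S (face (s , next s e))) ⟩
        (y s - y t) * ∂ s e         ∎
        where
        factor : ∀ p q f g → p * (f - g) + q * (g - f) ≡ (p - q) * (f - g)
        factor = solve-∀

  record Step : Set where
    constructor mkStep
    field
      weight  : ℤ
      {start end} : Vertex
      via     : Edge
      start≢end : start ≢ end
      start∼  : start ∼ via
      end∼    : end ∼ via

  open Step

  -- The flow of a list of weighted steps out of v through e.
  χ : Step → Vertex → Edge → ℤ
  χ st v e = δ (e ≟ via st) (δ (v ≟ start st) (weight st) + δ (v ≟ end st) (- weight st))

  flow : List Step → Vertex → Edge → ℤ
  flow []         v e = 0ℤ
  flow (st ∷ sts) v e = χ st v e + flow sts v e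

  boundary : List Step → (Vertex → ℤ) → ℤ
  boundary []         y = 0ℤ
  boundary (st ∷ sts) y = weight st * (y (start st) - y (end st)) + boundary sts y

  χ-other-edge : ∀ st {v e} → e ≢ via st → χ st v e ≡ 0ℤ
  χ-other-edge st {e = e} e≢ with e ≟ via st
  ... | yes p = ⊥-elim (e≢ p)
  ... | no _  = refl

  χ-other-vertex : ∀ st {v e} → v ≢ start st → v ≢ end st → χ st v e ≡ 0ℤ
  χ-other-vertex st {v} {e} v≢s v≢t with e ≟ via st | v ≟ start st | v ≟ end st
  ... | no _  | _     | _     = refl
  ... | yes _ | yes p | _     = ⊥-elim (v≢s p)
  ... | yes _ | no _  | yes p = ⊥-elim (v≢t p)
  ... | yes _ | no _  | no _  = refl

  χ-start : ∀ st → χ st (start st) (via st) ≡ weight st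
  χ-start st with via st ≟ via st | start st ≟ start st | start st ≟ end st
  ... | no ¬p | _     | _     = ⊥-elim (¬p refl)
  ... | yes _ | no ¬p | _     = ⊥-elim (¬p refl)
  ... | yes _ | yes _ | yes p = ⊥-elim (start≢end st p)
  ... | yes _ | yes _ | no _  = ℤₚ.+-identityʳ _

  χ-end : ∀ st → χ st (end st) (via st) ≡ - weight st
  χ-end st with via st ≟ via st | end st ≟ start st | end st ≟ end st
  ... | no ¬p | _     | _     = ⊥-elim (¬p refl)
  ... | yes _ | yes p | _     = ⊥-elim (start≢end st (sym p))
  ... | yes _ | no _  | no ¬p = ⊥-elim (¬p refl)
  ... | yes _ | no _  | yes _ = ℤₚ.+-identityˡ _

  step-ends : ∀ st {v w} → v ∼ via st → w ∼ via st → v ≢ w →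
              (v ≡ start st × w ≡ end st) ⊎ (v ≡ end st × w ≡ start st)
  step-ends st v∼ w∼ v≢w with ends-two (start∼ st) (end∼ st) v∼ (start≢end st)
                            | ends-two (start∼ st) (end∼ st) w∼ (start≢end st)
  ... | inj₁ p | inj₂ q = inj₁ (p , q)
  ... | inj₂ p | inj₁ q = inj₂ (p , q)
  ... | inj₁ p | inj₁ q = ⊥-elim (v≢w (trans p (sym q)))
  ... | inj₂ p | inj₂ q = ⊥-elim (v≢w (trans p (sym q)))

  χ-antisym : ∀ st {v w e} → v ∼ e → w ∼ e → v ≢ w → χ st v e ≡ - χ st w e
  χ-antisym st {v} {w} {e} v∼e w∼e v≢w = by-edge (e ≟ via st)
    where
    by-edge : Dec (e ≡ via st) → χ st v e ≡ - χ st w e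
    by-edge (no e≢) = trans (χ-other-edge st {v} e≢) (cong -_ (sym (χ-other-edge st {w} e≢)))
    by-edge (yes refl) with step-ends st v∼e w∼e v≢w
    ... | inj₁ (refl , refl) = trans (χ-start st) (trans (sym (ℤₚ.neg-involutive _)) (cong -_ (sym (χ-end st))))
    ... | inj₂ (refl , refl) = trans (χ-end st) (cong -_ (sym (χ-start st)))

  flow-antisym : ∀ sts {v w e} → v ∼ e → w ∼ e → v ≢ w → flow sts v e ≡ - flow sts w e
  flow-antisym []         _ _ _ = refl
  flow-antisym (st ∷ sts) {w = w} {e} v∼e w∼e v≢w =
    trans (cong₂ _+_ (χ-antisym st v∼e w∼e v≢w) (flow-antisym sts v∼e w∼e v≢w)) (sym (ℤₚ.neg-distrib-+ (χ st w e) _))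

  flow-half : ∀ sts {s e} → (∀ {x} → x ∼ e → x ≡ s) → ∀ v → flow sts v e ≡ 0ℤ
  flow-half []         only v = refl
  flow-half (st ∷ sts) {e = e} only v = trans (cong (χ st v e +_) (flow-half sts only v))
    (trans (ℤₚ.+-identityʳ (χ st v e)) (χ-other-edge st {v}
      λ { refl → start≢end st (trans (only (start∼ st)) (sym (only (end∼ st)))) }))

  flow-++ : ∀ sts sts′ v e → flow (sts ++ sts′) v e ≡ flow sts v e + flow sts′ v e
  flow-++ []         sts′ v e = sym (ℤₚ.+-identityˡ _)
  flow-++ (st ∷ sts) sts′ v e = trans (cong (χ st v e +_) (flow-++ sts sts′ v e)) (sym (ℤₚ.+-assoc (χ st v e) _ _))

  boundary-++ : ∀ sts sts′ y → boundary (sts ++ sts′) y ≡ boundary sts y + boundary sts′ y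
  boundary-++ []         sts′ y = sym (ℤₚ.+-identityˡ _)
  boundary-++ (st ∷ sts) sts′ y =
    trans (cong (weight st * (y (start st) - y (end st)) +_) (boundary-++ sts sts′ y))
      (sym (ℤₚ.+-assoc (weight st * (y (start st) - y (end st))) _ _))

  -- Consequently a list of steps with vanishing `boundary` is a flow orthogonal to every
  -- coboundary.
  pairing : ∀ sts y → sum (λ e → (y (src e) - y (tgt e)) * flow sts (src e) e) ≡ boundary sts y
  pairing []         y = sum-zero {#edges} (λ e → (y (src e) - y (tgt e)) * 0ℤ) λ e → ℤₚ.*-zeroʳ (y (src e) - y (tgt e))
  pairing (st ∷ sts) y = begin
    sum (λ e → Δ e * (χ st (src e) e + flow sts (src e) e))                  ≡⟨ sum-cong-≗ (λ e → ℤₚ.*-distribˡ-+ (Δ e) _ _) ⟩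
    sum (λ e → Δ e * χ st (src e) e + Δ e * flow sts (src e) e)              ≡⟨ ∑-distrib-+ (λ e → Δ e * χ st (src e) e) _ ⟩
    sum (λ e → Δ e * χ st (src e) e) + sum (λ e → Δ e * flow sts (src e) e)  ≡⟨ cong₂ _+_ (trans (sum-single _ (via st) other) at-via) (pairing sts y) ⟩
    weight st * (y (start st) - y (end st)) + boundary sts y                 ∎
    where
    open ≡-Reasoning
    Δ : Edge → ℤ
    Δ e = y (src e) - y (tgt e)
    other : ∀ e → e ≢ via st → Δ e * χ st (src e) e ≡ 0ℤ
    other e e≢ = trans (cong (Δ e *_) (χ-other-edge st {src e} e≢)) (ℤₚ.*-zeroʳ (Δ e))
    swap-sign : ∀ w p q → (p - q) * - w ≡ w * (q - p)
    swap-sign = solve-∀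
    at-via : Δ (via st) * χ st (src (via st)) (via st) ≡ weight st * (y (start st) - y (end st))
    at-via with is-end (start∼ st) (end∼ st) (start≢end st)
    ... | inj₁ (p , q) = trans
      (cong₂ (λ a b → (y a - y b) * χ st a (via st)) (sym p) (sym q))
      (trans (cong ((y (start st) - y (end st)) *_) (χ-start st)) (ℤₚ.*-comm (y (start st) - y (end st)) (weight st)))
    ... | inj₂ (p , q) = trans
      (cong₂ (λ a b → (y a - y b) * χ st a (via st)) (sym q) (sym p))
      (trans (cong ((y (end st) - y (start st)) *_) (χ-end st)) (swap-sign (weight st) (y (end st)) (y (start st))))

  module _ (connected : ∀ u v → Star Adjacent u v) (v₀ : Vertex) (outer : Fin #faces) where

    -- By Euler's formula the system S (face (src e , e)) - S (face (tgt e , e)) + t flow(e) = y (src e) - y (tgt e)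
    -- has more unknowns S, y, t than equations.  As both S and the flow are orthogonal to the
    -- coboundary of y, the latter vanishes in a solution.
    abstract
      potential : ∀ sts → (∀ y → boundary sts y ≡ 0ℤ) →
                  Σ[ S ∈ (Fin #faces → ℤ) ] Σ[ t ∈ ℤ ] t ≢ 0ℤ × S outer ≡ 0ℤ ×
                  (∀ {v e} → v ∼ e → S (face (v , next v e)) ≡ S (face (v , e)) + t * flow sts v e)
      potential sts closed = S , t , t≢0 , S-outer , jump
        where
        open ≡-Reasoning
        -- There is one unknown for each face, one for each vertex and the multiplier `t` of the
        -- flow. By Euler's formula this exceeds by one the number of equations: one for each full
        -- edge and two normalisations.
        N : ℕ
        N = #faces ℕ.+ (#vertices ℕ.+ 1)
        S-index : Fin #faces → Fin N
        S-index i = i ↑ˡ (#vertices ℕ.+ 1)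
        y-index : Vertex → Fin N
        y-index v = #faces ↑ʳ (v ↑ˡ 1)
        t-index : Fin N
        t-index = #faces ↑ʳ (#vertices ↑ʳ zero)
        -- The first two rows normalise `S` at the outer face and `y` at `v₀`, which removes the
        -- additive constants. There is a row for every edge, but those of half-edges will not be
        -- imposed.
        row : Fin (2 ℕ.+ #edges) → LinearForm N
        row zero          = (1ℤ , S-index outer) ∷ []
        row (suc zero)    = (1ℤ , y-index v₀) ∷ []
        row (suc (suc e)) =
          (1ℤ , S-index (face (src e , e))) ∷ (- 1ℤ , S-index (face (tgt e , e))) ∷
          (- 1ℤ , y-index (src e)) ∷ (1ℤ , y-index (tgt e)) ∷ (flow sts (src e) e , t-index) ∷ []
        enough : 2 ℕ.+ ∣ fullEdges ∣ < N
        enough = ℕₚ.≤-reflexive begin-ℕ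
          where
          begin-ℕ : suc (2 ℕ.+ ∣ fullEdges ∣) ≡ N
          begin-ℕ = trans (cong suc (sym euler)) (trans (cong suc (ℕₚ.+-comm #vertices #faces))
                      (trans (sym (ℕₚ.+-comm (#faces ℕ.+ #vertices) 1)) (ℕₚ.+-assoc #faces #vertices 1)))
        solution : Σ[ x ∈ (Fin N → ℤ) ] (∃[ j ] x j ≢ 0ℤ) ×
                   (∀ i → i ∈ inside ∷ inside ∷ fullEdges → dot (coefficient (row i)) x ≡ 0ℤ)
        solution = nontrivial-solution (inside ∷ inside ∷ fullEdges) (coefficient ∘ row) enough
        x : Fin N → ℤ
        x = proj₁ solution
        S : Fin #faces → ℤ
        S = x ∘ S-index
        y : Vertex → ℤ
        y = x ∘ y-index
        t : ℤ
        t = x t-index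
        solves : ∀ i → i ∈ inside ∷ inside ∷ fullEdges → eval (row i) x ≡ 0ℤ
        solves i i∈ = trans (sym (dot-coefficient (row i) x)) (proj₂ (proj₂ solution) i i∈)
        unit : ∀ a → 1ℤ * a + 0ℤ ≡ a
        unit = solve-∀
        S-outer : S outer ≡ 0ℤ
        S-outer = trans (sym (unit (S outer))) (solves zero here)
        y-v₀ : y v₀ ≡ 0ℤ
        y-v₀ = trans (sym (unit (y v₀))) (solves (suc zero) (there here))

        Δ : Edge → ℤ
        Δ e = y (src e) - y (tgt e)
        φ′ : Edge → ℤ
        φ′ e = flow sts (src e) e

        -- This is the equation of `e` multiplied by `Δ e`, and it is trivial for a half-edge.
        -- Summed over all edges, the right-hand side vanishes by orthogonality and only squares
        -- remain.
        Δ≡ : ∀ e → Δ e * Δ e ≡ Δ e * ∂ S (src e) e + t * (Δ e * φ′ e)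
        Δ≡ e with src e | tgt e | endsAre e | solves (suc (suc e))
        ... | s | _ | one-end refl s∼e _ | _ = vanish (y s) (∂ S s e) t (flow sts s e)
          where
          vanish : ∀ y d t f → (y - y) * (y - y) ≡ (y - y) * d + t * ((y - y) * f)
          vanish = solve-∀
        ... | s | r | two-ends s≢r s∼e r∼e e∈ | eq = begin
          (y s - y r) * (y s - y r)                              ≡⟨ cong ((y s - y r) *_) equation ⟩
          (y s - y r) * (∂ S s e + t * flow sts s e)             ≡⟨ distribute (y s - y r) (∂ S s e) t (flow sts s e) ⟩
          (y s - y r) * ∂ S s e + t * ((y s - y r) * flow sts s e) ∎
          where
          distribute : ∀ a b c d → a * (b + c * d) ≡ a * b + c * (a * d)
          distribute = solve-∀
          isolate : ∀ a b p q f t → p - q ≡ a - b + t * f - (1ℤ * a + (- 1ℤ * b + (- 1ℤ * p + (1ℤ * q + (f * t + 0ℤ)))))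
          isolate = solve-∀
          equation : y s - y r ≡ ∂ S s e + t * flow sts s e
          equation = begin
            y s - y r
              ≡⟨ isolate (S (face (s , e))) (S (face (r , e))) (y s) (y r) (flow sts s e) t ⟩
            _ ≡⟨ cong (λ z → S (face (s , e)) - S (face (r , e)) + t * flow sts s e - z) (eq (there (there e∈))) ⟩
            S (face (s , e)) - S (face (r , e)) + t * flow sts s e - 0ℤ
              ≡⟨ ℤₚ.+-identityʳ _ ⟩
            S (face (s , e)) - S (face (r , e)) + t * flow sts s e
              ≡⟨ cong (λ f → S (face (s , e)) - f + t * flow sts s e)
                   (cong S (face-turn r∼e s∼e (λ x → ends-two r∼e s∼e x (≢-sym s≢r)))) ⟩
            ∂ S s e + t * flow sts s e ∎

        Δ≡0 : ∀ e → Δ e ≡ 0ℤ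
        Δ≡0 = sum-squares≡0 Δ (begin
          sum (λ e → Δ e * Δ e)                                             ≡⟨ sum-cong-≗ Δ≡ ⟩
          sum (λ e → Δ e * ∂ S (src e) e + t * (Δ e * φ′ e))                ≡⟨ ∑-distrib-+ (λ e → Δ e * ∂ S (src e) e) _ ⟩
          sum (λ e → Δ e * ∂ S (src e) e) + sum (λ e → t * (Δ e * φ′ e))    ≡⟨ cong₂ _+_ (orthogonal S y) (sym (*-distribˡ-sum t (λ e → Δ e * φ′ e))) ⟩
          0ℤ + t * sum (λ e → Δ e * φ′ e)                                   ≡⟨ cong (λ z → 0ℤ + t * z) (trans (pairing sts y) (closed y)) ⟩
          0ℤ + t * 0ℤ                                                       ≡⟨ cong (0ℤ +_) (ℤₚ.*-zeroʳ t) ⟩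
          0ℤ                                                                ∎)

        y-adjacent : ∀ {u v} → Adjacent u v → y u ≡ y v
        y-adjacent (u≢v , e , u∼e , v∼e) with is-end u∼e v∼e u≢v
        ... | inj₁ (refl , refl) = ℤₚ.i-j≡0⇒i≡j _ _ (Δ≡0 e)
        ... | inj₂ (refl , refl) = sym (ℤₚ.i-j≡0⇒i≡j _ _ (Δ≡0 e))

        y≡0 : ∀ v → y v ≡ 0ℤ
        y≡0 v = trans (along (connected v v₀)) y-v₀
          where
          along : ∀ {u w} → Star Adjacent u w → y u ≡ y w
          along ε       = refl
          along (a ◅ r) = trans (y-adjacent a) (along r)

        jump : ∀ {v e} → v ∼ e → S (face (v , next v e)) ≡ S (face (v , e)) + t * flow sts v e
        jump {v} {e} v∼e with endsAre e | solves (suc (suc e))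
        ... | one-end _ _ only | _ = begin
          S (face (v , next v e))             ≡⟨ cong S (sym (face-turn v∼e v∼e (λ x → inj₁ (trans (only x) (sym (only v∼e)))))) ⟩
          S (face (v , e))                    ≡⟨ sym (ℤₚ.+-identityʳ _) ⟩
          S (face (v , e)) + 0ℤ               ≡⟨ cong (S (face (v , e)) +_) (sym (trans (cong (t *_) (flow-half sts only v)) (ℤₚ.*-zeroʳ t))) ⟩
          S (face (v , e)) + t * flow sts v e ∎
        ... | two-ends s≢r s∼e r∼e e∈ | eq = at-end (ends-two s∼e r∼e v∼e s≢r)
          where
          isolate : ∀ a b p q f t → b ≡ a + t * f - (1ℤ * a + (- 1ℤ * b + (- 1ℤ * p + (1ℤ * q + (f * t + 0ℤ))))) - (p - q)
          isolate = solve-∀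
          cross : S (face (tgt e , e)) ≡ S (face (src e , e)) + t * flow sts (src e) e
          cross = begin
            S (face (tgt e , e))
              ≡⟨ isolate (S (face (src e , e))) (S (face (tgt e , e))) (y (src e)) (y (tgt e)) (flow sts (src e) e) t ⟩
            _ ≡⟨ cong₂ (λ p q → S (face (src e , e)) + t * flow sts (src e) e - p - q) (eq (there (there e∈))) (Δ≡0 e) ⟩
            S (face (src e , e)) + t * flow sts (src e) e - 0ℤ - 0ℤ
              ≡⟨ trans (ℤₚ.+-identityʳ _) (ℤₚ.+-identityʳ _) ⟩
            S (face (src e , e)) + t * flow sts (src e) e ∎
          back : ∀ a b f t → a ≡ b - t * f → b ≡ a + t * f
          back a b f t refl = undo b f t
            where
            undo : ∀ b f t → b ≡ b - t * f + t * f
            undo = solve-∀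
          at-end : ∀ {v} → v ≡ src e ⊎ v ≡ tgt e → S (face (v , next v e)) ≡ S (face (v , e)) + t * flow sts v e
          at-end (inj₁ refl) = trans (cong S (sym (face-turn r∼e s∼e (λ x → ends-two r∼e s∼e x (≢-sym s≢r))))) cross
          at-end (inj₂ refl) = trans (cong S (sym (face-turn s∼e r∼e (λ x → ends-two s∼e r∼e x s≢r))))
            (back _ _ (flow sts (tgt e) e) t (trans cross
              (cong (S (face (src e , e)) +_) (trans (cong (t *_) (flow-antisym sts s∼e r∼e s≢r)) (sym (ℤₚ.neg-distribʳ-* t _))))))

        -- Without the flow term `S` does not change around a vertex or along an edge, so by
        -- connectedness it equals its value 0 at the outer face. As `y` vanishes too, the solution
        -- would be trivial.
        t≢0 : t ≢ 0ℤ
        t≢0 t≡0 with j , x≢0 ← proj₁ (proj₂ solution) = x≢0 (all-zero j)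
          where
          turn : ∀ {v e} → v ∼ e → S (face (v , next v e)) ≡ S (face (v , e))
          turn {v} {e} v∼e = trans (jump v∼e) (trans (cong (λ s → S (face (v , e)) + s * flow sts v e) t≡0) (ℤₚ.+-identityʳ _))
          same-vertex : ∀ {v e f} → v ∼ e → v ∼ f → S (face (v , f)) ≡ S (face (v , e))
          same-vertex {v} {e} v∼e v∼f = cyclic-closed (λ g → S (face (v , g)) ≡ S (face (v , e)))
            (λ g v∼g eq → trans (turn v∼g) eq) v∼e v∼f refl
          along : ∀ {u w e f} → Star Adjacent u w → u ∼ e → w ∼ f → S (face (w , f)) ≡ S (face (u , e))
          along ε u∼e w∼f = same-vertex u∼e w∼f
          along ((u≢w , g , u∼g , w∼g) ◅ r) u∼e z∼f = trans (along r w∼g z∼f)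
            (trans (trans (cong S (face-turn w∼g u∼g (λ x → ends-two w∼g u∼g x (≢-sym u≢w)))) (turn u∼g)) (same-vertex u∼e u∼g))
          S≡0 : ∀ i → S i ≡ 0ℤ
          S≡0 i with (v , e) , v∼e , refl ← face-onto i | (w , f) , w∼f , fw ← face-onto outer =
            trans (along (connected w v) w∼f v∼e) (trans (cong S fw) S-outer)
          all-zero : ∀ j → x j ≡ 0ℤ
          all-zero j with splitAt #faces j in eq
          ... | inj₁ i = trans (cong x (sym (splitAt⁻¹-↑ˡ eq))) (S≡0 i)
          ... | inj₂ k with splitAt #vertices k in eq′
          ...   | inj₁ v = trans (cong x (sym (trans (cong (#faces ↑ʳ_) (splitAt⁻¹-↑ˡ eq′)) (splitAt⁻¹-↑ʳ eq)))) (y≡0 v)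
          ...   | inj₂ zero = trans (cong x (sym (trans (cong (#faces ↑ʳ_) (splitAt⁻¹-↑ʳ eq′)) (splitAt⁻¹-↑ʳ eq)))) t≡0

-- Theta graphs in an outerplanar drawing

module Theta (G : CubicGraph) (D : PlanarDrawing G) where
  open GraphKit G
  open PlanarDrawing D
  open Planarity G D
  open Step

  path : ∀ {P a b} → ℤ → Reach P a b → List Step
  path w ε = []
  path w (((a≢b , e , a∼e , b∼e) , _) ◅ r) = mkStep w e a≢b a∼e b∼e ∷ path w r

  path-boundary : ∀ {P a b} w (r : Reach P a b) y → boundary (path w r) y ≡ w * (y a - y b)
  path-boundary {a = a} w ε y = sym (trans (cong (w *_) (ℤₚ.i≡j⇒i-j≡0 (refl {x = y a}))) (ℤₚ.*-zeroʳ w))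
  path-boundary {a = a} {b} w (_◅_ {j = c} _ r) y =
    trans (cong (w * (y a - y c) +_) (path-boundary w r y)) (telescope w (y a) (y c) (y b))
    where
    telescope : ∀ w p q r → w * (p - q) + w * (q - r) ≡ w * (p - r)
    telescope = solve-∀

  path-flow : ∀ {P a b} w (r : Reach P a b) {v e} → ¬ P v → flow (path w r) v e ≡ 0ℤ
  path-flow w ε ¬Pv = refl
  path-flow {P} w (((a≢b , e , a∼e , b∼e) , Pa , Pb) ◅ r) {v} {e′} ¬Pv =
    trans (cong (χ st v e′ +_) (path-flow w r ¬Pv)) (trans (ℤₚ.+-identityʳ (χ st v e′))
      (χ-other-vertex st {v} {e′} (λ { refl → ¬Pv Pa }) (λ { refl → ¬Pv Pb })))
    where
    st : Step
    st = mkStep w e a≢b a∼e b∼e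

  -- From s through g to its neighbour p, on through k to o and within P to z.
  record Leg (P : Vertex → Set) (s z : Vertex) : Set where
    field
      amount  : ℤ
      amount≢0 : amount ≢ 0ℤ
      {p o}   : Vertex
      g k     : Edge
      s≢p     : s ≢ p
      s∼g     : s ∼ g
      p∼g     : p ∼ g
      p≢o     : p ≢ o
      p∼k     : p ∼ k
      o∼k     : o ∼ k
      route   : Reach P o z
      ¬Ps     : ¬ P s
      ¬Pp     : ¬ P p
      Po      : P o

    s≢o : s ≢ o
    s≢o s≡o = ¬Ps (subst P (sym s≡o) Po)

    first second : Step
    first  = mkStep amount g s≢p s∼g p∼g
    second = mkStep amount k p≢o p∼k o∼k

    steps : List Step
    steps = first ∷ second ∷ path amount route

    steps-boundary : ∀ y → boundary steps y ≡ amount * (y s - y z)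
    steps-boundary y = trans (cong (λ q → amount * (y s - y p) + (amount * (y p - y o) + q)) (path-boundary amount route y))
      (telescope amount (y s) (y p) (y o) (y z))
      where
      telescope : ∀ w s p o z → w * (s - p) + (w * (p - o) + w * (o - z)) ≡ w * (s - z)
      telescope = solve-∀

    three : ∀ v e → ¬ P v → flow steps v e ≡ χ first v e + χ second v e
    three v e ¬Pv = cong (χ first v e +_) (trans (cong (χ second v e +_) (path-flow amount route ¬Pv)) (ℤₚ.+-identityʳ (χ second v e)))

    flow-s-other : ∀ {e} → e ≢ g → flow steps s e ≡ 0ℤ
    flow-s-other {e} e≢g = trans (three s e ¬Ps) (cong₂ _+_ (χ-other-edge first {s} {e} e≢g)
      (χ-other-vertex second {s} {e} s≢p s≢o))

    flow-s-own : flow steps s g ≡ amount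
    flow-s-own = trans (three s g ¬Ps) (trans (cong₂ _+_ (χ-start first) (χ-other-vertex second {s} {g} s≢p s≢o))
      (ℤₚ.+-identityʳ amount))

    flow-p : ∀ {e} → e ≢ g → e ≢ k → flow steps p e ≡ 0ℤ
    flow-p {e} e≢g e≢k = trans (three p e ¬Pp) (cong₂ _+_ (χ-other-edge first {p} {e} e≢g) (χ-other-edge second {p} {e} e≢k))

    flow-other : ∀ {v e} → v ≢ s → v ≢ p → ¬ P v → flow steps v e ≡ 0ℤ
    flow-other {v} {e} v≢s v≢p ¬Pv = trans (three v e ¬Pv)
      (cong₂ _+_ (χ-other-vertex first {v} {e} v≢s v≢p) (χ-other-vertex second {v} {e} v≢p λ v≡o → ¬Pv (subst P (sym v≡o) Po)))

  open Leg using (p; o; g; k; p∼g; p∼k; s∼g)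

  module _ (connected : ∀ u v → Star Adjacent u v) (outer : Fin #faces) (onOuter : ∀ v → OnFace outer v)
           {P : Vertex → Set} {s z : Vertex} (l₁ l₂ l₃ : Leg P s z)
           (balanced : Leg.amount l₁ + (Leg.amount l₂ + Leg.amount l₃) ≡ 0ℤ)
           (p₁≢p₂ : p l₁ ≢ p l₂) (p₁≢p₃ : p l₁ ≢ p l₃) (p₂≢p₃ : p l₂ ≢ p l₃) where
    private
      all : List Step
      all = Leg.steps l₁ ++ Leg.steps l₂ ++ Leg.steps l₃

      closed : ∀ y → boundary all y ≡ 0ℤ
      closed y = begin
        boundary all y
          ≡⟨ trans (boundary-++ (Leg.steps l₁) _ y) (cong (boundary (Leg.steps l₁) y +_) (boundary-++ (Leg.steps l₂) _ y)) ⟩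
        boundary (Leg.steps l₁) y + (boundary (Leg.steps l₂) y + boundary (Leg.steps l₃) y)
          ≡⟨ cong₂ _+_ (Leg.steps-boundary l₁ y) (cong₂ _+_ (Leg.steps-boundary l₂ y) (Leg.steps-boundary l₃ y)) ⟩
        _ ≡⟨ collect (Leg.amount l₁) (Leg.amount l₂) (Leg.amount l₃) (y s - y z) ⟩
        (Leg.amount l₁ + (Leg.amount l₂ + Leg.amount l₃)) * (y s - y z)
          ≡⟨ cong (_* (y s - y z)) balanced ⟩
        0ℤ ∎
        where
        open ≡-Reasoning
        collect : ∀ a b c d → a * d + (b * d + c * d) ≡ (a + (b + c)) * d
        collect = solve-∀

      all-flow : ∀ v e {a b c} → flow (Leg.steps l₁) v e ≡ a → flow (Leg.steps l₂) v e ≡ b → flow (Leg.steps l₃) v e ≡ c →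
                 flow all v e ≡ a + (b + c)
      all-flow v e p q r = trans (flow-++ (Leg.steps l₁) _ v e)
        (cong₂ _+_ p (trans (flow-++ (Leg.steps l₂) _ v e) (cong₂ _+_ q r)))

      g≢ : (l l′ : Leg P s z) → p l ≢ p l′ → g l ≢ g l′
      g≢ l l′ p≢ refl with ends-two (s∼g l) (p∼g l) (p∼g l′) (Leg.s≢p l)
      ... | inj₁ eq = Leg.s≢p l′ (sym eq)
      ... | inj₂ eq = p≢ (sym eq)

      pot : Σ[ S ∈ (Fin #faces → ℤ) ] Σ[ t ∈ ℤ ] t ≢ 0ℤ × S outer ≡ 0ℤ ×
            (∀ {v e} → v ∼ e → S (face (v , next v e)) ≡ S (face (v , e)) + t * flow all v e)
      pot = potential connected s outer all closed
      S : Fin #faces → ℤ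
      S = proj₁ pot
      t : ℤ
      t = proj₁ (proj₂ pot)
      t≢0 : t ≢ 0ℤ
      t≢0 = proj₁ (proj₂ (proj₂ pot))
      S-outer : S outer ≡ 0ℤ
      S-outer = proj₁ (proj₂ (proj₂ (proj₂ pot)))
      jump : ∀ {v e} → v ∼ e → S (face (v , next v e)) ≡ S (face (v , e)) + t * flow all v e
      jump = proj₂ (proj₂ (proj₂ (proj₂ pot)))

      Isolated : Leg P s z → Set
      Isolated l = ∀ {e} → e ≢ g l → e ≢ k l → flow all (p l) e ≡ 0ℤ

      -- The outer face meets p, all of whose faces lie beside the leg.
      beside : (l : Leg P s z) → Isolated l → S (face (s , g l)) ≡ 0ℤ ⊎ S (face (s , next s (g l))) ≡ 0ℤ
      beside l isolated = cases (rotation K)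
        where
        g≢k : g l ≢ k l
        g≢k eq with ends-two (s∼g l) (p∼g l) (subst (o l ∼_) (sym eq) (Leg.o∼k l)) (Leg.s≢p l)
        ... | inj₁ o≡s = Leg.s≢o l (sym o≡s)
        ... | inj₂ o≡p = Leg.p≢o l (sym o≡p)
        h : Edge
        h = proj₁ (thirdEdge (p∼g l) (p∼k l) g≢k)
        K : Claw (p l) (g l) (k l) h
        K = proj₂ (thirdEdge (p∼g l) (p∼k l) g≢k)
        e : Edge
        e = proj₁ (onOuter (p l))
        p∼e : p l ∼ e
        p∼e = proj₁ (proj₂ (onOuter (p l)))
        left : S (face (p l , next (p l) (g l))) ≡ S (face (s , g l))
        left = cong S (sym (face-turn (s∼g l) (p∼g l) (λ x → ends-two (s∼g l) (p∼g l) x (Leg.s≢p l))))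
        right : S (face (p l , g l)) ≡ S (face (s , next s (g l)))
        right = cong S (face-turn (p∼g l) (s∼g l) (λ x → ends-two (p∼g l) (s∼g l) x (≢-sym (Leg.s≢p l))))
        outer-at : ∀ {x} → e ≡ x → S (face (p l , x)) ≡ 0ℤ
        outer-at refl = trans (cong S (proj₂ (proj₂ (onOuter (p l))))) S-outer
        flat : S (face (p l , next (p l) h)) ≡ S (face (p l , h))
        flat = trans (jump (Claw.v∼c K)) (trans (cong (λ f → S (face (p l , h)) + t * f)
          (isolated (≢-sym (Claw.a≢c K)) (≢-sym (Claw.b≢c K)))) (trans (cong (S (face (p l , h)) +_) (ℤₚ.*-zeroʳ t)) (ℤₚ.+-identityʳ _)))
        cases : Rotation (p l) (g l) (k l) h ⊎ Rotation (p l) (g l) h (k l) →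
                S (face (s , g l)) ≡ 0ℤ ⊎ S (face (s , next s (g l))) ≡ 0ℤ
        cases (inj₁ (_ , ng≡k , _ , nh≡g)) =
          [ (λ eq → inj₂ (trans (sym right) (outer-at eq))) ,
          [ (λ eq → inj₁ (trans (sym left) (outer-at (trans eq (sym ng≡k))))) ,
            (λ eq → inj₂ (trans (sym right) (trans (cong (λ x → S (face (p l , x))) (sym nh≡g)) (trans flat (outer-at eq))))) ]′ ]′
          (Claw.only K p∼e)
        cases (inj₂ (_ , ng≡h , nh≡k , _)) =
          [ (λ eq → inj₂ (trans (sym right) (outer-at eq))) ,
          [ (λ eq → inj₁ (trans (sym left) (trans (cong (λ x → S (face (p l , x))) ng≡h)
                                 (trans (sym flat) (outer-at (trans eq (sym nh≡k))))))) ,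
            (λ eq → inj₁ (trans (sym left) (outer-at (trans eq (sym ng≡h))))) ]′ ]′
          (Claw.only K p∼e)

      Own : Leg P s z → Set
      Own l = flow all s (g l) ≡ Leg.amount l

      -- Across the leg the potential jumps by `t` times the amount of the leg, a product of nonzero
      -- integers.
      crossing : (l : Leg P s z) → Own l → S (face (s , g l)) ≡ 0ℤ → S (face (s , next s (g l))) ≡ 0ℤ → ⊥
      crossing l own p q = [ t≢0 , Leg.amount≢0 l ]′ (ℤₚ.i*j≡0⇒i≡0∨j≡0 t (product≡0 _ _ _ _ p q own (jump (s∼g l))))
        where
        product≡0 : ∀ a b f w → a ≡ 0ℤ → b ≡ 0ℤ → f ≡ w → b ≡ a + t * f → t * w ≡ 0ℤ
        product≡0 _ _ f _ refl refl refl eq = trans (sym (ℤₚ.+-identityˡ (t * f))) (sym eq)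

      own₁ : Own l₁
      own₁ = trans (all-flow s (g l₁) (Leg.flow-s-own l₁) (Leg.flow-s-other l₂ (g≢ l₁ l₂ p₁≢p₂)) (Leg.flow-s-other l₃ (g≢ l₁ l₃ p₁≢p₃)))
        (ℤₚ.+-identityʳ (Leg.amount l₁))
      own₂ : Own l₂
      own₂ = trans (all-flow s (g l₂) (Leg.flow-s-other l₁ (g≢ l₂ l₁ (≢-sym p₁≢p₂))) (Leg.flow-s-own l₂) (Leg.flow-s-other l₃ (g≢ l₂ l₃ p₂≢p₃)))
        (trans (ℤₚ.+-identityˡ (Leg.amount l₂ + 0ℤ)) (ℤₚ.+-identityʳ (Leg.amount l₂)))
      own₃ : Own l₃
      own₃ = trans (all-flow s (g l₃) (Leg.flow-s-other l₁ (g≢ l₃ l₁ (≢-sym p₁≢p₃))) (Leg.flow-s-other l₂ (g≢ l₃ l₂ (≢-sym p₂≢p₃))) (Leg.flow-s-own l₃))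
        (trans (ℤₚ.+-identityˡ (0ℤ + Leg.amount l₃)) (ℤₚ.+-identityˡ (Leg.amount l₃)))

      away : (l l′ : Leg P s z) → p l ≢ p l′ → ∀ e → flow (Leg.steps l′) (p l) e ≡ 0ℤ
      away l l′ p≢ e = Leg.flow-other l′ {p l} {e} (≢-sym (Leg.s≢p l)) p≢ (Leg.¬Pp l)

      beside₁ : S (face (s , g l₁)) ≡ 0ℤ ⊎ S (face (s , next s (g l₁))) ≡ 0ℤ
      beside₁ = beside l₁ λ {e} a b → all-flow (p l₁) e (Leg.flow-p l₁ a b) (away l₁ l₂ p₁≢p₂ e) (away l₁ l₃ p₁≢p₃ e)
      beside₂ : S (face (s , g l₂)) ≡ 0ℤ ⊎ S (face (s , next s (g l₂))) ≡ 0ℤ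
      beside₂ = beside l₂ λ {e} a b → all-flow (p l₂) e (away l₂ l₁ (≢-sym p₁≢p₂) e) (Leg.flow-p l₂ a b) (away l₂ l₃ p₂≢p₃ e)
      beside₃ : S (face (s , g l₃)) ≡ 0ℤ ⊎ S (face (s , next s (g l₃))) ≡ 0ℤ
      beside₃ = beside l₃ λ {e} a b → all-flow (p l₃) e (away l₃ l₁ (≢-sym p₁≢p₃) e) (away l₃ l₂ (≢-sym p₂≢p₃) e) (Leg.flow-p l₃ a b)

      -- Of the three faces around s two are outer, and these are separated by a leg.
      around : ∀ {m₁ m₂ m₃} → Rotation s (g m₁) (g m₂) (g m₃) → Own m₁ → Own m₂ → Own m₃ →
               S (face (s , g m₁)) ≡ 0ℤ ⊎ S (face (s , next s (g m₁))) ≡ 0ℤ →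
               S (face (s , g m₂)) ≡ 0ℤ ⊎ S (face (s , next s (g m₂))) ≡ 0ℤ →
               S (face (s , g m₃)) ≡ 0ℤ ⊎ S (face (s , next s (g m₃))) ≡ 0ℤ → ⊥
      around {m₁} {m₂} {m₃} (_ , n₁ , n₂ , n₃) o₁ o₂ o₃ b₁ b₂ b₃ = cases b₁ b₂ b₃
        where
        at₁ : ∀ {a b} → a ≡ b → S (face (s , a)) ≡ 0ℤ → S (face (s , b)) ≡ 0ℤ
        at₁ refl q = q
        cases : S (face (s , g m₁)) ≡ 0ℤ ⊎ S (face (s , next s (g m₁))) ≡ 0ℤ →
                S (face (s , g m₂)) ≡ 0ℤ ⊎ S (face (s , next s (g m₂))) ≡ 0ℤ →
                S (face (s , g m₃)) ≡ 0ℤ ⊎ S (face (s , next s (g m₃))) ≡ 0ℤ → ⊥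
        cases (inj₁ z₁) (inj₁ z₂) _         = crossing m₁ o₁ z₁ (at₁ (sym n₁) z₂)
        cases (inj₁ z₁) (inj₂ z₃) _         = crossing m₃ o₃ (at₁ n₂ z₃) (at₁ (sym n₃) z₁)
        cases (inj₂ z₂) _         (inj₁ z₃) = crossing m₂ o₂ (at₁ n₁ z₂) (at₁ (sym n₂) z₃)
        cases (inj₂ z₂) _         (inj₂ z₁) = crossing m₁ o₁ (at₁ n₃ z₁) z₂

    noTheta : ⊥
    noTheta = [ (λ R → around {l₁} {l₂} {l₃} R own₁ own₂ own₃ beside₁ beside₂ beside₃) ,
                (λ R → around {l₁} {l₃} {l₂} R own₁ own₃ own₂ beside₁ beside₃ beside₂) ]′ (rotation K)
      where
      third-is : ∃[ c ] Claw s (g l₁) (g l₂) c → Claw s (g l₁) (g l₂) (g l₃)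
      third-is (c , K) = [ (λ eq → ⊥-elim (g≢ l₃ l₁ (≢-sym p₁≢p₃) eq)) , [ (λ eq → ⊥-elim (g≢ l₃ l₂ (≢-sym p₂≢p₃) eq)) ,
        (λ eq → subst (Claw s (g l₁) (g l₂)) (sym eq) K) ]′ ]′ (Claw.only K (s∼g l₃))
      K : Claw s (g l₁) (g l₂) (g l₃)
      K = third-is (thirdEdge (s∼g l₁) (s∼g l₂) (g≢ l₁ l₂ p₁≢p₂))

  -- The amounts 1, 1 and -2 are nonzero with sum zero, so the three legs together carry a closed
  -- flow. Their routes may overlap within the remaining vertices, since the argument looks at the
  -- flow only around `s` and the vertices pᵢ.
  noK₂₃ : (∀ u v → Star Adjacent u v) → Σ[ outer ∈ Fin #faces ] (∀ v → OnFace outer v) →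
          NoK₂₃
  noK₂₃ connected (outer , onOuter) {s} {p₁} {p₂} {p₃} {o₁}
    (s≢p₁ , g₁ , s∼g₁ , p∼g₁) (s≢p₂ , g₂ , s∼g₂ , p∼g₂) (s≢p₃ , g₃ , s∼g₃ , p∼g₃) p₁≢p₂ p₁≢p₃ p₂≢p₃
    (p≢o₁ , k₁ , p∼k₁ , o∼k₁) (p≢o₂ , k₂ , p∼k₂ , o∼k₂) (p≢o₃ , k₃ , p∼k₃ , o∼k₃) P₁ P₂ P₃ r₂ r₃ =
    noTheta connected outer onOuter
      (record { amount = 1ℤ ; amount≢0 = λ () ; g = g₁ ; k = k₁ ; s≢p = s≢p₁ ; s∼g = s∼g₁ ; p∼g = p∼g₁
              ; p≢o = p≢o₁ ; p∼k = p∼k₁ ; o∼k = o∼k₁ ; route = ε {x = o₁}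
              ; ¬Ps = λ P → proj₁ P refl ; ¬Pp = λ P → proj₁ (proj₂ P) refl ; Po = P₁ })
      (record { amount = 1ℤ ; amount≢0 = λ () ; g = g₂ ; k = k₂ ; s≢p = s≢p₂ ; s∼g = s∼g₂ ; p∼g = p∼g₂
              ; p≢o = p≢o₂ ; p∼k = p∼k₂ ; o∼k = o∼k₂ ; route = r₂
              ; ¬Ps = λ P → proj₁ P refl ; ¬Pp = λ P → proj₁ (proj₂ (proj₂ P)) refl ; Po = P₂ })
      (record { amount = ℤ.-[1+ 1 ] ; amount≢0 = λ () ; g = g₃ ; k = k₃ ; s≢p = s≢p₃ ; s∼g = s∼g₃ ; p∼g = p∼g₃
              ; p≢o = p≢o₃ ; p∼k = p∼k₃ ; o∼k = o∼k₃ ; route = r₃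
              ; ¬Ps = λ P → proj₁ P refl ; ¬Pp = λ P → proj₂ (proj₂ (proj₂ P)) refl ; Po = P₃ })
      refl p₁≢p₂ p₁≢p₃ p₂≢p₃

-- Building up connected vertex sets

module Structure (G : CubicGraph) where
  open GraphKit G

  VSet : Set
  VSet = Subset #vertices

  record Pendant (W W′ : VSet) : Set where
    field
      {x w}   : Vertex
      {h p q} : Edge
      x∉W     : x ∉ W
      w∈W     : w ∈ W
      w∼h     : w ∼ h
      claw-x  : Claw x h p q
      h-only  : ∀ {z} → z ∈ W → z ∼ h → z ≡ w
      p-new   : ∀ {z} → z ∈ W → ¬ (z ∼ p)
      q-new   : ∀ {z} → z ∈ W → ¬ (z ∼ q)
      members : ∀ {z} → z ∈ W′ ⇆ (z ∈ W ⊎ z ≡ x)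

  -- A path y₀, …, yₘ₊₁ closing a cycle of length at least 4 with the edge e = uv.
  record Ear (W W′ : VSet) : Set where
    field
      {u v}      : Vertex
      {e}        : Edge
      m          : ℕ
      y          : Fin (2 ℕ.+ m) → Vertex
      x          : Fin (3 ℕ.+ m) → Edge
      q          : Fin (2 ℕ.+ m) → Edge
      u≢v        : u ≢ v
      u∈W        : u ∈ W
      v∈W        : v ∈ W
      u∼e        : u ∼ e
      v∼e        : v ∼ e
      claw-y     : ∀ j → Claw (y j) (x (inject₁ j)) (x (suc j)) (q j)
      u∼x        : u ∼ x zero
      v∼x        : v ∼ x (fromℕ _)
      first≢e    : x zero ≢ e
      last≢e     : x (fromℕ _) ≢ e
      first-only : ∀ {z} → z ∈ W → z ∼ x zero → z ≡ u
      last-only  : ∀ {z} → z ∈ W → z ∼ x (fromℕ _) → z ≡ v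
      x-new      : ∀ {z j} → z ∈ W → z ∼ x j → j ≡ zero ⊎ j ≡ fromℕ _
      q-new      : ∀ {z j} → z ∈ W → ¬ (z ∼ q j)
      x-inj      : ∀ {i j} → x i ≡ x j → i ≡ j
      q-inj      : ∀ {i j} → q i ≡ q j → i ≡ j
      x≢q        : ∀ {i j} → x i ≢ q j
      y∉W        : ∀ {j} → y j ∉ W
      y₀-adj     : Adjacent u (y zero)
      y-adj      : ∀ j → Adjacent (y (inject₁ j)) (y (suc j))
      members    : ∀ {z} → z ∈ W′ ⇆ (z ∈ W ⊎ (∃[ j ] z ≡ y j))

  -- The base is a parameter since the same set will be built up from various vertices and also from
  -- the two ends of an edge.
  data Built (B : VSet) : VSet → Set where
    base    : Built B B
    pendant : ∀ {W W′} → Built B W → Pendant W W′ → Built B W′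
    ear     : ∀ {W W′} → Built B W → Ear W W′ → Built B W′

  ConnectedSet : VSet → Set
  ConnectedSet W = ∀ {a b} → a ∈ W → b ∈ W → Reach (_∈ W) a b

  pendant⊂ : ∀ {W W′} → Pendant W W′ → ∣ W ∣ < ∣ W′ ∣
  pendant⊂ P = p⊂q⇒∣p∣<∣q∣ ((λ z∈ → proj₂ members (inj₁ z∈)) , x , proj₂ members (inj₂ refl) , x∉W)
    where open Pendant P

  ear⊂ : ∀ {W W′} → Ear W W′ → ∣ W ∣ < ∣ W′ ∣
  ear⊂ E = p⊂q⇒∣p∣<∣q∣ ((λ z∈ → proj₂ members (inj₁ z∈)) , y zero , proj₂ members (inj₂ (zero , refl)) , y∉W)
    where open Ear E

  pendant-connected : ∀ {W W′} → Pendant W W′ → ConnectedSet W → ConnectedSet W′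
  pendant-connected {W} {W′} P conn a∈ b∈ = to-w (proj₁ members a∈) ◅◅ reach-sym (to-w (proj₁ members b∈))
    where
    open Pendant P
    W⊆ : ∀ {z} → z ∈ W → z ∈ W′
    W⊆ z∈ = proj₂ members (inj₁ z∈)
    to-w : ∀ {z} → z ∈ W ⊎ z ≡ x → Reach (_∈ W′) z w
    to-w (inj₁ z∈)   = reach-map W⊆ (conn z∈ w∈W)
    to-w (inj₂ refl) = (adjacent (λ { refl → x∉W w∈W }) (Claw.v∼a claw-x) w∼h , proj₂ members (inj₂ refl) , W⊆ w∈W) ◅ ε

  ear-connected : ∀ {W W′} → Ear W W′ → ConnectedSet W → ConnectedSet W′
  ear-connected {W} {W′} E conn a∈ b∈ = to-u (proj₁ members a∈) ◅◅ reach-sym (to-u (proj₁ members b∈))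
    where
    open Ear E
    W⊆ : ∀ {z} → z ∈ W → z ∈ W′
    W⊆ z∈ = proj₂ members (inj₁ z∈)
    y∈ : ∀ j → y j ∈ W′
    y∈ j = proj₂ members (inj₂ (j , refl))
    y-to-u : ∀ {k} (f : Fin (suc k) → Vertex) → (∀ j → f j ∈ W′) → Adjacent u (f zero) →
             (∀ j → Adjacent (f (inject₁ j)) (f (suc j))) → ∀ j → Reach (_∈ W′) u (f j)
    y-to-u f f∈ a₀ as zero = (a₀ , W⊆ u∈W , f∈ zero) ◅ ε
    y-to-u {suc k} f f∈ a₀ as (suc j) = go f f∈ as (suc j) ((a₀ , W⊆ u∈W , f∈ zero) ◅ ε)
      where
      go : ∀ {k} (f : Fin (suc k) → Vertex) → (∀ j → f j ∈ W′) → (∀ j → Adjacent (f (inject₁ j)) (f (suc j))) →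
           ∀ j → Reach (_∈ W′) u (f zero) → Reach (_∈ W′) u (f j)
      go f f∈ as zero r = r
      go {suc k} f f∈ as (suc j) r = go (f ∘ suc) (f∈ ∘ suc) (as ∘ suc) j (r ◅◅ ((as zero , f∈ zero , f∈ (suc zero)) ◅ ε))
    to-u : ∀ {z} → z ∈ W ⊎ (∃[ j ] z ≡ y j) → Reach (_∈ W′) z u
    to-u (inj₁ z∈)         = reach-map W⊆ (conn z∈ u∈W)
    to-u (inj₂ (j , refl)) = reach-sym (y-to-u y y∈ y₀-adj y-adj j)

  built⊇ : ∀ {B W} → Built B W → B ⊆ W
  built⊇ base          = id
  built⊇ (pendant b P) = λ z∈ → proj₂ (Pendant.members P) (inj₁ (built⊇ b z∈))
  built⊇ (ear b E)     = λ z∈ → proj₂ (Ear.members E) (inj₁ (built⊇ b z∈))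

  built-connected : ∀ {B W} → ConnectedSet B → Built B W → ConnectedSet W
  built-connected conn base          = conn
  built-connected conn (pendant b P) = pendant-connected P (built-connected conn b)
  built-connected conn (ear b E)     = ear-connected E (built-connected conn b)

-- Existence of the construction: shortest ears

least : (P : ℕ → Set) → ∀ {n} → P n → ¬ ¬ (∃[ k ] P k × (∀ {l} → l < k → ¬ P l))
least P {n} Pn none = search (suc n) n ℕₚ.≤-refl Pn
  where
  search : ∀ b n → n < b → ¬ P n
  search (suc b) n (s≤s n≤b) Pn = none (n , Pn , λ l<n → search b _ (ℕₚ.≤-trans l<n n≤b))

module BuildingUp (G : CubicGraph) (triangle-free : TriangleFree G) (noK₂₃ : GraphKit.NoK₂₃ G) where
  open GraphKit G
  open Structure G

  infixr 5 _⟨_⟩_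
  data Path (P : Vertex → Set) : Vertex → Vertex → ℕ → Set where
    single : ∀ {x} → P x → Path P x x 0
    _⟨_⟩_  : ∀ {x x′ y n} → P x → Adjacent x x′ → Path P x′ y n → Path P x y (suc n)

  module _ {P : Vertex → Set} where
    -- Indices beyond the length of the path yield its last vertex.
    vtx : ∀ {x y n} → Path P x y n → ℕ → Vertex
    vtx {x} (single _)       _       = x
    vtx {x} (_ ⟨ _ ⟩ ρ) zero    = x
    vtx     (_ ⟨ _ ⟩ ρ) (suc k) = vtx ρ k

    vtx-zero : ∀ {x y n} (ρ : Path P x y n) → vtx ρ 0 ≡ x
    vtx-zero (single _)       = refl
    vtx-zero (_ ⟨ _ ⟩ _) = refl

    vtx-last : ∀ {x y n} (ρ : Path P x y n) → vtx ρ n ≡ y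
    vtx-last (single _)       = refl
    vtx-last (_ ⟨ _ ⟩ ρ) = vtx-last ρ

    vtx-P : ∀ {x y n} (ρ : Path P x y n) k → P (vtx ρ k)
    vtx-P (single p)       k       = p
    vtx-P (p ⟨ _ ⟩ ρ) zero    = p
    vtx-P (_ ⟨ _ ⟩ ρ) (suc k) = vtx-P ρ k

    vtx-adj : ∀ {x y n} (ρ : Path P x y n) {k} → k < n → Adjacent (vtx ρ k) (vtx ρ (suc k))
    vtx-adj (_ ⟨ a ⟩ ρ) {zero}  _         = subst (Adjacent _) (sym (vtx-zero ρ)) a
    vtx-adj (_ ⟨ a ⟩ ρ) {suc k} (s≤s k<n) = vtx-adj ρ k<n

    take : ∀ {x y n} (ρ : Path P x y n) {k} → k ≤ n → Path P x (vtx ρ k) k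
    take (single p)       {zero}  _         = (single p)
    take (p ⟨ _ ⟩ ρ) {zero}  _         = (single p)
    take (p ⟨ a ⟩ ρ) {suc k} (s≤s k≤n) = p ⟨ a ⟩ take ρ k≤n

    drop : ∀ {x y n} (ρ : Path P x y n) {k} → k ≤ n → Path P (vtx ρ k) y (n ℕ.∸ k)
    drop (single p)         {zero}  _         = (single p)
    drop ρ@(_ ⟨ _ ⟩ _) {zero}  _         = ρ
    drop (_ ⟨ _ ⟩ ρ)   {suc k} (s≤s k≤n) = drop ρ k≤n

    join : ∀ {x y y′ z n k} → Path P x y n → Adjacent y y′ → Path P y′ z k → Path P x z (suc (n ℕ.+ k))
    join (single p)       a σ = p ⟨ a ⟩ σ
    join (p ⟨ b ⟩ ρ) a σ = p ⟨ b ⟩ join ρ a σ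

    glue : ∀ {x y z n k} → Path P x y n → Path P y z k → Path P x z (n ℕ.+ k)
    glue (single _)       σ = σ
    glue (p ⟨ b ⟩ ρ) σ = p ⟨ b ⟩ glue ρ σ

    path⇒reach : ∀ {x y n} → Path P x y n → Reach P x y
    path⇒reach (single _)                 = ε
    path⇒reach (p ⟨ a ⟩ ρ@(single q))   = (a , p , q) ◅ ε
    path⇒reach (p ⟨ a ⟩ ρ@(q ⟨ _ ⟩ _)) = (a , p , q) ◅ path⇒reach ρ

    reach⇒path : ∀ {x y} → P x → Reach P x y → ∃[ n ] Path P x y n
    reach⇒path p ε = 0 , (single p)
    reach⇒path p ((a , _ , q) ◅ r) with n , ρ ← reach⇒path q r = suc n , p ⟨ a ⟩ ρ

  -- The walk is cut directly after its last visit to `x`.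
  leave : ∀ {P : Vertex → Set} {x z y} → y ≢ x → Reach P z y →
          (z ≢ x × Reach (λ v → P v × v ≢ x) z y) ⊎
          (∃[ o ] Adjacent x o × P o × o ≢ x × Reach (λ v → P v × v ≢ x) o y)
  leave y≢x ε = inj₁ (y≢x , ε)
  leave {x = x} {z} y≢x ((a , Pz , Po) ◅ r) with leave y≢x r
  ... | inj₂ found = inj₂ found
  ... | inj₁ (o≢x , r′) with z ≟ x
  ...   | yes refl = inj₂ (_ , a , Po , o≢x , r′)
  ...   | no z≢x   = inj₁ (z≢x , (a , (Pz , z≢x) , (Po , o≢x)) ◅ r′)

  module Within (U : VSet) where
    Outside : VSet → Vertex → Set
    Outside W z = z ∈ U × z ∉ W

    -- Ears with distinct ends are attached at adjacent vertices, so that each of them closes a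
    -- cycle with an edge. This property has to survive every extension of `W`.
    EarInvariant : VSet → Set
    EarInvariant W = ∀ {a b x y} → a ∈ W → b ∈ W → Outside W x → Outside W y → Adjacent a x → Adjacent b y →
                     Reach (Outside W) x y → a ≡ b ⊎ Adjacent a b

    ProperEar : VSet → ℕ → Set
    ProperEar W n = ∃[ a ] ∃[ b ] ∃[ x ] ∃[ y ]
      a ≢ b × a ∈ W × b ∈ W × Adjacent a x × Adjacent b y × Path (Outside W) x y n

    crossing : ∀ {W a z} → a ∈ W → z ∉ W → Reach (_∈ U) a z → ∃[ w ] ∃[ x ] w ∈ W × Outside W x × Adjacent w x
    crossing a∈ z∉ ε = ⊥-elim (z∉ a∈)
    crossing {W} a∈ z∉ (_◅_ {j = b} (adj , _ , b∈U) r) with b ∈? W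
    ... | yes b∈ = crossing b∈ z∉ r
    ... | no b∉  = _ , b , a∈ , (b∈U , b∉) , adj

    Extension : VSet → Set
    Extension W = Σ[ W′ ∈ VSet ] W′ ⊆ U × EarInvariant W′ × (Pendant W W′ ⊎ Ear W W′)

    -- A second neighbour of `x` in `W` would give a proper ear through `x`, and so would a path
    -- from `x` outside `W` that returns to a vertex other than `w`. Hence later ears at `x` can end
    -- only at `x` or at its neighbour `w`.
    addPendant : ∀ {W} → W ⊆ U → EarInvariant W → (∀ {n} → ¬ ProperEar W n) →
                 ∃[ w ] ∃[ x ] w ∈ W × Outside W x × Adjacent w x → Extension W
    addPendant {W} W⊆U inv noEar (w , x , w∈W , (x∈U , x∉W) , w≢x , h , w∼h , x∼h)
      with p , q , K ← clawFrom x∼h = W ∪ ⁅ x ⁆ , W′⊆U , inv′ , inj₁ (record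
      { x∉W = x∉W ; w∈W = w∈W ; w∼h = w∼h ; claw-x = K
      ; h-only = λ z∈ z∼h → [ id , (λ { refl → ⊥-elim (x∉W z∈) }) ]′ (ends-two w∼h x∼h z∼h w≢x)
      ; p-new = λ z∈ z∼p → Claw.a≢b K (only-h z∈ z∼p (Claw.v∼b K))
      ; q-new = λ z∈ z∼q → Claw.a≢c K (only-h z∈ z∼q (Claw.v∼c K))
      ; members = split , [ (λ z∈ → x∈p∪q⁺ (inj₁ z∈)) , (λ { refl → x∈p∪q⁺ (inj₂ (x∈⁅x⁆ x)) }) ]′ })
      where
      w~x : Adjacent w x
      w~x = w≢x , h , w∼h , x∼h
      split : ∀ {z} → z ∈ W ∪ ⁅ x ⁆ → z ∈ W ⊎ z ≡ x
      split z∈ = [ inj₁ , (λ z∈x → inj₂ (x∈⁅y⁆⇒x≡y x z∈x)) ]′ (x∈p∪q⁻ W ⁅ x ⁆ z∈)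
      W′⊆U : W ∪ ⁅ x ⁆ ⊆ U
      W′⊆U z∈ = [ W⊆U , (λ { refl → x∈U }) ]′ (split z∈)
      only-w : ∀ {z} → z ∈ W → Adjacent z x → z ≡ w
      only-w {z} z∈ z~x with z ≟ w
      ... | yes z≡w = z≡w
      ... | no z≢w  = ⊥-elim (noEar (z , w , x , x , z≢w , z∈ , w∈W , z~x , w~x , single (x∈U , x∉W)))
      only-h : ∀ {z g} → z ∈ W → z ∼ g → x ∼ g → h ≡ g
      only-h z∈ z∼g x∼g with refl ← only-w z∈ (adjacent (λ { refl → x∉W z∈ }) z∼g x∼g) = same-ends w∼h x∼h z∼g x∼g w≢x
      shrink : ∀ {z} → Outside (W ∪ ⁅ x ⁆) z → Outside W z
      shrink (z∈U , z∉) = z∈U , λ z∈ → z∉ (x∈p∪q⁺ (inj₁ z∈))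
      through : ∀ {b x′ y′} → b ∈ W → Outside (W ∪ ⁅ x ⁆) x′ → Adjacent x x′ → Adjacent b y′ →
                Reach (Outside (W ∪ ⁅ x ⁆)) x′ y′ → b ≡ w
      through {b} b∈ out x~x′ b~y′ r with b ≟ w
      ... | yes b≡w = b≡w
      ... | no b≢w with n , ρ ← reach⇒path (x∈U , x∉W) ((x~x′ , (x∈U , x∉W) , shrink out) ◅ reach-map shrink r) =
        ⊥-elim (noEar (w , b , x , _ , ≢-sym b≢w , w∈W , b∈ , w~x , b~y′ , ρ))
      inv′ : EarInvariant (W ∪ ⁅ x ⁆)
      inv′ a∈ b∈ x′-out y′-out a~x′ b~y′ r with split a∈ | split b∈
      ... | inj₁ a∈W  | inj₁ b∈W  = inv a∈W b∈W (shrink x′-out) (shrink y′-out) a~x′ b~y′ (reach-map shrink r)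
      ... | inj₂ refl | inj₂ refl = inj₁ refl
      ... | inj₂ refl | inj₁ b∈W with refl ← through b∈W x′-out a~x′ b~y′ r = inj₂ (adj-sym w~x)
      ... | inj₁ a∈W  | inj₂ refl with refl ← through a∈W y′-out b~y′ a~x′ (reach-sym r) = inj₂ w~x

    module AddEar {W : VSet} (W⊆U : W ⊆ U) (inv : EarInvariant W) {a b x₀ y₀ m}
                  (a≢b : a ≢ b) (a∈W : a ∈ W) (b∈W : b ∈ W) (a~b : Adjacent a b)
                  (a~x₀ : Adjacent a x₀) (b~y₀ : Adjacent b y₀)
                  (ρ : Path (Outside W) x₀ y₀ (suc m)) (shortest : ∀ {l} → l < suc m → ¬ ProperEar W l) where

      private
        n : ℕ
        n = suc m

      out : ∀ k → Outside W (vtx ρ k)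
      out = vtx-P ρ

      cut< : ∀ {i j} → i < j → j ≤ n → i ℕ.+ (n ℕ.∸ j) < n
      cut< {i} {j} i<j j≤n = subst (i ℕ.+ (n ℕ.∸ j) <_) (ℕₚ.m+[n∸m]≡n j≤n) (ℕₚ.+-monoˡ-< (n ℕ.∸ j) i<j)

      -- Here and in the next lemmas minimality is used by cutting: a repeated vertex, a chord or a
      -- further edge to `W` would provide a shorter proper ear.
      vtx-inj : ∀ {i j} → i < j → j ≤ n → vtx ρ i ≢ vtx ρ j
      vtx-inj {i} {j} i<j j≤n eq = shortest (cut< i<j j≤n) (a , b , x₀ , y₀ , a≢b , a∈W , b∈W , a~x₀ , b~y₀ ,
        glue (take ρ (ℕₚ.≤-trans (ℕₚ.<⇒≤ i<j) j≤n)) (subst (λ z → Path _ z y₀ (n ℕ.∸ j)) (sym eq) (drop ρ j≤n)))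

      vtx-chord : ∀ {i j} → i < j → j ≤ n → Adjacent (vtx ρ i) (vtx ρ j) → j ≡ suc i
      vtx-chord {i} {j} i<j j≤n adj with suc i ℕₚ.≟ j
      ... | yes eq = sym eq
      ... | no neq = ⊥-elim (shortest (cut< (ℕₚ.≤∧≢⇒< i<j neq) j≤n) (a , b , x₀ , y₀ , a≢b , a∈W , b∈W , a~x₀ , b~y₀ ,
        join (take ρ (ℕₚ.≤-trans (ℕₚ.<⇒≤ i<j) j≤n)) adj (drop ρ j≤n)))

      chord-a : ∀ {i z} → i < n → z ∈ W → Adjacent z (vtx ρ i) → z ≡ a
      chord-a {i} {z} i<n z∈ adj with z ≟ a
      ... | yes eq = eq
      ... | no z≢a = ⊥-elim (shortest i<n (a , z , x₀ , _ , ≢-sym z≢a , a∈W , z∈ , a~x₀ , adj , take ρ (ℕₚ.<⇒≤ i<n)))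

      chord-b : ∀ {i z} → 0 < i → i ≤ n → z ∈ W → Adjacent z (vtx ρ i) → z ≡ b
      chord-b {i} {z} 0<i i≤n z∈ adj with z ≟ b
      ... | yes eq = eq
      ... | no z≢b = ⊥-elim (shortest (cut< 0<i i≤n) (z , b , _ , y₀ , z≢b , z∈ , b∈W , adj , b~y₀ , drop ρ i≤n))

      -- The cycle formed by the ear and the edge ab, with the indices 0 to `n + 2`. Its closing
      -- edge joins the first index to the last one, an exception in most of the statements below.
      c : ℕ → Vertex
      c zero    = a
      c (suc k) with k ℕₚ.≤? n
      ... | yes _ = vtx ρ k
      ... | no _  = b

      c-in : ∀ {k} → k ≤ n → c (suc k) ≡ vtx ρ k
      c-in {k} k≤n with k ℕₚ.≤? n
      ... | yes _ = refl
      ... | no k≰ = ⊥-elim (k≰ k≤n)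

      c-end : c (suc (suc n)) ≡ b
      c-end with suc n ℕₚ.≤? n
      ... | yes p = ⊥-elim (ℕₚ.1+n≰n p)
      ... | no _  = refl

      data Index : ℕ → Set where
        start : Index 0
        inner : ∀ {k} → k ≤ n → Index (suc k)
        end   : Index (suc (suc n))

      index : ∀ {k} → k ≤ suc (suc n) → Index k
      index {zero} _ = start
      index {suc k} (s≤s k≤) with k ℕₚ.≟ suc n
      ... | yes refl = end
      ... | no k≢    = inner (ℕₚ.≤-pred (ℕₚ.≤∧≢⇒< k≤ k≢))

      c-out : ∀ {k} → k ≤ n → Outside W (c (suc k))
      c-out k≤n = subst (Outside W) (sym (c-in k≤n)) (out _)

      c-inj : ∀ {i j} → i < j → j ≤ suc (suc n) → c i ≢ c j
      c-inj {i} {j} i<j j≤ eq with index (ℕₚ.≤-trans (ℕₚ.<⇒≤ i<j) j≤) | index j≤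
      ... | start     | inner j≤n = proj₂ (c-out j≤n) (subst (_∈ W) eq a∈W)
      ... | start     | end       = a≢b (trans eq c-end)
      ... | inner i≤n | inner j≤n = vtx-inj (ℕₚ.≤-pred i<j) j≤n (trans (sym (c-in i≤n)) (trans eq (c-in j≤n)))
      ... | inner i≤n | end       = proj₂ (c-out i≤n) (subst (_∈ W) (sym (trans eq c-end)) b∈W)
      ... | end       | inner j≤n = ℕₚ.<⇒≱ i<j (ℕₚ.≤-trans (s≤s j≤n) (ℕₚ.n≤1+n _))
      ... | end       | end       = ℕₚ.<-irrefl refl i<j

      c-≢ : ∀ {i j} → i ≤ suc (suc n) → j ≤ suc (suc n) → i ≢ j → c i ≢ c j
      c-≢ {i} {j} i≤ j≤ i≢j with ℕₚ.<-cmp i j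
      ... | tri< i<j _ _ = c-inj i<j j≤
      ... | tri≈ _ i≡j _ = ⊥-elim (i≢j i≡j)
      ... | tri> _ _ j<i = ≢-sym (c-inj j<i i≤)

      c-≡ : ∀ {i j} → i ≤ suc (suc n) → j ≤ suc (suc n) → c i ≡ c j → i ≡ j
      c-≡ {i} {j} i≤ j≤ eq = decidable-stable (i ℕₚ.≟ j) λ i≢j → c-≢ i≤ j≤ i≢j eq

      abstract
        c-adj : ∀ {k} → k < suc (suc n) → Adjacent (c k) (c (suc k))
        c-adj {zero} _ = subst (Adjacent a) (sym (trans (c-in z≤n) (vtx-zero ρ))) a~x₀
        c-adj {suc k} (s≤s (s≤s k≤n)) with k ℕₚ.≟ n
        ... | yes refl = subst₂ Adjacent (sym (trans (c-in k≤n) (vtx-last ρ))) (sym c-end) (adj-sym b~y₀)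
        ... | no k≢n   = subst₂ Adjacent (sym (c-in k≤n)) (sym (c-in (ℕₚ.≤∧≢⇒< k≤n k≢n))) (vtx-adj ρ (ℕₚ.≤∧≢⇒< k≤n k≢n))

      n>0 : 0 < n
      n>0 = s≤s z≤n

      c-chord : ∀ {i j} → i < j → j ≤ suc (suc n) → Adjacent (c i) (c j) → j ≡ suc i ⊎ (i ≡ 0 × j ≡ suc (suc n))
      c-chord {i} {j} i<j j≤ adj with index (ℕₚ.≤-trans (ℕₚ.<⇒≤ i<j) j≤) | index j≤
      ... | start | end = inj₂ (refl , refl)
      ... | start | inner {zero} _ = inj₁ refl
      ... | start | inner {suc k} k≤n =
        ⊥-elim (a≢b (chord-b (s≤s z≤n) k≤n a∈W (subst (Adjacent a) (c-in k≤n) adj)))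
      ... | inner i≤n | inner j≤n =
        inj₁ (cong suc (vtx-chord (ℕₚ.≤-pred i<j) j≤n (subst₂ Adjacent (c-in i≤n) (c-in j≤n) adj)))
      ... | inner {k} k≤n | end with k ℕₚ.≟ n
      ...   | yes refl = inj₁ refl
      ...   | no k≢n   = ⊥-elim (a≢b (sym (chord-a (ℕₚ.≤∧≢⇒< k≤n k≢n) b∈W (adj-sym (subst₂ Adjacent (c-in k≤n) c-end adj)))))
      c-chord i<j j≤ adj | end | inner j≤n = ⊥-elim (ℕₚ.<⇒≱ i<j (ℕₚ.≤-trans (s≤s j≤n) (ℕₚ.n≤1+n _)))
      c-chord i<j j≤ adj | end | end = ⊥-elim (ℕₚ.<-irrefl refl i<j)

      c-inW : ∀ {k z} → k ≤ n → z ∈ W → Adjacent z (c (suc k)) → z ≡ a ⊎ z ≡ b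
      c-inW {zero}  k≤n z∈ adj = inj₁ (chord-a n>0 z∈ (subst (Adjacent _) (c-in k≤n) adj))
      c-inW {suc k} k≤n z∈ adj = inj₂ (chord-b (s≤s z≤n) k≤n z∈ (subst (Adjacent _) (c-in k≤n) adj))

      y : Fin (suc n) → Vertex
      y j = c (suc (toℕ j))

      member? : ∀ z → Dec (z ∈ W ⊎ (∃[ j ] z ≡ y j))
      member? z = (z ∈? W) ⊎-dec any? λ j → z ≟ y j

      abstract
        W′ : VSet
        W′ = ⟦ member? ⟧

        members : ∀ {z} → z ∈ W′ ⇆ (z ∈ W ⊎ (∃[ j ] z ≡ y j))
        members = ∈⟦⟧⁻ member? , ∈⟦⟧⁺ member?

      toℕ≤ : ∀ {k} (j : Fin (suc k)) → toℕ j ≤ k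
      toℕ≤ j = ℕₚ.≤-pred (toℕ<n j)

      c∈W′ : ∀ {k} → k ≤ suc (suc n) → c k ∈ W′
      c∈W′ k≤ with index k≤
      ... | start     = proj₂ members (inj₁ a∈W)
      ... | inner k≤n = proj₂ members (inj₂ (fromℕ< (s≤s k≤n) , cong (c ∘ suc) (sym (toℕ-fromℕ< (s≤s k≤n)))))
      ... | end       = proj₂ members (inj₁ (subst (_∈ W) (sym c-end) b∈W))

      x : Fin (suc (suc n)) → Edge
      x j = proj₁ (proj₂ (c-adj (toℕ<n j)))

      x-start : ∀ j → c (toℕ j) ∼ x j
      x-start j = proj₁ (proj₂ (proj₂ (c-adj (toℕ<n j))))

      x-end : ∀ j → c (suc (toℕ j)) ∼ x j
      x-end j = proj₂ (proj₂ (proj₂ (c-adj (toℕ<n j))))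

      x-ends : ∀ {z} j → z ∼ x j → z ≡ c (toℕ j) ⊎ z ≡ c (suc (toℕ j))
      x-ends j z∼ = ends-two (x-start j) (x-end j) z∼ (proj₁ (c-adj (toℕ<n j)))

      x-index : ∀ {k} j → k ≤ suc (suc n) → c k ∼ x j → k ≡ toℕ j ⊎ k ≡ suc (toℕ j)
      x-index j k≤ ∼x = [ (λ eq → inj₁ (c-≡ k≤ (ℕₚ.m≤n⇒m≤1+n (toℕ≤ j)) eq)) , (λ eq → inj₂ (c-≡ k≤ (toℕ<n j) eq)) ]′ (x-ends j ∼x)

      x-inj : ∀ {i j} → x i ≡ x j → i ≡ j
      x-inj {i} {j} eq = toℕ-injective (match (x-index j (ℕₚ.m≤n⇒m≤1+n (toℕ≤ i)) (subst (c (toℕ i) ∼_) eq (x-start i)))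
                                              (x-index j (toℕ<n i) (subst (c (suc (toℕ i)) ∼_) eq (x-end i))))
        where
        match : ∀ {i j} → i ≡ j ⊎ i ≡ suc j → suc i ≡ j ⊎ suc i ≡ suc j → i ≡ j
        match         (inj₁ p) _        = p
        match         (inj₂ _) (inj₂ q) = ℕₚ.suc-injective q
        match {i} {j} (inj₂ p) (inj₁ q) =
          ⊥-elim (ℕₚ.<-irrefl (trans p (cong suc (sym q))) (ℕₚ.m<n⇒m<1+n (ℕₚ.n<1+n i)))

      y∼prev : ∀ j → y j ∼ x (inject₁ j)
      y∼prev j = subst (λ k → c (suc k) ∼ x (inject₁ j)) (toℕ-inject₁ j) (x-end (inject₁ j))

      y∼next : ∀ j → y j ∼ x (suc j)
      y∼next j = x-start (suc j)

      prev≢next : ∀ j → x (inject₁ j) ≢ x (suc j)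
      prev≢next j eq = ℕₚ.1+n≢n (sym (trans (sym (toℕ-inject₁ j)) (cong toℕ (x-inj eq))))

      abstract
        q : Fin (suc n) → Edge
        q j = proj₁ (thirdEdge (y∼prev j) (y∼next j) (prev≢next j))

        claw-y : ∀ j → Claw (y j) (x (inject₁ j)) (x (suc j)) (q j)
        claw-y j = proj₂ (thirdEdge (y∼prev j) (y∼next j) (prev≢next j))

      x≢q : ∀ {i j} → x i ≢ q j
      x≢q {i} {j} eq with x-index {suc (toℕ j)} i (s≤s (ℕₚ.m≤n⇒m≤1+n (toℕ≤ j))) (subst (y j ∼_) (sym eq) (Claw.v∼c (claw-y j)))
      ... | inj₁ p = Claw.b≢c (claw-y j) (trans (cong x (toℕ-injective p)) eq)
      ... | inj₂ p = Claw.a≢c (claw-y j) (trans (cong x (toℕ-injective (trans (toℕ-inject₁ j) (ℕₚ.suc-injective p)))) eq)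

      chord-edge : ∀ {k l g} → k < l → l ≤ suc (suc n) → c k ∼ g → c l ∼ g → (∃[ i ] g ≡ x i) ⊎ (k ≡ 0 × l ≡ suc (suc n))
      chord-edge {k} {l} {g} k<l l≤ k∼g l∼g with c-chord k<l l≤ (adjacent (c-inj k<l l≤) k∼g l∼g)
      ... | inj₂ both≡ = inj₂ both≡
      ... | inj₁ refl = inj₁ (i , same-ends k∼g l∼g (subst (λ k → c k ∼ x i) toℕ-i (x-start i))
                              (subst (λ k → c (suc k) ∼ x i) toℕ-i (x-end i)) (c-inj k<l l≤))
        where
        i : Fin (suc (suc n))
        i = fromℕ< l≤
        toℕ-i : toℕ i ≡ k
        toℕ-i = toℕ-fromℕ< l≤

      q-inj : ∀ {i j} → q i ≡ q j → i ≡ j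
      q-inj {i} {j} eq with ℕₚ.<-cmp (toℕ i) (toℕ j)
      ... | tri≈ _ i≡j _ = toℕ-injective i≡j
      ... | tri< i<j _ _ with chord-edge (s≤s i<j) (s≤s (ℕₚ.m≤n⇒m≤1+n (toℕ≤ j))) (Claw.v∼c (claw-y i))
                               (subst (y j ∼_) (sym eq) (Claw.v∼c (claw-y j)))
      ...   | inj₁ (_ , p) = ⊥-elim (x≢q (sym p))
      q-inj {i} {j} eq | tri> _ _ j<i with chord-edge (s≤s j<i) (s≤s (ℕₚ.m≤n⇒m≤1+n (toℕ≤ i))) (Claw.v∼c (claw-y j))
                               (subst (y i ∼_) eq (Claw.v∼c (claw-y i)))
      ...   | inj₁ (_ , p) = ⊥-elim (x≢q (sym p))

      y∉W : ∀ {j} → y j ∉ W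
      y∉W {j} = proj₂ (c-out (toℕ≤ j))

      q-new : ∀ {z j} → z ∈ W → ¬ (z ∼ q j)
      q-new {z} {j} z∈ z∼q with c-inW (toℕ≤ j) z∈ (adjacent (λ { refl → y∉W {j} z∈ }) z∼q (Claw.v∼c (claw-y j)))
      ... | inj₁ refl with chord-edge {0} (s≤s z≤n) (s≤s (ℕₚ.m≤n⇒m≤1+n (toℕ≤ j))) z∼q (Claw.v∼c (claw-y j))
      ...   | inj₁ (_ , p)  = x≢q (sym p)
      ...   | inj₂ (_ , eq) = ℕₚ.<⇒≢ (toℕ<n j) (ℕₚ.suc-injective eq)
      q-new {z} {j} z∈ z∼q | inj₂ refl with chord-edge (s≤s (toℕ<n j)) ℕₚ.≤-refl (Claw.v∼c (claw-y j)) (subst (_∼ q j) (sym c-end) z∼q)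
      ...   | inj₁ (_ , p) = x≢q (sym p)

      c∈W⇒ : ∀ {k} → k ≤ suc (suc n) → c k ∈ W → k ≡ 0 ⊎ k ≡ suc (suc n)
      c∈W⇒ k≤ c∈ with index k≤
      ... | start     = inj₁ refl
      ... | inner k≤n = ⊥-elim (proj₂ (c-out k≤n) c∈)
      ... | end       = inj₂ refl

      x-new : ∀ {z j} → z ∈ W → z ∼ x j → j ≡ zero ⊎ j ≡ fromℕ (suc n)
      x-new {z} {j} z∈ z∼x with x-ends j z∼x
      ... | inj₁ refl with c∈W⇒ (ℕₚ.m≤n⇒m≤1+n (toℕ≤ j)) z∈
      ...   | inj₁ p = inj₁ (toℕ-injective p)
      ...   | inj₂ p = ⊥-elim (ℕₚ.<⇒≢ (toℕ<n j) p)
      x-new {z} {j} z∈ z∼x | inj₂ refl with c∈W⇒ (toℕ<n j) z∈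
      ...   | inj₂ p = inj₂ (toℕ-injective (trans (ℕₚ.suc-injective p) (sym (toℕ-fromℕ (suc n)))))

      newEar : Ear W W′
      newEar = record
        { m = m ; y = y ; x = x ; q = q ; u≢v = a≢b ; u∈W = a∈W ; v∈W = b∈W
        ; u∼e = proj₁ (proj₂ (proj₂ a~b)) ; v∼e = proj₂ (proj₂ (proj₂ a~b))
        ; claw-y = claw-y ; u∼x = x-start zero ; v∼x = v∼last
        ; first≢e = λ eq → 0≢2+ (x-index {suc (suc n)} zero ℕₚ.≤-refl
            (subst₂ _∼_ (sym c-end) (sym eq) (proj₂ (proj₂ (proj₂ a~b)))))
        ; last≢e = λ eq → last≢0 (x-index {0} (fromℕ (suc n)) z≤n (subst (a ∼_) (sym eq) (proj₁ (proj₂ (proj₂ a~b)))))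
        ; first-only = λ z∈ z∼ → [ id , (λ { refl → ⊥-elim (proj₂ (c-out z≤n) z∈) }) ]′ (x-ends zero z∼)
        ; last-only = last-only
        ; x-new = x-new ; q-new = q-new ; x-inj = x-inj ; q-inj = q-inj ; x≢q = x≢q
        ; y∉W = λ {j} → y∉W {j} ; y₀-adj = c-adj (s≤s z≤n)
        ; y-adj = λ j → subst (λ k → Adjacent (c (suc k)) (y (suc j))) (sym (toℕ-inject₁ j)) (c-adj (s≤s (s≤s (ℕₚ.m≤n⇒m≤1+n (toℕ≤ j)))))
        ; members = members }
        where
        v∼last : b ∼ x (fromℕ (suc n))
        v∼last = subst (_∼ x (fromℕ (suc n))) (trans (cong (c ∘ suc) (toℕ-fromℕ (suc n))) c-end) (x-end (fromℕ (suc n)))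
        0≢2+ : ¬ (suc (suc n) ≡ 0 ⊎ suc (suc n) ≡ 1)
        0≢2+ (inj₁ ())
        0≢2+ (inj₂ ())
        last≢0 : ¬ (0 ≡ toℕ (fromℕ (suc n)) ⊎ 0 ≡ suc (toℕ (fromℕ (suc n))))
        last≢0 (inj₁ ())
        last≢0 (inj₂ ())
        last-only : ∀ {z} → z ∈ W → z ∼ x (fromℕ (suc n)) → z ≡ b
        last-only {z} z∈ z∼ with x-ends (fromℕ (suc n)) z∼
        ... | inj₂ eq = trans eq (trans (cong (c ∘ suc) (toℕ-fromℕ (suc n))) c-end)
        ... | inj₁ eq = ⊥-elim (proj₂ (c-out ℕₚ.≤-refl) (subst (_∈ W) (trans eq (cong c (toℕ-fromℕ (suc n)))) z∈))

      W′⊆U : W′ ⊆ U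
      W′⊆U z∈ with proj₁ members z∈
      ... | inj₁ z∈W        = W⊆U z∈W
      ... | inj₂ (j , refl) = proj₁ (c-out (toℕ≤ j))

      shrink : ∀ {z} → Outside W′ z → Outside W z
      shrink (z∈U , z∉) = z∈U , λ z∈ → z∉ (proj₂ members (inj₁ z∈))

      out≢c : ∀ {z k} → Outside W′ z → k ≤ suc (suc n) → z ≢ c k
      out≢c (_ , z∉) k≤ refl = z∉ (c∈W′ k≤)

      segment : ∀ {T i j} → i ≤ j → j ≤ suc (suc n) → (∀ {k} → i ≤ k → k ≤ j → T (c k)) → Reach T (c i) (c j)
      segment {j = zero}  z≤n _ _ = ε
      segment {T} {i} {suc j} i≤ j≤ inT with ℕₚ.m≤n⇒m<n∨m≡n i≤
      ... | inj₂ refl = ε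
      ... | inj₁ i<   = segment (ℕₚ.≤-pred i<) (ℕₚ.<⇒≤ j≤) (λ p q → inT p (ℕₚ.m≤n⇒m≤1+n q)) ◅◅
        ((c-adj j≤ , inT (ℕₚ.≤-pred i<) (ℕₚ.n≤1+n _) , inT i≤ ℕₚ.≤-refl) ◅ ε)

      closing : Adjacent a (c (suc (suc n)))
      closing = subst (Adjacent a) (sym c-end) a~b

      -- An ear between non-consecutive vertices of the cycle gives a K₂,₃ minor: two branch sets are
      -- cᵢ and the part of the cycle and of the ear away from cᵢ, the others the neighbours of cᵢ.
      module Minor {i j k₁ k₂ l₁ l₂ : ℕ}
                   (i≤ : i ≤ suc (suc n)) (j≤ : j ≤ suc (suc n)) (k₁≤ : k₁ ≤ suc (suc n)) (k₂≤ : k₂ ≤ suc (suc n))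
                   (i~k₁ : Adjacent (c i) (c k₁)) (i~k₂ : Adjacent (c i) (c k₂)) (k₁≢k₂ : k₁ ≢ k₂)
                   (k₁~l₁ : Adjacent (c k₁) (c l₁)) (k₂~l₂ : Adjacent (c k₂) (c l₂)) where
        Away : ℕ → Set
        Away k = k ≤ suc (suc n) × k ≢ i × k ≢ k₁ × k ≢ k₂

        Route : ℕ → ℕ → Set₁
        Route k l = ∀ {T : Vertex → Set} → (∀ {k} → Away k → T (c k)) → Reach T (c k) (c l)

        impossible : ∀ {x′ y′} → Away j → Away l₁ → Away l₂ → Route l₂ l₁ → Route j l₁ →
                     Outside W′ x′ → Outside W′ y′ → Adjacent (c i) x′ → Adjacent (c j) y′ → Reach (Outside W′) x′ y′ → ⊥
        impossible {x′} {y′} away-j away-l₁ away-l₂ l₂→l₁ j→l₁ x′-out y′-out i~x′ j~y′ r = conclude (y′ ≟ x′)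
          where
          T : Vertex → Set
          T z = z ≢ c i × z ≢ c k₁ × z ≢ c k₂ × z ≢ x′
          T-c : ∀ {k} → Away k → T (c k)
          T-c (k≤ , k≢i , k≢k₁ , k≢k₂) =
            c-≢ k≤ i≤ k≢i , c-≢ k≤ k₁≤ k≢k₁ , c-≢ k≤ k₂≤ k≢k₂ , λ eq → out≢c x′-out k≤ (sym eq)
          T-out : ∀ {z} → Outside W′ z × z ≢ x′ → T z
          T-out (out , z≢x′) = out≢c out i≤ , out≢c out k₁≤ , out≢c out k₂≤ , z≢x′
          from : ∀ {o} → Adjacent x′ o → T o → Reach T o (c j) → ⊥
          from x′~o To s = noK₂₃ i~k₁ i~k₂ i~x′ (c-≢ k₁≤ k₂≤ k₁≢k₂) (λ eq → out≢c x′-out k₁≤ (sym eq))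
            (λ eq → out≢c x′-out k₂≤ (sym eq)) k₁~l₁ k₂~l₂ x′~o (T-c away-l₁) (T-c away-l₂) To (l₂→l₁ T-c) (s ◅◅ j→l₁ T-c)
          -- The third neighbour of `c i` is `x′`. The rest of the ear, after its last visit to
          -- `x′`, joins `c j` and the remaining part of the cycle.
          conclude : Dec (y′ ≡ x′) → ⊥
          conclude (yes refl) = from (adj-sym j~y′) (T-c away-j) ε
          conclude (no y′≢x′) with leave y′≢x′ r
          ... | inj₁ (x′≢x′ , _) = x′≢x′ refl
          ... | inj₂ (o , x′~o , o-out , o≢x′ , s) = from x′~o (T-out (o-out , o≢x′))
            (reach-map T-out s ◅◅ ((adj-sym j~y′ , T-out (y′-out , y′≢x′) , T-c away-j) ◅ ε))

      -- The three cases differ in the place where the closing edge enters: at `c i` itself, at its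
      -- neighbour `c 0`, or on the part of the cycle away from `c i`.
      noCrossEar : ∀ {i j x′ y′} → i < j → j ≤ suc (suc n) → j ≢ suc i → ¬ (i ≡ 0 × j ≡ suc (suc n)) →
                   Outside W′ x′ → Outside W′ y′ → Adjacent (c i) x′ → Adjacent (c j) y′ → Reach (Outside W′) x′ y′ → ⊥
      noCrossEar {zero} {j} 0<j j≤ j≢1 ¬ends =
        impossible (away 2≤j j≤n+1) (away ℕₚ.≤-refl (s≤s n>0)) (away (s≤s n>0) ℕₚ.≤-refl)
          (λ inT → reach-sym (segment (s≤s n>0) (ℕₚ.n≤1+n _) (λ p q → inT (away p q))))
          (λ inT → reach-sym (segment 2≤j j≤ (λ p q → inT (away p (ℕₚ.≤-trans q j≤n+1)))))
        where
        open Minor {0} {j} {1} {suc (suc n)} {2} {suc n} z≤n j≤ (s≤s z≤n) ℕₚ.≤-refl (c-adj (s≤s z≤n)) closing (λ ())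
                   (c-adj (s≤s (s≤s z≤n))) (adj-sym (c-adj ℕₚ.≤-refl))
        2≤j : 2 ≤ j
        2≤j = ℕₚ.≤∧≢⇒< 0<j (≢-sym j≢1)
        j≤n+1 : j ≤ suc n
        j≤n+1 = ℕₚ.≤-pred (ℕₚ.≤∧≢⇒< j≤ (λ eq → ¬ends (refl , eq)))
        away : ∀ {k} → 2 ≤ k → k ≤ suc n → Away k
        away (s≤s (s≤s _)) k≤ = ℕₚ.m≤n⇒m≤1+n k≤ , (λ ()) , (λ ()) , ℕₚ.<⇒≢ (s≤s k≤)
      noCrossEar {suc zero} {j} 1<j j≤ j≢2 _ =
        impossible (away 3≤j j≤) (away ℕₚ.≤-refl (ℕₚ.≤-trans 3≤j j≤)) (away (ℕₚ.≤-trans 3≤j j≤) ℕₚ.≤-refl)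
          (λ inT → reach-sym (segment (ℕₚ.≤-trans 3≤j j≤) ℕₚ.≤-refl (λ p q → inT (away p q))))
          (λ inT → reach-sym (segment 3≤j j≤ (λ p q → inT (away p (ℕₚ.≤-trans q j≤)))))
        where
        3≤j : 3 ≤ j
        3≤j = ℕₚ.≤∧≢⇒< 1<j (≢-sym j≢2)
        open Minor {1} {j} {2} {0} {3} {suc (suc n)} (s≤s z≤n) j≤ (s≤s (s≤s z≤n)) z≤n (c-adj (s≤s (s≤s z≤n)))
                   (adj-sym (c-adj (s≤s z≤n))) (λ ()) (c-adj (ℕₚ.≤-trans 3≤j j≤)) closing
        away : ∀ {k} → 3 ≤ k → k ≤ suc (suc n) → Away k
        away (s≤s (s≤s (s≤s _))) k≤ = k≤ , (λ ()) , (λ ()) , (λ ())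
      noCrossEar {suc (suc i)} {j} i<j j≤ j≢ _ =
        impossible (above 4+i≤j j≤) (above ℕₚ.≤-refl 4+i≤) (below ℕₚ.≤-refl)
          (λ inT → reach-sym (segment z≤n i≤ (λ _ q → inT (below q))) ◅◅
                   ((closing , inT (below z≤n) , inT (above 4+i≤ ℕₚ.≤-refl)) ◅ ε) ◅◅
                   reach-sym (segment 4+i≤ ℕₚ.≤-refl (λ p q → inT (above p q))))
          (λ inT → reach-sym (segment 4+i≤j j≤ (λ p q → inT (above p (ℕₚ.≤-trans q j≤)))))
        where
        4+i≤j : 4 ℕ.+ i ≤ j
        4+i≤j = ℕₚ.≤∧≢⇒< i<j (≢-sym j≢)
        4+i≤ : 4 ℕ.+ i ≤ suc (suc n)
        4+i≤ = ℕₚ.≤-trans 4+i≤j j≤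
        3+i≤ : 3 ℕ.+ i ≤ suc (suc n)
        3+i≤ = ℕₚ.<⇒≤ 4+i≤
        2+i≤ : 2 ℕ.+ i ≤ suc (suc n)
        2+i≤ = ℕₚ.<⇒≤ 3+i≤
        1+i≤ : 1 ℕ.+ i ≤ suc (suc n)
        1+i≤ = ℕₚ.<⇒≤ 2+i≤
        i≤ : i ≤ suc (suc n)
        i≤ = ℕₚ.<⇒≤ 1+i≤
        open Minor {suc (suc i)} {j} {3 ℕ.+ i} {suc i} {4 ℕ.+ i} {i} 2+i≤ j≤ 3+i≤ 1+i≤ (c-adj 3+i≤)
                   (adj-sym (c-adj 2+i≤)) (λ eq → ℕₚ.<⇒≢ (s≤s (ℕₚ.m≤n+m i 1)) (sym (ℕₚ.suc-injective (ℕₚ.suc-injective (cong suc eq))))) (c-adj 4+i≤) (adj-sym (c-adj 1+i≤))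
        above : ∀ {k} → 4 ℕ.+ i ≤ k → k ≤ suc (suc n) → Away k
        above p k≤ = k≤ , ≢-sym (ℕₚ.<⇒≢ (ℕₚ.<⇒≤ p)) , ≢-sym (ℕₚ.<⇒≢ p) , ≢-sym (ℕₚ.<⇒≢ (ℕₚ.<⇒≤ (ℕₚ.<⇒≤ p)))
        below : ∀ {k} → k ≤ i → Away k
        below p = ℕₚ.≤-trans p i≤ , ℕₚ.<⇒≢ (s≤s (ℕₚ.m≤n⇒m≤1+n p)) , ℕₚ.<⇒≢ (s≤s (ℕₚ.m≤n⇒m≤1+n (ℕₚ.m≤n⇒m≤1+n p))) , ℕₚ.<⇒≢ (s≤s p)

      OnCycle : Vertex → Set
      OnCycle z = ∃[ k ] k ≤ suc (suc n) × z ≡ c k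

      inner-onCycle : ∀ j → OnCycle (y j)
      inner-onCycle j = suc (toℕ j) , s≤s (ℕₚ.m≤n⇒m≤1+n (toℕ≤ j)) , refl

      -- An ear from W to yⱼ extends along the path to ears ending at a and at b.
      old-onCycle : ∀ {z j x′ y′} → z ∈ W → Outside W′ x′ → Outside W′ y′ → Adjacent z x′ → Adjacent (y j) y′ →
                    Reach (Outside W′) x′ y′ → OnCycle z
      old-onCycle {z} {j} {x′} z∈ x′-out y′-out z~x′ yj~y′ r
        with inv z∈ a∈W (shrink x′-out) (c-out z≤n) z~x′ (c-adj (s≤s z≤n)) (to-yj ◅◅ reach-sym (segment (s≤s z≤n) j≤ (λ p q → on p (ℕₚ.≤-trans q (s≤s (toℕ≤ j))))))
           | inv z∈ b∈W (shrink x′-out) (c-out ℕₚ.≤-refl) z~x′ (subst (λ v → Adjacent v (c (suc n))) c-end (adj-sym (c-adj ℕₚ.≤-refl)))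
                 (to-yj ◅◅ segment (s≤s (toℕ≤ j)) (ℕₚ.n≤1+n _) (λ p q → on (ℕₚ.≤-trans (s≤s z≤n) p) q))
        where
        j≤ : suc (toℕ j) ≤ suc (suc n)
        j≤ = s≤s (ℕₚ.m≤n⇒m≤1+n (toℕ≤ j))
        on : ∀ {k} → 1 ≤ k → k ≤ suc n → Outside W (c k)
        on (s≤s _) (s≤s k≤) = c-out k≤
        to-yj : Reach (Outside W) x′ (y j)
        to-yj = reach-map shrink r ◅◅ ((adj-sym yj~y′ , shrink y′-out , c-out (toℕ≤ j)) ◅ ε)
      ... | inj₁ refl | _         = 0 , z≤n , refl
      ... | inj₂ _    | inj₁ refl = suc (suc n) , ℕₚ.≤-refl , sym c-end
      ... | inj₂ z~a  | inj₂ z~b  = ⊥-elim (triangle-free _ _ _ (z~a , a~b , z~b))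

      consecutive : ∀ {i j x′ y′} → i < j → j ≤ suc (suc n) → Outside W′ x′ → Outside W′ y′ →
                    Adjacent (c i) x′ → Adjacent (c j) y′ → Reach (Outside W′) x′ y′ → Adjacent (c i) (c j)
      consecutive {i} {j} i<j j≤ x′-out y′-out i~x′ j~y′ r with j ℕₚ.≟ suc i
      ... | yes refl = c-adj j≤
      ... | no j≢ with i ℕₚ.≟ 0 | j ℕₚ.≟ suc (suc n)
      ...   | yes refl | yes refl = closing
      ...   | no i≢0   | _        = ⊥-elim (noCrossEar i<j j≤ j≢ (λ (p , _) → i≢0 p) x′-out y′-out i~x′ j~y′ r)
      ...   | yes _    | no j≢n   = ⊥-elim (noCrossEar i<j j≤ j≢ (λ (_ , p) → j≢n p) x′-out y′-out i~x′ j~y′ r)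

      cycle-inv : ∀ {a′ b′ x′ y′} → OnCycle a′ → OnCycle b′ → Outside W′ x′ → Outside W′ y′ → Adjacent a′ x′ → Adjacent b′ y′ →
                  Reach (Outside W′) x′ y′ → a′ ≡ b′ ⊎ Adjacent a′ b′
      cycle-inv (i , i≤ , refl) (j , j≤ , refl) x′-out y′-out i~x′ j~y′ r with ℕₚ.<-cmp i j
      ... | tri≈ _ refl _ = inj₁ refl
      ... | tri< i<j _ _  = inj₂ (consecutive i<j j≤ x′-out y′-out i~x′ j~y′ r)
      ... | tri> _ _ j<i  = inj₂ (adj-sym (consecutive j<i i≤ y′-out x′-out j~y′ i~x′ (reach-sym r)))

      inv′ : EarInvariant W′
      inv′ a∈ b∈ x′-out y′-out a~x′ b~y′ r with proj₁ members a∈ | proj₁ members b∈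
      ... | inj₁ a∈W        | inj₁ b∈W        = inv a∈W b∈W (shrink x′-out) (shrink y′-out) a~x′ b~y′ (reach-map shrink r)
      ... | inj₁ a∈W        | inj₂ (j , refl) =
        cycle-inv (old-onCycle {j = j} a∈W x′-out y′-out a~x′ b~y′ r) (inner-onCycle j) x′-out y′-out a~x′ b~y′ r
      ... | inj₂ (i , refl) | inj₁ b∈W        =
        cycle-inv (inner-onCycle i) (old-onCycle {j = i} b∈W y′-out x′-out b~y′ a~x′ (reach-sym r)) x′-out y′-out a~x′ b~y′ r
      ... | inj₂ (i , refl) | inj₂ (j , refl) = cycle-inv (inner-onCycle i) (inner-onCycle j) x′-out y′-out a~x′ b~y′ r

    case-adj : ∀ {a b : Vertex} → a ≢ b → a ≡ b ⊎ Adjacent a b → (Adjacent a b → ⊥) → ⊥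
    case-adj a≢b (inj₁ eq)  k = a≢b eq
    case-adj a≢b (inj₂ adj) k = k adj

    -- Whether there is a proper ear, and how long a shortest one is, is not decided, whence the
    -- double negation. An ear with a single inner vertex would form a triangle with the edge
    -- between its ends.
    extend : ∀ {W w z} → W ⊆ U → EarInvariant W → ConnectedSet U → w ∈ W → z ∈ U → z ∉ W → ¬ ¬ Extension W
    extend {W} W⊆U inv conn w∈ z∈U z∉W none = ¬¬-excluded-middle λ where
      (no noEar) → none (addPendant W⊆U inv (λ {n} e → noEar (n , e)) (crossing w∈ z∉W (conn (W⊆U w∈) z∈U)))
      (yes (n , e)) → least (ProperEar W) {n} e λ where
        (zero , (a , b , x , .x , a≢b , a∈ , b∈ , a~x , b~x , single p) , _) →
          case-adj a≢b (inv a∈ b∈ p p a~x b~x ε) λ a~b → triangle-free _ _ _ (a~x , adj-sym b~x , a~b)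
        (suc m , (a , b , x , y , a≢b , a∈ , b∈ , a~x , b~y , ρ) , shortest) →
          case-adj a≢b (inv a∈ b∈ (subst (Outside W) (vtx-zero ρ) (vtx-P ρ 0)) (subst (Outside W) (vtx-last ρ) (vtx-P ρ (suc m)))
                         a~x b~y (path⇒reach ρ)) λ a~b →
          let open AddEar W⊆U inv a≢b a∈ b∈ a~b a~x b~y ρ shortest in
          none (W′ , W′⊆U , inv′ , inj₂ newEar)

    built : ∀ {B w} → ConnectedSet U → w ∈ B → B ⊆ U → EarInvariant B → ¬ ¬ Built B U
    built {B} conn w∈ B⊆U inv = grow ∣ U ∣ (ℕₚ.m≤m+n ∣ U ∣ ∣ B ∣) base w∈ B⊆U inv
      where
      -- The number `k` bounds how many vertices of `U` are still missing.
      grow : ∀ k {W w} → ∣ U ∣ ≤ k ℕ.+ ∣ W ∣ → Built B W → w ∈ W → W ⊆ U → EarInvariant W → ¬ ¬ Built B U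
      grow k {W} U≤ b w∈ W⊆U inv none with any? (λ z → (z ∈? U) ×-dec ¬? (z ∈? W))
      ... | no complete = none (subst (Built B) (⊆-antisym W⊆U
              (λ {z} z∈U → decidable-stable (z ∈? W) λ z∉ → complete (z , z∈U , z∉))) b)
      grow zero U≤ b w∈ W⊆U inv none | yes (z , z∈U , z∉W) =
        ℕₚ.<⇒≱ (p⊂q⇒∣p∣<∣q∣ (W⊆U , z , z∈U , z∉W)) U≤
      grow (suc k) {W} U≤ b w∈ W⊆U inv none | yes (z , z∈U , z∉W) =
        extend W⊆U inv conn w∈ z∈U z∉W λ where
          (W′ , W′⊆U , inv′ , inj₁ P) → grow k (smaller (pendant⊂ P)) (pendant b P) (proj₂ (Pendant.members P) (inj₁ w∈)) W′⊆U inv′ none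
          (W′ , W′⊆U , inv′ , inj₂ E) → grow k (smaller (ear⊂ E)) (ear b E) (proj₂ (Ear.members E) (inj₁ w∈)) W′⊆U inv′ none
        where
        smaller : ∀ {s} → ∣ W ∣ < s → ∣ U ∣ ≤ k ℕ.+ s
        smaller lt = ℕₚ.≤-trans U≤ (ℕₚ.≤-trans (ℕₚ.≤-reflexive (sym (ℕₚ.+-suc k ∣ W ∣))) (ℕₚ.+-monoʳ-≤ k lt))

-- Edge colourings around a vertex set, and maps from colour classes to three colours

module Colouring (G : CubicGraph) where
  open GraphKit G
  open Structure G

  EdgeColouring : Set
  EdgeColouring = Edge → Colour

  Inc : VSet → Edge → Set
  Inc W e = ∃[ v ] v ∈ W × v ∼ e

  Proper : VSet → EdgeColouring → Set
  Proper W γ = ∀ {v a b} → v ∈ W → v ∼ a → v ∼ b → a ≢ b → γ a ≢ γ b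

  -- Classes are compared near `W` only, so the values of a colouring elsewhere are irrelevant and
  -- total functions can serve as colourings.
  Share : VSet → EdgeColouring → Colour → EdgeColouring → Colour → Set
  Share W γ i γ′ j = ∀ {e} → Inc W e → γ e ≡ i ⇆ γ′ e ≡ j

  Agree : VSet → EdgeColouring → EdgeColouring → Set
  Agree W γ γ′ = ∀ {e} → Inc W e → γ e ≡ γ′ e

  agree⇒share : ∀ {W γ γ′} i → Agree W γ γ′ → Share W γ i γ′ i
  agree⇒share i agree e∈ = trans (sym (agree e∈)) , trans (agree e∈)

  share-refl : ∀ {W γ i} → Share W γ i γ i
  share-refl _ = id , id

  share-sym : ∀ {W γ i γ′ j} → Share W γ i γ′ j → Share W γ′ j γ i
  share-sym s e∈ = proj₂ (s e∈) , proj₁ (s e∈)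

  share-trans : ∀ {W γ i γ′ j γ″ k} → Share W γ i γ′ j → Share W γ′ j γ″ k → Share W γ i γ″ k
  share-trans s t e∈ = proj₁ (t e∈) ∘ proj₁ (s e∈) , proj₂ (s e∈) ∘ proj₂ (t e∈)

  share-relabel : ∀ {W γ i} {π : Colour → Colour} → Injective₃ π → Share W γ i (π ∘ γ) (π i)
  share-relabel {π = π} π-inj _ = cong π , π-inj

  proper-relabel : ∀ {W γ} {π : Colour → Colour} → Injective₃ π → Proper W γ → Proper W (π ∘ γ)
  proper-relabel π-inj proper v∈ v∼a v∼b a≢b eq = proper v∈ v∼a v∼b a≢b (π-inj eq)

  abstract
    hits : ∀ {W γ v} → Proper W γ → v ∈ W → ∀ i → ∃[ e ] v ∼ e × γ e ≡ i
    hits {γ = γ} {v} proper v∈ i with a , b , c , K ← claw v with i ≟ᶜ γ a | i ≟ᶜ γ b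
    ... | yes eq | _      = a , Claw.v∼a K , sym eq
    ... | no _   | yes eq = b , Claw.v∼b K , sym eq
    ... | no i≢a | no i≢b = c , Claw.v∼c K , sym (remaining-colour (γ a) (γ b) (γ c) i
      (proper v∈ (Claw.v∼a K) (Claw.v∼b K) (Claw.a≢b K)) (proper v∈ (Claw.v∼a K) (Claw.v∼c K) (Claw.a≢c K))
      (proper v∈ (Claw.v∼b K) (Claw.v∼c K) (Claw.b≢c K)) i≢a i≢b)

  claw-proper : ∀ {v a b c} {γ : EdgeColouring} → Claw v a b c → γ a ≢ γ b → γ a ≢ γ c → γ b ≢ γ c →
                ∀ {e f} → v ∼ e → v ∼ f → e ≢ f → γ e ≢ γ f
  claw-proper K ab ac bc v∼e v∼f e≢f with Claw.only K v∼e | Claw.only K v∼f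
  ... | inj₁ refl        | inj₁ refl        = ⊥-elim (e≢f refl)
  ... | inj₁ refl        | inj₂ (inj₁ refl) = ab
  ... | inj₁ refl        | inj₂ (inj₂ refl) = ac
  ... | inj₂ (inj₁ refl) | inj₁ refl        = ≢-sym ab
  ... | inj₂ (inj₁ refl) | inj₂ (inj₁ refl) = ⊥-elim (e≢f refl)
  ... | inj₂ (inj₁ refl) | inj₂ (inj₂ refl) = bc
  ... | inj₂ (inj₂ refl) | inj₁ refl        = ≢-sym ac
  ... | inj₂ (inj₂ refl) | inj₂ (inj₁ refl) = ≢-sym bc
  ... | inj₂ (inj₂ refl) | inj₂ (inj₂ refl) = ⊥-elim (e≢f refl)

  -- A 3-colouring of the complex belonging to `W`, written as a function of a colouring and a
  -- colour: by `shared` it depends only on the class that they determine, and by `injective`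
  -- adjacent classes get different values.
  record ClassColouring (W : VSet) : Set where
    field
      value     : EdgeColouring → Colour → Colour
      injective : ∀ {γ} → Proper W γ → Injective₃ (value γ)
      shared    : ∀ {γ γ′ i j} → Proper W γ → Proper W γ′ → Share W γ i γ′ j → value γ i ≡ value γ′ j

    Constant : Edge → Set
    Constant e = ∀ {γ γ′} → Proper W γ → Proper W γ′ → value γ (γ e) ≡ value γ′ (γ′ e)

    GivenBy : Vertex → Set
    GivenBy y = y ∈ W × (∀ {e} → y ∼ e → Constant e)

  open ClassColouring

  Represented : VSet → Set
  Represented W = (c : ClassColouring W) → ¬ ¬ (∃[ y ] GivenBy c y)

  Separated : VSet → Set
  Separated W = ∀ {e f} → Inc W e → Inc W f → e ≢ f → ¬ ¬ (∃[ γ ] Proper W γ × γ e ≢ γ f)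

  Colourable : VSet → Set
  Colourable W = ∃[ γ ] Proper W γ

  -- Any two colourings in which `f` and `g` have equal colours are joined by a sequence of such
  -- colourings, each sharing a class with the next one. The closure is encoded by the predicates
  -- invariant under single steps.
  WeaklyConnected : VSet → Edge → Edge → Set₁
  WeaklyConnected W f g = (V : EdgeColouring → Set) →
    (∀ {γ γ′ i j} → Proper W γ → Proper W γ′ → γ f ≡ γ g → γ′ f ≡ γ′ g → Share W γ i γ′ j → V γ → V γ′) →
    ∀ {γ γ′} → Proper W γ → Proper W γ′ → γ f ≡ γ g → γ′ f ≡ γ′ g → V γ → V γ′

  exchange : ∀ {f g} → Injective₃ f → Injective₃ g → ∀ {a b c} → a ≢ b → a ≢ c → b ≢ c →
             f a ≡ g a → f b ≢ g b → f c ≡ g b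
  exchange {f} {g} f-inj g-inj {a} {b} {c} a≢b a≢c b≢c fa fb =
    remaining-colour (f a) (f b) (g b) (f c) (≢⇒≢ f-inj a≢b) (λ eq → ≢⇒≢ g-inj a≢b (trans (sym fa) eq)) fb
      (≢⇒≢ f-inj (≢-sym a≢c)) (≢⇒≢ f-inj (≢-sym b≢c))

  two-constant : ∀ {W y a b e} (c : ClassColouring W) → y ∈ W → Claw y a b e → Constant c a → Constant c b →
                 ∀ {f} → y ∼ f → Constant c f
  two-constant {a = a} {b} {e} c y∈ K const-a const-b {f} y∼f {γ} {γ′} proper proper′ with Claw.only K y∼f
  ... | inj₁ refl        = const-a proper proper′
  ... | inj₂ (inj₁ refl) = const-b proper proper′
  ... | inj₂ (inj₂ refl) = remaining-colour (val′ a) (val′ b) (val′ e) (value c γ (γ e))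
    (≢⇒≢ (injective c proper′) (ab proper′)) (≢⇒≢ (injective c proper′) (ae proper′)) (≢⇒≢ (injective c proper′) (be proper′))
    (λ eq → ≢⇒≢ (injective c proper) (≢-sym (ae proper)) (trans eq (sym (const-a proper proper′))))
    (λ eq → ≢⇒≢ (injective c proper) (≢-sym (be proper)) (trans eq (sym (const-b proper proper′))))
    where
    val′ : Edge → Colour
    val′ g = value c γ′ (γ′ g)
    ab : ∀ {δ} → Proper _ δ → δ a ≢ δ b
    ab p = p y∈ (Claw.v∼a K) (Claw.v∼b K) (Claw.a≢b K)
    ae : ∀ {δ} → Proper _ δ → δ a ≢ δ e
    ae p = p y∈ (Claw.v∼a K) (Claw.v∼c K) (Claw.a≢c K)
    be : ∀ {δ} → Proper _ δ → δ b ≢ δ e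
    be p = p y∈ (Claw.v∼b K) (Claw.v∼c K) (Claw.b≢c K)

  -- Otherwise the colouring of classes by the position of h among the edges at w, with the two others
  -- exchanged according to D, would not be given by a vertex.
  module _ {W : VSet} (rep : Represented W) (sep : Separated W) {w h} (w∈W : w ∈ W) (w∼h : w ∼ h)
           (h-only : ∀ {z} → z ∈ W → z ∼ h → z ≡ w) (D : EdgeColouring → Bool)
           (closed : ∀ {γ γ′ i j} → Proper W γ → Proper W γ′ → Share W γ i γ′ j → i ≢ γ h → D γ ≡ D γ′) where
    private
      r s : Edge
      r = proj₁ (clawFrom w∼h)
      s = proj₁ (proj₂ (clawFrom w∼h))
      K : Claw w h r s
      K = proj₂ (proj₂ (clawFrom w∼h))
      Inc-h : Inc W h
      Inc-h = w , w∈W , w∼h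
      Inc-r : Inc W r
      Inc-r = w , w∈W , Claw.v∼b K

      pick : Bool → Colour
      pick true  = 1F
      pick false = 2F

      pick-inj : ∀ {a b} → pick a ≡ pick b → a ≡ b
      pick-inj {true}  {true}  _ = refl
      pick-inj {false} {false} _ = refl

      pick≢0 : ∀ {a} → pick a ≢ 0F
      pick≢0 {true} ()
      pick≢0 {false} ()

      slot : ∀ {P Q : Set} → Dec P → Dec Q → Bool → Colour
      slot (yes _) _       d = 0F
      slot (no _)  (yes _) d = pick d
      slot (no _)  (no _)  d = pick (not d)

      not≢ : ∀ d → d ≢ not d
      not≢ true ()
      not≢ false ()

      val : EdgeColouring → Colour → Colour
      val γ i = slot (i ≟ᶜ γ h) (i ≟ᶜ γ r) (D γ)

      val-inj : ∀ {γ} → Proper W γ → Injective₃ (val γ)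
      val-inj {γ} proper {i} {j} eq with i ≟ᶜ γ h | i ≟ᶜ γ r | j ≟ᶜ γ h | j ≟ᶜ γ r
      ... | yes p | _     | yes q | _     = trans p (sym q)
      ... | yes _ | _     | no _  | yes _ = ⊥-elim (pick≢0 (sym eq))
      ... | yes _ | _     | no _  | no _  = ⊥-elim (pick≢0 (sym eq))
      ... | no _  | yes _ | yes _ | _     = ⊥-elim (pick≢0 eq)
      ... | no _  | no _  | yes _ | _     = ⊥-elim (pick≢0 eq)
      ... | no _  | yes p | no _  | yes q = trans p (sym q)
      ... | no _  | yes _ | no _  | no _  = ⊥-elim (not≢ (D γ) (pick-inj eq))
      ... | no _  | no _  | no _  | yes _ = ⊥-elim (not≢ (D γ) (sym (pick-inj eq)))
      ... | no p  | no p′ | no q  | no q′ = trans (to-s p p′) (sym (to-s q q′))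
        where
        to-s : ∀ {i} → i ≢ γ h → i ≢ γ r → i ≡ γ s
        to-s {i} = remaining-colour (γ h) (γ r) (γ s) i (proper w∈W w∼h (Claw.v∼b K) (Claw.a≢b K))
          (proper w∈W w∼h (Claw.v∼c K) (Claw.a≢c K)) (proper w∈W (Claw.v∼b K) (Claw.v∼c K) (Claw.b≢c K))

      val-shared : ∀ {γ γ′ i j} → Proper W γ → Proper W γ′ → Share W γ i γ′ j → val γ i ≡ val γ′ j
      val-shared {γ} {γ′} {i} {j} proper proper′ share with i ≟ᶜ γ h | j ≟ᶜ γ′ h | i ≟ᶜ γ r | j ≟ᶜ γ′ r
      ... | yes _ | yes _ | _     | _     = refl
      ... | yes p | no q  | _     | _     = ⊥-elim (q (sym (proj₁ (share Inc-h) (sym p))))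
      ... | no p  | yes q | _     | _     = ⊥-elim (p (sym (proj₂ (share Inc-h) (sym q))))
      ... | no p  | no _  | yes _ | yes _ = cong pick (closed proper proper′ share p)
      ... | no p  | no _  | no _  | no _  = cong (pick ∘ not) (closed proper proper′ share p)
      ... | no _  | no _  | yes p | no q  = ⊥-elim (q (sym (proj₁ (share Inc-r) (sym p))))
      ... | no _  | no _  | no p  | yes q = ⊥-elim (p (sym (proj₂ (share Inc-r) (sym q))))

      val-h : ∀ γ → val γ (γ h) ≡ 0F
      val-h γ with γ h ≟ᶜ γ h
      ... | yes _ = refl
      ... | no ¬p = ⊥-elim (¬p refl)

      val-r : ∀ {γ} → Proper W γ → val γ (γ r) ≡ pick (D γ)
      val-r {γ} proper with γ r ≟ᶜ γ h | γ r ≟ᶜ γ r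
      ... | yes p | _     = ⊥-elim (proper w∈W w∼h (Claw.v∼b K) (Claw.a≢b K) (sym p))
      ... | no _  | yes _ = refl
      ... | no _  | no ¬p = ⊥-elim (¬p refl)

    halfEdge-invariant : ∀ {γ γ′} → Proper W γ → Proper W γ′ → D γ ≡ D γ′
    halfEdge-invariant {γ} {γ′} proper proper′ = decidable-stable (D γ ≟ᵇ D γ′) λ neq →
      rep (record { value = val ; injective = val-inj ; shared = val-shared }) λ (y , y∈ , const) →
        -- The edge `z` at `y` in the class of `h` has the value 0, which marks this class in every
        -- colouring, so `z` and `h` always have equal colours. By separation they coincide, whence
        -- `y` is `w`; there the value of `r` reveals `D`.
        let (z , y∼z , γz) = hits proper y∈ (γ h)
            z-follows : ∀ {δ} → Proper W δ → δ z ≡ δ h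
            z-follows {δ} δ-proper = val-inj δ-proper (trans (const y∼z δ-proper proper)
              (trans (cong (val γ) γz) (trans (val-h γ) (sym (val-h δ)))))
            y≡w : y ≡ w
            y≡w = decidable-stable (y ≟ w) λ y≢w → sep (y , y∈ , y∼z) Inc-h
                    (λ z≡h → y≢w (h-only y∈ (subst (y ∼_) z≡h y∼z)))
                    λ (δ , δ-proper , δz≢δh) → δz≢δh (z-follows δ-proper)
        in neq (pick-inj (trans (sym (val-r proper))
             (trans (const (subst (_∼ r) (sym y≡w) (Claw.v∼b K)) proper proper′) (val-r proper′))))

-- Attaching a pendant vertex

module PendantStep (G : CubicGraph) {W W′ : Subset (CubicGraph.#vertices G)} (P : Structure.Pendant G W W′) where
  open GraphKit G
  open Structure G
  open Colouring G
  open ClassColouring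
  open Pendant P

  private
    r s : Edge
    r = proj₁ (clawFrom w∼h)
    s = proj₁ (proj₂ (clawFrom w∼h))
    K : Claw w h r s
    K = proj₂ (proj₂ (clawFrom w∼h))
    Inc-h : Inc W h
    Inc-h = w , w∈W , w∼h
    Inc-r : Inc W r
    Inc-r = w , w∈W , Claw.v∼b K
    Inc-s : Inc W s
    Inc-s = w , w∈W , Claw.v∼c K
    p≢q : p ≢ q
    p≢q = Claw.b≢c claw-x

  W⊆W′ : ∀ {z} → z ∈ W → z ∈ W′
  W⊆W′ z∈ = proj₂ members (inj₁ z∈)

  x∈W′ : x ∈ W′
  x∈W′ = proj₂ members (inj₂ refl)

  Inc-split : ∀ {e} → Inc W′ e → Inc W e ⊎ e ≡ p ⊎ e ≡ q
  Inc-split (v , v∈ , v∼e) with proj₁ members v∈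
  ... | inj₁ v∈W  = inj₁ (v , v∈W , v∼e)
  ... | inj₂ refl with Claw.only claw-x v∼e
  ...   | inj₁ refl = inj₁ Inc-h
  ...   | inj₂ e≡   = inj₂ e≡

  proper-shrink : ∀ {γ} → Proper W′ γ → Proper W γ
  proper-shrink proper v∈ = proper (W⊆W′ v∈)

  abstract
    extend : EdgeColouring → Colour → Colour → EdgeColouring
    extend γ b c e with e ≟ p | e ≟ q
    ... | yes _ | _     = b
    ... | no _  | yes _ = c
    ... | no _  | no _  = γ e

    extend-p : ∀ γ b c → extend γ b c p ≡ b
    extend-p γ b c with p ≟ p | p ≟ q
    ... | yes _ | _ = refl
    ... | no ¬p | _ = ⊥-elim (¬p refl)

    extend-q : ∀ γ b c → extend γ b c q ≡ c
    extend-q γ b c with q ≟ p | q ≟ q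
    ... | yes eq | _     = ⊥-elim (p≢q (sym eq))
    ... | no _   | yes _ = refl
    ... | no _   | no ¬p = ⊥-elim (¬p refl)

    extend-old : ∀ γ b c {e} → Inc W e → extend γ b c e ≡ γ e
    extend-old γ b c {e} (v , v∈ , v∼e) with e ≟ p | e ≟ q
    ... | yes refl | _        = ⊥-elim (p-new v∈ v∼e)
    ... | no _     | yes refl = ⊥-elim (q-new v∈ v∼e)
    ... | no _     | no _     = refl

  extend-proper : ∀ {γ b c} → Proper W γ → γ h ≢ b → γ h ≢ c → b ≢ c → Proper W′ (extend γ b c)
  extend-proper {γ} {b} {c} proper h≢b h≢c b≢c v∈ v∼e v∼f e≢f with proj₁ members v∈
  ... | inj₁ v∈W  = subst₂ _≢_ (sym (extend-old γ b c (_ , v∈W , v∼e))) (sym (extend-old γ b c (_ , v∈W , v∼f)))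
                      (proper v∈W v∼e v∼f e≢f)
  ... | inj₂ refl = claw-proper claw-x
    (subst₂ _≢_ (sym (extend-old γ b c Inc-h)) (sym (extend-p γ b c)) h≢b)
    (subst₂ _≢_ (sym (extend-old γ b c Inc-h)) (sym (extend-q γ b c)) h≢c)
    (subst₂ _≢_ (sym (extend-p γ b c)) (sym (extend-q γ b c)) b≢c) v∼e v∼f e≢f

  -- Both extensions of γ fold the claw at x onto that at w.
  _⁺ _⁻ : EdgeColouring → EdgeColouring
  γ ⁺ = extend γ (γ r) (γ s)
  γ ⁻ = extend γ (γ s) (γ r)

  module _ {γ : EdgeColouring} (proper : Proper W γ) where
    h≢r : γ h ≢ γ r
    h≢r = proper w∈W w∼h (Claw.v∼b K) (Claw.a≢b K)
    h≢s : γ h ≢ γ s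
    h≢s = proper w∈W w∼h (Claw.v∼c K) (Claw.a≢c K)
    r≢s : γ r ≢ γ s
    r≢s = proper w∈W (Claw.v∼b K) (Claw.v∼c K) (Claw.b≢c K)
    ⁺-proper : Proper W′ (γ ⁺)
    ⁺-proper = extend-proper proper h≢r h≢s r≢s
    ⁻-proper : Proper W′ (γ ⁻)
    ⁻-proper = extend-proper proper h≢s h≢r (≢-sym r≢s)

  fold-share : ∀ {γ i γ′ j δ δ′} → Share W γ i γ′ j → (∀ {e} → Inc W′ e → ∃[ f ] Inc W f × δ e ≡ γ f × δ′ e ≡ γ′ f) →
               Share W′ δ i δ′ j
  fold-share share fold e∈ with f , f∈ , δe , δ′e ← fold e∈ =
    (λ eq → trans δ′e (proj₁ (share f∈) (trans (sym δe) eq))) , (λ eq → trans δe (proj₂ (share f∈) (trans (sym δ′e) eq)))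

  ⁺-share : ∀ {γ i γ′ j} → Share W γ i γ′ j → Share W′ (γ ⁺) i (γ′ ⁺) j
  ⁺-share {γ} {γ′ = γ′} share = fold-share {γ} {γ′ = γ′} share λ e∈ → case (Inc-split e∈)
    where
    case : ∀ {e} → Inc W e ⊎ e ≡ p ⊎ e ≡ q → ∃[ f ] Inc W f × (γ ⁺) e ≡ γ f × (γ′ ⁺) e ≡ γ′ f
    case (inj₁ e∈)          = _ , e∈ , extend-old γ _ _ e∈ , extend-old γ′ _ _ e∈
    case (inj₂ (inj₁ refl)) = r , Inc-r , extend-p γ _ _ , extend-p γ′ _ _
    case (inj₂ (inj₂ refl)) = s , Inc-s , extend-q γ _ _ , extend-q γ′ _ _

  ⁻-share : ∀ {γ i γ′ j} → Share W γ i γ′ j → Share W′ (γ ⁻) i (γ′ ⁻) j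
  ⁻-share {γ} {γ′ = γ′} share = fold-share {γ} {γ′ = γ′} share λ e∈ → case (Inc-split e∈)
    where
    case : ∀ {e} → Inc W e ⊎ e ≡ p ⊎ e ≡ q → ∃[ f ] Inc W f × (γ ⁻) e ≡ γ f × (γ′ ⁻) e ≡ γ′ f
    case (inj₁ e∈)          = _ , e∈ , extend-old γ _ _ e∈ , extend-old γ′ _ _ e∈
    case (inj₂ (inj₁ refl)) = s , Inc-s , extend-p γ _ _ , extend-p γ′ _ _
    case (inj₂ (inj₂ refl)) = r , Inc-r , extend-q γ _ _ , extend-q γ′ _ _

  off-share : ∀ γ {b c b′ c′} → b ≢ γ h → c ≢ γ h → b′ ≢ γ h → c′ ≢ γ h →
              Share W′ (extend γ b c) (γ h) (extend γ b′ c′) (γ h)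
  off-share γ {b} {c} {b′} {c′} b≢ c≢ b′≢ c′≢ e∈ with Inc-split e∈
  ... | inj₁ e∈W         = trans (extend-old γ b′ c′ e∈W) ∘ trans (sym (extend-old γ b c e∈W)) ,
                           trans (extend-old γ b c e∈W) ∘ trans (sym (extend-old γ b′ c′ e∈W))
  ... | inj₂ (inj₁ refl) = off (λ eq → b≢ (trans (sym (extend-p γ b c)) eq)) (λ eq → b′≢ (trans (sym (extend-p γ b′ c′)) eq))
  ... | inj₂ (inj₂ refl) = off (λ eq → c≢ (trans (sym (extend-q γ b c)) eq)) (λ eq → c′≢ (trans (sym (extend-q γ b′ c′)) eq))

  data Shape (γ : EdgeColouring) : Set where
    is-⁺ : γ p ≡ γ r → γ q ≡ γ s → Agree W′ γ (γ ⁺) → Shape γ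
    is-⁻ : γ p ≡ γ s → γ q ≡ γ r → Agree W′ γ (γ ⁻) → Shape γ

  -- The edge `h` belongs to both claws, so `p` and `q` carry the colours of `r` and `s` in one of
  -- the two orders.
  shape : ∀ {γ} → Proper W′ γ → Shape γ
  shape {γ} proper = case (γ p ≟ᶜ γ r)
    where
    old : Proper W γ
    old = proper-shrink proper
    h≢p : γ h ≢ γ p
    h≢p = proper x∈W′ (Claw.v∼a claw-x) (Claw.v∼b claw-x) (Claw.a≢b claw-x)
    h≢q : γ h ≢ γ q
    h≢q = proper x∈W′ (Claw.v∼a claw-x) (Claw.v∼c claw-x) (Claw.a≢c claw-x)
    γp≢γq : γ p ≢ γ q
    γp≢γq = proper x∈W′ (Claw.v∼b claw-x) (Claw.v∼c claw-x) (Claw.b≢c claw-x)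
    agree : ∀ {b c} → γ p ≡ b → γ q ≡ c → Agree W′ γ (extend γ b c)
    agree {b} {c} pb qc e∈ with Inc-split e∈
    ... | inj₁ e∈W         = sym (extend-old γ b c e∈W)
    ... | inj₂ (inj₁ refl) = trans pb (sym (extend-p γ b c))
    ... | inj₂ (inj₂ refl) = trans qc (sym (extend-q γ b c))
    case : Dec (γ p ≡ γ r) → Shape γ
    case (yes pr) = is-⁺ pr qs (agree pr qs)
      where
      qs : γ q ≡ γ s
      qs = remaining-colour (γ h) (γ r) (γ s) (γ q) (h≢r old) (h≢s old) (r≢s old) (≢-sym h≢q) (λ eq → γp≢γq (trans pr (sym eq)))
    case (no ¬pr) = is-⁻ ps qr (agree ps qr)
      where
      ps : γ p ≡ γ s
      ps = remaining-colour (γ h) (γ r) (γ s) (γ p) (h≢r old) (h≢s old) (r≢s old) (≢-sym h≢p) ¬pr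
      qr : γ q ≡ γ r
      qr = remaining-colour (γ h) (γ s) (γ r) (γ q) (h≢s old) (h≢r old) (≢-sym (r≢s old)) (≢-sym h≢q) (λ eq → γp≢γq (trans ps (sym eq)))

  colourable : Colourable W → Colourable W′
  colourable (γ , proper) = γ ⁺ , ⁺-proper proper

  -- The colourings `γ ⁺` and `γ ⁻` agree at `e` and differ at `f`, so one of them separates these
  -- edges.
  separate-new : Colourable W → ∀ {e f} → Inc W e → f ≡ p ⊎ f ≡ q → ∃[ γ ] Proper W′ γ × γ e ≢ γ f
  separate-new (γ , proper) {e} {f} e∈ f≡ = decide ((γ ⁺) e ≟ᶜ (γ ⁺) f)
    where
    differs : f ≡ p ⊎ f ≡ q → (γ ⁺) f ≢ (γ ⁻) f
    differs (inj₁ refl) = subst₂ _≢_ (sym (extend-p γ _ _)) (sym (extend-p γ _ _)) (r≢s proper)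
    differs (inj₂ refl) = subst₂ _≢_ (sym (extend-q γ _ _)) (sym (extend-q γ _ _)) (≢-sym (r≢s proper))
    decide : Dec ((γ ⁺) e ≡ (γ ⁺) f) → ∃[ γ ] Proper W′ γ × γ e ≢ γ f
    decide (no neq) = γ ⁺ , ⁺-proper proper , neq
    decide (yes eq) = γ ⁻ , ⁻-proper proper , λ eq′ → differs f≡
      (trans (sym eq) (trans (extend-old γ _ _ e∈) (trans (sym (extend-old γ _ _ e∈)) eq′)))

  separated : Colourable W → Separated W → ∀ {e f} → Inc W e → Inc W′ f → e ≢ f → ¬ ¬ (∃[ γ ] Proper W′ γ × γ e ≢ γ f)
  separated col sep {e} {f} e∈ f∈ e≢f none with Inc-split f∈
  ... | inj₂ f≡  = none (separate-new col e∈ f≡)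
  ... | inj₁ f∈W = sep e∈ f∈W e≢f λ (γ , proper , neq) → none (γ ⁺ , ⁺-proper proper ,
        subst₂ _≢_ (sym (extend-old γ _ _ e∈)) (sym (extend-old γ _ _ f∈W)) neq)

  module _ (rep : Represented W) (sep : Separated W) (c : ClassColouring W′) where
    private
      c⁺ : ClassColouring W
      c⁺ = record
        { value = λ γ → value c (γ ⁺) ; injective = λ proper → injective c (⁺-proper proper)
        ; shared = λ {γ} {γ′} proper proper′ share → shared c (⁺-proper proper) (⁺-proper proper′) (⁺-share {γ} {γ′ = γ′} share) }

      α β : EdgeColouring → Colour
      α γ = value c (γ ⁺) (γ r)
      β γ = value c (γ ⁻) (γ r)

      at-h : ∀ {γ} → Proper W γ → value c (γ ⁺) (γ h) ≡ value c (γ ⁻) (γ h)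
      at-h {γ} proper = shared c (⁺-proper proper) (⁻-proper proper)
        (off-share γ (≢-sym (h≢r proper)) (≢-sym (h≢s proper)) (≢-sym (h≢s proper)) (≢-sym (h≢r proper)))

      invariant : (D : EdgeColouring → Bool) →
        (∀ {γ γ′ i j} → Proper W γ → Proper W γ′ → Share W γ i γ′ j → i ≢ γ h → D γ ≡ D γ′) →
        ∀ {γ γ′} → Proper W γ → Proper W γ′ → D γ ≡ D γ′
      invariant D closed = halfEdge-invariant rep sep w∈W w∼h h-only D closed

      other-class : ∀ {γ γ′ i j} → Proper W γ → Proper W γ′ → Share W γ i γ′ j → i ≢ γ h →
                    (i ≡ γ r × j ≡ γ′ r) ⊎ (i ≡ γ s × j ≡ γ′ s)
      other-class {γ} {γ′} {i} proper proper′ share i≢h with i ≟ᶜ γ r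
      ... | yes refl = inj₁ (refl , sym (proj₁ (share Inc-r) refl))
      ... | no i≢r with refl ← remaining-colour (γ h) (γ r) (γ s) i (h≢r proper) (h≢s proper) (r≢s proper) i≢h i≢r =
        inj₂ (refl , sym (proj₁ (share Inc-s) refl))

      value⁺ : ∀ {γ γ′ i j} → Proper W γ → Proper W γ′ → Share W γ i γ′ j → value c (γ ⁺) i ≡ value c (γ′ ⁺) j
      value⁺ = shared c⁺

      value⁻ : ∀ {γ γ′ i j} → Proper W γ → Proper W γ′ → Share W γ i γ′ j → value c (γ ⁻) i ≡ value c (γ′ ⁻) j
      value⁻ {γ} {γ′} proper proper′ share = shared c (⁻-proper proper) (⁻-proper proper′) (⁻-share {γ} {γ′ = γ′} share)

      ≟-cong : ∀ {a b a′ b′ : Colour} → a ≡ b ⇆ a′ ≡ b′ → does (a ≟ᶜ b) ≡ does (a′ ≟ᶜ b′)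
      ≟-cong {a} {b} {a′} {b′} (f , g) with a ≟ᶜ b | a′ ≟ᶜ b′
      ... | yes _ | yes _ = refl
      ... | yes p | no q  = ⊥-elim (q (f p))
      ... | no p  | yes q = ⊥-elim (p (g q))
      ... | no _  | no _  = refl

      does-yes : ∀ {a b : Colour} → true ≡ does (a ≟ᶜ b) → a ≡ b
      does-yes {a} {b} eq with a ≟ᶜ b
      ... | yes p = p

      does-no : ∀ {a b : Colour} → false ≡ does (a ≟ᶜ b) → a ≢ b
      does-no {a} {b} eq with a ≟ᶜ b
      ... | no p = p

      -- As `γ ⁺` and `γ ⁻` share the class of `h`, their values either agree or are exchanged at
      -- the classes of `r` and `s`. By `halfEdge-invariant` the same alternative holds for all
      -- colourings.
      straight : EdgeColouring → Bool
      straight γ = does (α γ ≟ᶜ β γ)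

      r⇒s : ∀ {γ} → Proper W γ → α γ ≡ β γ → value c (γ ⁺) (γ s) ≡ value c (γ ⁻) (γ s)
      r⇒s proper eq = agree₃ (injective c (⁺-proper proper)) (injective c (⁻-proper proper)) (h≢r proper) (at-h proper) eq _

      s⇒r : ∀ {γ} → Proper W γ → value c (γ ⁺) (γ s) ≡ value c (γ ⁻) (γ s) → α γ ≡ β γ
      s⇒r proper eq = agree₃ (injective c (⁺-proper proper)) (injective c (⁻-proper proper)) (h≢s proper) (at-h proper) eq _

      straight-closed : ∀ {γ γ′ i j} → Proper W γ → Proper W γ′ → Share W γ i γ′ j → i ≢ γ h → straight γ ≡ straight γ′
      straight-closed {γ} {γ′} proper proper′ share i≢h with other-class proper proper′ share i≢h
      ... | inj₁ (refl , refl) = cong₂ (λ a b → does (a ≟ᶜ b)) (value⁺ proper proper′ share) (value⁻ proper proper′ share)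
      ... | inj₂ (refl , refl) = ≟-cong
        ((λ eq → s⇒r proper′ (trans (sym p⁺) (trans (r⇒s proper eq) p⁻))) ,
         (λ eq → s⇒r proper (trans p⁺ (trans (r⇒s proper′ eq) (sym p⁻)))))
        where
        p⁺ : value c (γ ⁺) (γ s) ≡ value c (γ′ ⁺) (γ′ s)
        p⁺ = value⁺ proper proper′ share
        p⁻ : value c (γ ⁻) (γ s) ≡ value c (γ′ ⁻) (γ′ s)
        p⁻ = value⁻ proper proper′ share

      module Straight {γ₀} (proper₀ : Proper W γ₀) (straight₀ : true ≡ straight γ₀) where
        follows : ∀ {γ} → Proper W′ γ → ∀ i → value c γ i ≡ value c (γ ⁺) i
        follows {γ} proper i = case (shape proper)
          where
          old : Proper W γ
          old = proper-shrink proper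
          case : Shape γ → value c γ i ≡ value c (γ ⁺) i
          case (is-⁺ _ _ agree) = shared c proper (⁺-proper old) (agree⇒share i agree)
          case (is-⁻ _ _ agree) = trans (shared c proper (⁻-proper old) (agree⇒share i agree))
            (sym (agree₃ (injective c (⁺-proper old)) (injective c (⁻-proper old)) (h≢r old) (at-h old)
              (does-yes (trans straight₀ (invariant straight straight-closed proper₀ old))) i))

        givenBy : ∀ {y} → GivenBy c⁺ y → GivenBy c y
        givenBy (y∈ , const) = W⊆W′ y∈ , λ y∼e proper proper′ →
          trans (follows proper _) (trans (const y∼e (proper-shrink proper) (proper-shrink proper′)) (sym (follows proper′ _)))

      module Twisted {γ₀} (proper₀ : Proper W γ₀) (twisted₀ : false ≡ straight γ₀) where
        α≢β : ∀ {γ} → Proper W γ → α γ ≢ β γ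
        α≢β proper = does-no (trans twisted₀ (invariant straight straight-closed proper₀ proper))

        s⁺ : ∀ {γ} → Proper W γ → value c (γ ⁺) (γ s) ≡ β γ
        s⁺ proper = exchange (injective c (⁺-proper proper)) (injective c (⁻-proper proper))
          (h≢r proper) (h≢s proper) (r≢s proper) (at-h proper) (α≢β proper)

        s⁻ : ∀ {γ} → Proper W γ → value c (γ ⁻) (γ s) ≡ α γ
        s⁻ proper = exchange (injective c (⁻-proper proper)) (injective c (⁺-proper proper))
          (h≢r proper) (h≢s proper) (r≢s proper) (sym (at-h proper)) (≢-sym (α≢β proper))

        α-closed : ∀ {γ γ′ i j} → Proper W γ → Proper W γ′ → Share W γ i γ′ j → i ≢ γ h → α γ ≡ α γ′
        α-closed proper proper′ share i≢h with other-class proper proper′ share i≢h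
        ... | inj₁ (refl , refl) = value⁺ proper proper′ share
        ... | inj₂ (refl , refl) = trans (sym (s⁻ proper)) (trans (value⁻ proper proper′ share) (s⁻ proper′))

        β-closed : ∀ {γ γ′ i j} → Proper W γ → Proper W γ′ → Share W γ i γ′ j → i ≢ γ h → β γ ≡ β γ′
        β-closed proper proper′ share i≢h with other-class proper proper′ share i≢h
        ... | inj₁ (refl , refl) = value⁻ proper proper′ share
        ... | inj₂ (refl , refl) = trans (sym (s⁺ proper)) (trans (value⁺ proper proper′ share) (s⁺ proper′))

        α-const : ∀ {γ γ′} → Proper W γ → Proper W γ′ → α γ ≡ α γ′
        α-const {γ} {γ′} proper proper′ = does-yes (trans (sym (dec-true (α γ′ ≟ᶜ α γ′) refl))
          (invariant (λ δ → does (α δ ≟ᶜ α γ′)) (λ p p′ share i≢ → cong (λ a → does (a ≟ᶜ α γ′)) (α-closed p p′ share i≢)) proper′ proper))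

        β-const : ∀ {γ γ′} → Proper W γ → Proper W γ′ → β γ ≡ β γ′
        β-const {γ} {γ′} proper proper′ = does-yes (trans (sym (dec-true (β γ′ ≟ᶜ β γ′) refl))
          (invariant (λ δ → does (β δ ≟ᶜ β γ′)) (λ p p′ share i≢ → cong (λ a → does (a ≟ᶜ β γ′)) (β-closed p p′ share i≢)) proper′ proper))

        -- In `γ ⁻` the edge `p` has the colour of `s`, but the twist gives that class the value
        -- `α γ`, just as for the class of `p` in `γ ⁺`. So `p` always sees α and `q` always sees β,
        -- and the new vertex represents `c`.
        at-p : ∀ {γ} → Proper W′ γ → value c γ (γ p) ≡ α γ
        at-p {γ} proper = case (shape proper)
          where
          old : Proper W γ
          old = proper-shrink proper
          case : Shape γ → value c γ (γ p) ≡ α γ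
          case (is-⁺ pr _ agree) = trans (cong (value c γ) pr) (shared c proper (⁺-proper old) (agree⇒share _ agree))
          case (is-⁻ ps _ agree) = trans (cong (value c γ) ps) (trans (shared c proper (⁻-proper old) (agree⇒share _ agree)) (s⁻ old))

        at-q : ∀ {γ} → Proper W′ γ → value c γ (γ q) ≡ β γ
        at-q {γ} proper = case (shape proper)
          where
          old : Proper W γ
          old = proper-shrink proper
          case : Shape γ → value c γ (γ q) ≡ β γ
          case (is-⁺ _ qs agree) = trans (cong (value c γ) qs) (trans (shared c proper (⁺-proper old) (agree⇒share _ agree)) (s⁺ old))
          case (is-⁻ _ qr agree) = trans (cong (value c γ) qr) (shared c proper (⁻-proper old) (agree⇒share _ agree))

        const-p : Constant c p
        const-p proper proper′ = trans (at-p proper) (trans (α-const (proper-shrink proper) (proper-shrink proper′)) (sym (at-p proper′)))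

        const-q : Constant c q
        const-q proper proper′ = trans (at-q proper) (trans (β-const (proper-shrink proper) (proper-shrink proper′)) (sym (at-q proper′)))

        givenBy : GivenBy c x
        givenBy = x∈W′ , two-constant c x∈W′ (rotate claw-x) const-p const-q

    represented : Colourable W → ¬ ¬ (∃[ y ] GivenBy c y)
    represented (γ₀ , proper₀) none with straight γ₀ in eq
    ... | true  = rep c⁺ λ (y , given) → none (y , Straight.givenBy proper₀ (sym eq) given)
    ... | false = none (x , Twisted.givenBy proper₀ (sym eq))

-- Attaching an ear: gluing colourings and walks

third-char : ∀ {a b i} → a ≢ b → third a b ≡ i ⇆ (a ≢ i × b ≢ i)
third-char {a} {b} {i} a≢b =
  (λ { refl → ≢-sym (third≢ˡ a b) , ≢-sym (third≢ʳ a b) }) ,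
  (λ (a≢i , b≢i) → sym (remaining-colour a b (third a b) i a≢b (≢-sym (third≢ˡ a b)) (≢-sym (third≢ʳ a b)) (≢-sym a≢i) (≢-sym b≢i)))

0≢1 : _≢_ {A = Colour} 0F 1F
0≢1 ()

0≢2 : _≢_ {A = Colour} 0F 2F
0≢2 ()

1≢2 : _≢_ {A = Colour} 1F 2F
1≢2 ()

abstract
  norm : Colour → Colour → Colour → Colour
  norm p q i with i ≟ᶜ p | i ≟ᶜ q
  ... | yes _ | _     = 0F
  ... | no _  | yes _ = 1F
  ... | no _  | no _  = 2F

  norm-p : ∀ p q → norm p q p ≡ 0F
  norm-p p q with p ≟ᶜ p | p ≟ᶜ q
  ... | yes _ | _ = refl
  ... | no ¬p | _ = ⊥-elim (¬p refl)

  norm-q : ∀ {p q} → p ≢ q → norm p q q ≡ 1F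
  norm-q {p} {q} p≢q with q ≟ᶜ p | q ≟ᶜ q
  ... | yes eq | _     = ⊥-elim (p≢q (sym eq))
  ... | no _   | yes _ = refl
  ... | no _   | no ¬p = ⊥-elim (¬p refl)

  norm-cong : ∀ {p q i p′ q′ i′} → p ≡ i ⇆ p′ ≡ i′ → q ≡ i ⇆ q′ ≡ i′ → norm p q i ≡ norm p′ q′ i′
  norm-cong {p} {q} {i} {p′} {q′} {i′} (f , f⁻) (g , g⁻) with i ≟ᶜ p | i ≟ᶜ q | i′ ≟ᶜ p′ | i′ ≟ᶜ q′
  ... | yes _ | _     | yes _ | _     = refl
  ... | yes a | _     | no b  | _     = ⊥-elim (b (sym (f (sym a))))
  ... | no a  | _     | yes b | _     = ⊥-elim (a (sym (f⁻ (sym b))))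
  ... | no _  | yes _ | no _  | yes _ = refl
  ... | no _  | yes a | no _  | no b  = ⊥-elim (b (sym (g (sym a))))
  ... | no _  | no a  | no _  | yes b = ⊥-elim (a (sym (g⁻ (sym b))))
  ... | no _  | no _  | no _  | no _  = refl

  norm-inj : ∀ {p q} → p ≢ q → Injective₃ (norm p q)
  norm-inj {p} {q} p≢q {i} {j} eq with i ≟ᶜ p | i ≟ᶜ q | j ≟ᶜ p | j ≟ᶜ q
  ... | yes a | _     | yes b | _     = trans a (sym b)
  ... | yes _ | _     | no _  | yes _ = ⊥-elim (0≢1 eq)
  ... | yes _ | _     | no _  | no _  = ⊥-elim (0≢2 eq)
  ... | no _  | yes _ | yes _ | _     = ⊥-elim (0≢1 (sym eq))
  ... | no _  | no _  | yes _ | _     = ⊥-elim (0≢2 (sym eq))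
  ... | no _  | yes a | no _  | yes b = trans a (sym b)
  ... | no _  | yes _ | no _  | no _  = ⊥-elim (1≢2 eq)
  ... | no _  | no _  | no _  | yes _ = ⊥-elim (1≢2 (sym eq))
  ... | no a  | no a′ | no b  | no b′ =
    trans (remaining-colour p q (third p q) i p≢q (≢-sym (third≢ˡ p q)) (≢-sym (third≢ʳ p q)) a a′)
      (sym (remaining-colour p q (third p q) j p≢q (≢-sym (third≢ˡ p q)) (≢-sym (third≢ʳ p q)) b b′))

  norm-id : ∀ i → norm 0F 1F i ≡ i
  norm-id = λ { 0F → refl ; 1F → refl ; 2F → refl }

module EarStep (G : CubicGraph) {W W′ : Subset (CubicGraph.#vertices G)} (E : Structure.Ear G W W′) where
  open GraphKit G
  open Structure G
  open Colouring G
  open Ear E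

  len : ℕ
  len = suc (suc m)

  hᵘ hᵛ : Edge
  hᵘ = x zero
  hᵛ = x (fromℕ len)

  W⊆W′ : ∀ {z} → z ∈ W → z ∈ W′
  W⊆W′ z∈ = proj₂ members (inj₁ z∈)

  y∈W′ : ∀ j → y j ∈ W′
  y∈W′ j = proj₂ members (inj₂ (j , refl))

  Inc-e : Inc W e
  Inc-e = u , u∈W , u∼e

  Inc-hᵘ : Inc W hᵘ
  Inc-hᵘ = u , u∈W , u∼x

  Inc-hᵛ : Inc W hᵛ
  Inc-hᵛ = v , v∈W , v∼x

  Inc-split : ∀ {g} → Inc W′ g → Inc W g ⊎ (∃[ j ] g ≡ x j) ⊎ (∃[ j ] g ≡ q j)
  Inc-split (z , z∈ , z∼g) with proj₁ members z∈
  ... | inj₁ z∈W        = inj₁ (z , z∈W , z∼g)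
  ... | inj₂ (j , refl) with Claw.only (claw-y j) z∼g
  ...   | inj₁ eq        = inj₂ (inj₁ (inject₁ j , eq))
  ...   | inj₂ (inj₁ eq) = inj₂ (inj₁ (suc j , eq))
  ...   | inj₂ (inj₂ eq) = inj₂ (inj₂ (j , eq))

  proper-shrink : ∀ {γ} → Proper W′ γ → Proper W γ
  proper-shrink proper v∈ = proper (W⊆W′ v∈)

  -- The first and the last edge of the ear already meet `W`, so only walks that begin and end with
  -- their colours can be glued.
  Fits : EdgeColouring → Colour → Colour → Set
  Fits γ a b = γ hᵘ ≡ a × γ hᵛ ≡ b

  abstract
    glue : ∀ {a b} → EdgeColouring → Walk a b len → EdgeColouring
    glue γ ω g with any? (λ j → x j ≟ g) | any? (λ j → q j ≟ g)
    ... | yes (j , _) | _           = at ω j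
    ... | no _        | yes (j , _) = third (at ω (inject₁ j)) (at ω (suc j))
    ... | no _        | no _        = γ g

    glue-x : ∀ {a b} γ (ω : Walk a b len) j → glue γ ω (x j) ≡ at ω j
    glue-x γ ω j with any? (λ i → x i ≟ x j) | any? (λ i → q i ≟ x j)
    ... | yes (i , eq) | _ = cong (at ω) (x-inj eq)
    ... | no none      | _ = ⊥-elim (none (j , refl))

    glue-q : ∀ {a b} γ (ω : Walk a b len) j → glue γ ω (q j) ≡ third (at ω (inject₁ j)) (at ω (suc j))
    glue-q γ ω j with any? (λ i → x i ≟ q j) | any? (λ i → q i ≟ q j)
    ... | yes (i , eq) | _            = ⊥-elim (x≢q eq)
    ... | no _         | yes (i , eq) with refl ← q-inj eq = refl
    ... | no _         | no none      = ⊥-elim (none (j , refl))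

    glue-old : ∀ {a b γ} (ω : Walk a b len) → Fits γ a b → ∀ {g} → Inc W g → glue γ ω g ≡ γ g
    glue-old {γ = γ} ω (γu , γv) {g} (z , z∈ , z∼g) with any? (λ j → x j ≟ g) | any? (λ j → q j ≟ g)
    ... | no _           | yes (j , refl) = ⊥-elim (q-new z∈ z∼g)
    ... | no _           | no _           = refl
    ... | yes (j , refl) | _              with x-new z∈ z∼g
    ...   | inj₁ refl = sym γu
    ...   | inj₂ refl = trans (at-last ω) (sym γv)

  glue-proper : ∀ {a b γ} (ω : Walk a b len) → Fits γ a b → Proper W γ → Proper W′ (glue γ ω)
  glue-proper {γ = γ} ω fits proper z∈ z∼f z∼g f≢g with proj₁ members z∈
  ... | inj₁ z∈W        = subst₂ _≢_ (sym (glue-old ω fits (_ , z∈W , z∼f))) (sym (glue-old ω fits (_ , z∈W , z∼g)))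
                            (proper z∈W z∼f z∼g f≢g)
  ... | inj₂ (j , refl) = claw-proper (claw-y j)
    (subst₂ _≢_ (sym (glue-x γ ω (inject₁ j))) (sym (glue-x γ ω (suc j))) (at-≢ ω j))
    (subst₂ _≢_ (sym (glue-x γ ω (inject₁ j))) (sym (glue-q γ ω j)) (≢-sym (third≢ˡ (at ω (inject₁ j)) (at ω (suc j)))))
    (subst₂ _≢_ (sym (glue-x γ ω (suc j))) (sym (glue-q γ ω j)) (≢-sym (third≢ʳ (at ω (inject₁ j)) (at ω (suc j)))))
    z∼f z∼g f≢g

  -- A third edge has colour `i` exactly if neither of the two edges of the ear beside it has, so
  -- the class of `i` along the walk determines it on the third edges as well.
  glue-share : ∀ {a b a′ b′ γ γ′ i} (ω : Walk a b len) (ω′ : Walk a′ b′ len) → Fits γ a b → Fits γ′ a′ b′ →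
               Share W γ i γ′ i → Same i ω ω′ → Share W′ (glue γ ω) i (glue γ′ ω′) i
  glue-share {γ = γ} {γ′} {i} ω ω′ fits fits′ share same g∈ with Inc-split g∈
  ... | inj₁ g∈W = trans (glue-old ω′ fits′ g∈W) ∘ proj₁ (share g∈W) ∘ trans (sym (glue-old ω fits g∈W)) ,
                   trans (glue-old ω fits g∈W) ∘ proj₂ (share g∈W) ∘ trans (sym (glue-old ω′ fits′ g∈W))
  ... | inj₂ (inj₁ (j , refl)) = trans (glue-x γ′ ω′ j) ∘ proj₁ (same j) ∘ trans (sym (glue-x γ ω j)) ,
                                 trans (glue-x γ ω j) ∘ proj₂ (same j) ∘ trans (sym (glue-x γ′ ω′ j))
  ... | inj₂ (inj₂ (j , refl)) = trans (glue-q γ′ ω′ j) ∘ third-same same ∘ trans (sym (glue-q γ ω j)) ,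
                                 trans (glue-q γ ω j) ∘ third-same {ω = ω′} {ω} (same-sym {ω = ω} {ω′} same) ∘ trans (sym (glue-q γ′ ω′ j))
    where
    third-same : ∀ {a b a′ b′} {ω : Walk a b len} {ω′ : Walk a′ b′ len} → Same i ω ω′ →
                 third (at ω (inject₁ j)) (at ω (suc j)) ≡ i → third (at ω′ (inject₁ j)) (at ω′ (suc j)) ≡ i
    third-same {ω = ω} {ω′} same eq = proj₂ (third-char (at-≢ ω′ j))
      (proj₁ not-i ∘ proj₂ (same (inject₁ j)) , proj₂ not-i ∘ proj₂ (same (suc j)))
      where
      not-i : at ω (inject₁ j) ≢ i × at ω (suc j) ≢ i
      not-i = proj₁ (third-char (at-≢ ω j)) eq

  abstract
    read : ∀ {γ a b} → Proper W′ γ → Fits γ a b → Σ[ ω ∈ Walk a b len ] (∀ k → at ω k ≡ γ (x k))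
    read {γ} proper (refl , refl) = fromFunction (γ ∘ x)
      (λ k → proper (y∈W′ k) (Claw.v∼a (claw-y k)) (Claw.v∼b (claw-y k)) (Claw.a≢b (claw-y k)))

    glue-read : ∀ {γ a b} (proper : Proper W′ γ) (fits : Fits γ a b) → Agree W′ (glue γ (proj₁ (read proper fits))) γ
    glue-read {γ} proper fits {g} g∈ with Inc-split g∈
    ... | inj₁ g∈W               = glue-old (proj₁ (read proper fits)) fits g∈W
    ... | inj₂ (inj₁ (j , refl)) = trans (glue-x γ (proj₁ (read proper fits)) j) (proj₂ (read proper fits) j)
    ... | inj₂ (inj₂ (j , refl)) = trans (glue-q γ (proj₁ (read proper fits)) j)
      (trans (cong₂ third (proj₂ (read proper fits) (inject₁ j)) (proj₂ (read proper fits) (suc j)))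
        (proj₂ (third-char (ne Claw.v∼a Claw.v∼b Claw.a≢b)) (ne Claw.v∼a Claw.v∼c Claw.a≢c , ne Claw.v∼b Claw.v∼c Claw.b≢c)))
      where
      ne : ∀ {a b} → (Claw (y j) (x (inject₁ j)) (x (suc j)) (q j) → y j ∼ a) →
           (Claw (y j) (x (inject₁ j)) (x (suc j)) (q j) → y j ∼ b) →
           (Claw (y j) (x (inject₁ j)) (x (suc j)) (q j) → a ≢ b) → γ a ≢ γ b
      ne f g h = proper (y∈W′ j) (f (claw-y j)) (g (claw-y j)) (h (claw-y j))

  e≢hᵘ : e ≢ hᵘ
  e≢hᵘ = ≢-sym first≢e

  e≢hᵛ : e ≢ hᵛ
  e≢hᵛ = ≢-sym last≢e

  γe≢γhᵘ : ∀ {γ} → Proper W γ → γ e ≢ γ hᵘ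
  γe≢γhᵘ proper = proper u∈W u∼e u∼x e≢hᵘ

  γe≢γhᵛ : ∀ {γ} → Proper W γ → γ e ≢ γ hᵛ
  γe≢γhᵛ proper = proper v∈W v∼e v∼x e≢hᵛ

  -- Normalised colourings: e and hᵘ have the colours 0 and 1, and hᵛ has colour b.
  record Normal (γ : EdgeColouring) (b : Colour) : Set where
    field
      proper : Proper W γ
      at-e   : γ e ≡ 0F
      at-hᵘ  : γ hᵘ ≡ 1F
      at-hᵛ  : γ hᵛ ≡ b

    fits : Fits γ 1F b
    fits = at-hᵘ , at-hᵛ

    b≢0 : b ≢ 0F
    b≢0 eq = γe≢γhᵛ proper (trans at-e (sym (trans at-hᵛ eq)))

  π : EdgeColouring → Colour → Colour
  π γ = norm (γ e) (γ hᵘ)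

  π-inj : ∀ {γ} → Proper W γ → Injective₃ (π γ)
  π-inj proper = norm-inj (γe≢γhᵘ proper)

  normalised : EdgeColouring → EdgeColouring
  normalised γ = π γ ∘ γ

  normal : ∀ {γ} → Proper W γ → Normal (normalised γ) (π γ (γ hᵛ))
  normal {γ} proper = record
    { proper = proper-relabel {γ = γ} (π-inj proper) proper
    ; at-e = norm-p (γ e) (γ hᵘ) ; at-hᵘ = norm-q (γe≢γhᵘ proper) ; at-hᵛ = refl }

  π-share : ∀ {γ γ′ i j} → Share W γ i γ′ j → π γ i ≡ π γ′ j
  π-share share = norm-cong (share Inc-e) (share Inc-hᵘ)

  normalised-share : ∀ {γ γ′ i j} → Proper W γ → Proper W γ′ → Share W γ i γ′ j →
                     Share W (normalised γ) (π γ i) (normalised γ′) (π γ i)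
  normalised-share {γ} {γ′} {i} {j} proper proper′ share g∈ =
    (λ eq → trans (cong (π γ′) (proj₁ (share g∈) (π-inj proper eq))) (sym (π-share share))) ,
    (λ eq → cong (π γ) (proj₂ (share g∈) (π-inj proper′ (trans eq (π-share share)))))

  π-normal : ∀ {γ b} → Normal γ b → ∀ i → π γ i ≡ i
  π-normal {γ} N i = trans (cong₂ (λ p q → norm p q i) (Normal.at-e N) (Normal.at-hᵘ N)) (norm-id i)

  -- At hᵛ the classes of 1 and of 2 distinguish the two kinds of normalised colourings.
  mixed⇒0 : ∀ {γ γ′ i b b′} → Normal γ b → Normal γ′ b′ → b ≢ b′ → Share W γ i γ′ i → i ≡ 0F
  mixed⇒0 {i = i} {b} {b′} N N′ b≢b′ share = decidable-stable (i ≟ᶜ 0F) clash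
    where
    clash : i ≢ 0F → ⊥
    clash i≢0 with b ≟ᶜ i | b′ ≟ᶜ i
    ... | yes refl | _        = b≢b′ (sym (trans (sym (Normal.at-hᵛ N′)) (proj₁ (share Inc-hᵛ) (Normal.at-hᵛ N))))
    ... | no _     | yes refl = b≢b′ (trans (sym (Normal.at-hᵛ N)) (proj₂ (share Inc-hᵛ) (Normal.at-hᵛ N′)))
    ... | no b≢i   | no b′≢i  = b≢b′ (trans (is-third b≢i (Normal.b≢0 N)) (sym (is-third b′≢i (Normal.b≢0 N′))))
      where
      is-third : ∀ {b} → b ≢ i → b ≢ 0F → b ≡ third i 0F
      is-third {b} b≢i b≢0 = remaining-colour i 0F (third i 0F) b i≢0 (≢-sym (third≢ˡ i 0F)) (≢-sym (third≢ʳ i 0F)) b≢i b≢0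

  module _ (sep : Separated W) where
    exists₂ : ¬ ¬ (∃[ γ ] Normal γ 2F)
    exists₂ none = sep Inc-hᵘ Inc-hᵛ (λ eq → 0≢last (x-inj eq)) λ (γ , proper , neq) →
      none (normalised γ , subst (Normal (normalised γ)) (remaining-colour 0F 1F 2F _ 0≢1 0≢2 1≢2
        (Normal.b≢0 (normal proper)) (λ eq → neq (π-inj proper (trans (norm-q (γe≢γhᵘ proper)) (sym eq))))) (normal proper))
      where
      0≢last : zero ≢ fromℕ len
      0≢last ()

    -- Let `f` be the third edge at `u`. The colour of `hᵛ` differs from that of `e`, which it meets
    -- at `v`, and by separation from that of `f`, so it is the colour of `hᵘ`.
    exists₁ : ¬ ¬ (∃[ γ ] Normal γ 1F)
    exists₁ none with f , K ← thirdEdge u∼e u∼x e≢hᵘ =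
      sep (u , u∈W , Claw.v∼c K) Inc-hᵛ (λ { refl → u≢v (last-only u∈W (Claw.v∼c K)) }) λ (γ , proper , neq) →
        none (normalised γ , subst (Normal (normalised γ))
          (trans (cong (π γ) (remaining-colour (γ e) (γ f) (γ hᵘ) (γ hᵛ) (proper u∈W u∼e (Claw.v∼c K) (Claw.a≢c K))
            (γe≢γhᵘ proper) (proper u∈W (Claw.v∼c K) u∼x (≢-sym (Claw.b≢c K))) (≢-sym (γe≢γhᵛ proper)) (≢-sym neq)))
            (norm-q (γe≢γhᵘ proper)))
          (normal proper))

    exists : ∀ {b} → b ≢ 0F → ¬ ¬ (∃[ γ ] Normal γ b)
    exists {0F} b≢0 = ⊥-elim (b≢0 refl)
    exists {1F} _   = exists₁
    exists {2F} _   = exists₂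

  colourable : Colourable W → Colourable W′
  colourable (γ , proper) = _ , glue-proper {γ = γ} (anyWalk m (γ hᵘ) (γ hᵛ)) (refl , refl) proper

  Inner : Fin (3 ℕ.+ m) → Set
  Inner j = ∃[ l ] j ≡ suc (inject₁ l)

  x-kind : ∀ j → Inc W (x j) ⊎ Inner j
  x-kind zero    = inj₁ Inc-hᵘ
  x-kind (suc j) with view j
  ... | ‵fromℕ     = inj₁ Inc-hᵛ
  ... | ‵inject₁ l = inj₂ (l , refl)

  -- A walk without 0 gives colour 0 to all third edges. Inserting a 0 at the edge `g` of the ear,
  -- or beside the third edge `g`, changes the colour of `g` but not that of `f`, so one of the two
  -- colourings separates them.
  separate-new : Separated W → ∀ {f g} → Inc W f → (∃[ j ] g ≡ x j × Inner j) ⊎ (∃[ j ] g ≡ q j) →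
                 ¬ ¬ (∃[ γ ] Proper W′ γ × γ f ≢ γ g)
  separate-new sep {f} {g} f∈ new none with b , b≢0 , ω , av ← walkFrom len (≢-sym 0≢1) =
    exists sep b≢0 λ (γ , N) → conclude N new
    where
    module _ {γ} (N : Normal γ b) where
      open Normal N
      two : (ω′ : Walk 1F b len) → glue γ ω g ≢ glue γ ω′ g → ⊥
      two ω′ neq with glue γ ω f ≟ᶜ glue γ ω g
      ... | no differ = none (_ , glue-proper ω fits proper , differ)
      ... | yes eq    = none (_ , glue-proper ω′ fits proper , λ eq′ →
            neq (trans (sym eq) (trans (trans (glue-old ω fits f∈) (sym (glue-old ω′ fits f∈))) eq′)))
      conclude : (∃[ j ] g ≡ x j × Inner j) ⊎ (∃[ j ] g ≡ q j) → ⊥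
      conclude (inj₁ (_ , refl , l , refl)) with ω′ , at-l ← insert ω av l = two ω′ λ eq →
        av (suc (inject₁ l) , trans (sym (glue-x γ ω _)) (trans eq (trans (glue-x γ ω′ _) at-l)))
      conclude (inj₂ (j , g≡)) = at-q j g≡
        where
        q≡0 : ∀ j → glue γ ω (q j) ≡ 0F
        q≡0 j = trans (glue-q γ ω j) (proj₂ (third-char (at-≢ ω j)) ((λ eq → av (inject₁ j , eq)) , (λ eq → av (suc j , eq))))
        q≢0 : ∀ (ω′ : Walk 1F b len) j → at ω′ (inject₁ j) ≡ 0F ⊎ at ω′ (suc j) ≡ 0F → glue γ ω′ (q j) ≢ 0F
        q≢0 ω′ j (inj₁ eq) eq′ = proj₁ (proj₁ (third-char (at-≢ ω′ j)) (trans (sym (glue-q γ ω′ j)) eq′)) eq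
        q≢0 ω′ j (inj₂ eq) eq′ = proj₂ (proj₁ (third-char (at-≢ ω′ j)) (trans (sym (glue-q γ ω′ j)) eq′)) eq
        at-q : ∀ j → g ≡ q j → ⊥
        at-q zero    refl with ω′ , at-l ← insert ω av zero = two ω′ λ eq → q≢0 ω′ zero (inj₂ at-l) (trans (sym eq) (q≡0 zero))
        at-q (suc l) refl with ω′ , at-l ← insert ω av l = two ω′ λ eq → q≢0 ω′ (suc l) (inj₁ at-l) (trans (sym eq) (q≡0 (suc l)))

  separated : Separated W → ∀ {f g} → Inc W f → Inc W′ g → f ≢ g → ¬ ¬ (∃[ γ ] Proper W′ γ × γ f ≢ γ g)
  separated sep {f} {g} f∈ g∈ f≢g none = case (Inc-split g∈)
    where
    old : Inc W g → ⊥
    old g∈W = sep f∈ g∈W f≢g λ (γ , proper , neq) → none (_ , glue-proper {γ = γ} (anyWalk m _ _) (refl , refl) proper ,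
      subst₂ _≢_ (sym (glue-old (anyWalk m _ _) (refl , refl) f∈)) (sym (glue-old (anyWalk m _ _) (refl , refl) g∈W)) neq)
    case : Inc W g ⊎ (∃[ j ] g ≡ x j) ⊎ (∃[ j ] g ≡ q j) → ⊥
    case (inj₁ g∈W)               = old g∈W
    case (inj₂ (inj₂ new))        = separate-new sep f∈ (inj₂ new) none
    case (inj₂ (inj₁ (j , refl))) with x-kind j
    ... | inj₁ g∈W   = old g∈W
    ... | inj₂ inner = separate-new sep f∈ (inj₁ (j , refl , inner)) none

-- Attaching an ear: the representing vertex

module EarRepresented (G : CubicGraph) {W W′ : Subset (CubicGraph.#vertices G)} (E : Structure.Ear G W W′)
                      (rep : Colouring.Represented G W) (sep : Colouring.Separated G W)
                      (c : Colouring.ClassColouring G W′) where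
  open GraphKit G
  open Structure G
  open Colouring G
  open ClassColouring
  open Ear E
  open EarStep G E

  -- The values of `c` as a function of two variables, the colouring near `W` and the walk. Below,
  -- `Straight` is independence of the walk and `RowConstant` is independence of the colouring.
  C : ∀ {b} → EdgeColouring → Walk 1F b len → Colour → Colour
  C γ ω = value c (glue γ ω)

  C-inj : ∀ {b γ} → Normal γ b → (ω : Walk 1F b len) → Injective₃ (C γ ω)
  C-inj N ω = injective c (glue-proper ω (Normal.fits N) (Normal.proper N))

  C-share : ∀ {b b′ γ γ′ i} → Normal γ b → Normal γ′ b′ → (ω : Walk 1F b len) (ω′ : Walk 1F b′ len) →
            Share W γ i γ′ i → Same i ω ω′ → C γ ω i ≡ C γ′ ω′ i
  C-share {i = i} N N′ ω ω′ share same = shared c (glue-proper ω (Normal.fits N) (Normal.proper N))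
    (glue-proper ω′ (Normal.fits N′) (Normal.proper N′)) (glue-share ω ω′ (Normal.fits N) (Normal.fits N′) share same)

  C-γ : ∀ {b γ γ′ i} → Normal γ b → Normal γ′ b → (ω : Walk 1F b len) → Share W γ i γ′ i → C γ ω i ≡ C γ′ ω i
  C-γ N N′ ω share = C-share N N′ ω ω share (same-refl {ω = ω})

  C-ω : ∀ {b b′ γ i} → Normal γ b → Normal γ b′ → (ω : Walk 1F b len) (ω′ : Walk 1F b′ len) → Same i ω ω′ → C γ ω i ≡ C γ ω′ i
  C-ω {γ = γ} N N′ ω ω′ = C-share N N′ ω ω′ (share-refl {γ = γ})

  kind : ∀ {γ b} → Normal γ b → b ≡ 1F ⊎ b ≡ 2F
  kind {b = 0F} N = ⊥-elim (Normal.b≢0 N refl)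
  kind {b = 1F} N = inj₁ refl
  kind {b = 2F} N = inj₂ refl

  agree-normalised : ∀ {γ b} → Normal γ b → Agree W γ (normalised γ)
  agree-normalised {γ} N {g} _ = sym (π-normal N (γ g))

  normalised-normal : ∀ {γ b} → Normal γ b → Normal (normalised γ) b
  normalised-normal {γ} N = subst (Normal (normalised γ)) (trans (π-normal N (γ hᵛ)) (Normal.at-hᵛ N)) (normal (Normal.proper N))

  normal-invariant : ∀ {w h} → w ∈ W → w ∼ h → (∀ {z} → z ∈ W → z ∼ h → z ≡ w) → (D : EdgeColouring → Bool) →
    (∀ {γ γ′ b b′ i} → Normal γ b → Normal γ′ b′ → Share W γ i γ′ i → i ≢ γ h → D γ ≡ D γ′) →
    ∀ {γ γ′ b b′} → Normal γ b → Normal γ′ b′ → D γ ≡ D γ′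
  normal-invariant {h = h} w∈W w∼h h-only D closed {γ} {γ′} N N′ = trans (to-normalised N) (trans
    (halfEdge-invariant rep sep w∈W w∼h h-only (D ∘ normalised)
      (λ {γ} {γ′} proper proper′ share i≢ → closed (normal proper) (normal proper′)
        (normalised-share {γ} {γ′} proper proper′ share) (≢⇒≢ (π-inj proper) i≢))
      (Normal.proper N) (Normal.proper N′))
    (sym (to-normalised N′)))
    where
    to-normalised : ∀ {γ b} → Normal γ b → D γ ≡ D (normalised γ)
    -- The colour `third (γ h) (γ h)` is merely some colour other than that of `h`.
    to-normalised {γ} N = closed N (normalised-normal N) (agree⇒share (third (γ h) (γ h)) (agree-normalised N)) (third≢ˡ (γ h) (γ h))

  invariantᵘ : (D : EdgeColouring → Bool) →
    (∀ {γ γ′ b b′ i} → Normal γ b → Normal γ′ b′ → Share W γ i γ′ i → i ≢ γ hᵘ → D γ ≡ D γ′) →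
    ∀ {γ γ′ b b′} → Normal γ b → Normal γ′ b′ → D γ ≡ D γ′
  invariantᵘ = normal-invariant u∈W u∼x first-only

  invariantᵛ : (D : EdgeColouring → Bool) →
    (∀ {γ γ′ b b′ i} → Normal γ b → Normal γ′ b′ → Share W γ i γ′ i → i ≢ γ hᵛ → D γ ≡ D γ′) →
    ∀ {γ γ′ b b′} → Normal γ b → Normal γ′ b′ → D γ ≡ D γ′
  invariantᵛ = normal-invariant v∈W v∼x last-only

  -- The classes of W extended along ω₁ and ω₂: a colouring c restricts to W.
  module Section (ω₁ : Walk 1F 1F len) (ω₂ : Walk 1F 2F len) (same : Same 0F ω₁ ω₂) where
    Cˢ : EdgeColouring → Colour → Colour
    Cˢ γ i with γ hᵛ ≟ᶜ 1F
    ... | yes _ = C γ ω₁ i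
    ... | no _  = C γ ω₂ i

    Cˢ₁ : ∀ {γ} → Normal γ 1F → ∀ i → Cˢ γ i ≡ C γ ω₁ i
    Cˢ₁ {γ} N i with γ hᵛ ≟ᶜ 1F
    ... | yes _ = refl
    ... | no ¬p = ⊥-elim (¬p (Normal.at-hᵛ N))

    Cˢ₂ : ∀ {γ} → Normal γ 2F → ∀ i → Cˢ γ i ≡ C γ ω₂ i
    Cˢ₂ {γ} N i with γ hᵛ ≟ᶜ 1F
    ... | yes p = ⊥-elim (1≢2 (trans (sym p) (Normal.at-hᵛ N)))
    ... | no _  = refl

    Cˢ-share : ∀ {γ γ′ b b′ i} → Normal γ b → Normal γ′ b′ → Share W γ i γ′ i → Cˢ γ i ≡ Cˢ γ′ i
    Cˢ-share {γ} {γ′} {i = i} N N′ share with kind N | kind N′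
    ... | inj₁ refl | inj₁ refl = trans (Cˢ₁ N i) (trans (C-γ N N′ ω₁ share) (sym (Cˢ₁ N′ i)))
    ... | inj₂ refl | inj₂ refl = trans (Cˢ₂ N i) (trans (C-γ N N′ ω₂ share) (sym (Cˢ₂ N′ i)))
    -- Colourings of different kinds can share the class of 0 only, which is why exactly this class
    -- has to be common to `ω₁` and `ω₂`.
    ... | inj₁ refl | inj₂ refl with refl ← mixed⇒0 N N′ 1≢2 share =
      trans (Cˢ₁ N i) (trans (C-share N N′ ω₁ ω₂ share same) (sym (Cˢ₂ N′ i)))
    ... | inj₂ refl | inj₁ refl with refl ← mixed⇒0 N N′ (≢-sym 1≢2) share =
      trans (Cˢ₂ N i) (trans (C-share N N′ ω₂ ω₁ share (same-sym {ω = ω₁} {ω₂} same)) (sym (Cˢ₁ N′ i)))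

    Cˢ-inj : ∀ {γ b} → Normal γ b → Injective₃ (Cˢ γ)
    Cˢ-inj {γ} N {i} {j} eq with kind N
    ... | inj₁ refl = C-inj N ω₁ (trans (sym (Cˢ₁ N i)) (trans eq (Cˢ₁ N j)))
    ... | inj₂ refl = C-inj N ω₂ (trans (sym (Cˢ₂ N i)) (trans eq (Cˢ₂ N j)))

    restricted : ClassColouring W
    restricted = record
      { value     = λ γ i → Cˢ (normalised γ) (π γ i)
      ; injective = λ proper eq → π-inj proper (Cˢ-inj (normal proper) eq)
      ; shared    = λ {γ} {γ′} proper proper′ share → trans
          (Cˢ-share (normal proper) (normal proper′) (normalised-share {γ} {γ′} proper proper′ share))
          (cong (Cˢ (normalised γ′)) (π-share share)) }

    restricted-normal : ∀ {γ b} → Normal γ b → ∀ i → value restricted γ i ≡ Cˢ γ i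
    restricted-normal {γ} N i = trans (cong (Cˢ (normalised γ)) (π-normal N i))
      (sym (Cˢ-share N (normalised-normal N) (agree⇒share i (agree-normalised N))))

  Straight : Colour → Set
  Straight b = ∀ {γ} → Normal γ b → (ω ω′ : Walk 1F b len) → ∀ i → C γ ω i ≡ C γ ω′ i

  from-C : ∀ {γ} (proper : Proper W′ γ) i →
           let N = normal (proper-shrink proper) in
           Σ[ ω ∈ Walk 1F (π γ (γ hᵛ)) len ] (∀ k → at ω k ≡ normalised γ (x k)) × value c γ i ≡ C (normalised γ) ω (π γ i)
  from-C {γ} proper i = ω , at-ω , trans (shared c proper properⁿ (share-relabel {W′} {γ} (π-inj old)))
      (sym (shared c (glue-proper ω (Normal.fits N) (Normal.proper N)) properⁿ (agree⇒share (π γ i) (glue-read properⁿ (Normal.fits N)))))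
    where
    old : Proper W γ
    old = proper-shrink proper
    N : Normal (normalised γ) (π γ (γ hᵛ))
    N = normal old
    properⁿ : Proper W′ (normalised γ)
    properⁿ = proper-relabel {W′} {γ} (π-inj old) proper
    ω : Walk 1F (π γ (γ hᵛ)) len
    ω = proj₁ (read properⁿ (Normal.fits N))
    at-ω : ∀ k → at ω k ≡ normalised γ (x k)
    at-ω = proj₂ (read properⁿ (Normal.fits N))

  module StraightCase (straight₁ : Straight 1F) where
    -- Comparison of the values for ω and ω′, which share the class of z, at the class of 0.
    module Compare (z z̄ : Colour) (z≢0 : z ≢ 0F) (z≢z̄ : z ≢ z̄) (z̄≢0 : z̄ ≢ 0F)
                   (insert-0 : (ω : Walk 1F 2F len) → ¬ Has 0F ω → Σ[ ω′ ∈ Walk 1F 2F len ] Same z̄ ω ω′ × Has 0F ω′)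
                   {h} (invariant : (D : EdgeColouring → Bool) →
                     (∀ {γ γ′ b b′ i} → Normal γ b → Normal γ′ b′ → Share W γ i γ′ i → i ≢ γ h → D γ ≡ D γ′) →
                     ∀ {γ γ′ b b′} → Normal γ b → Normal γ′ b′ → D γ ≡ D γ′)
                   (at-h : ∀ {γ} → Normal γ 2F → γ h ≡ z) where

      -- Walks that use 0 can be redirected to end in 1 without changing the class of 0; there
      -- `straight₁` compares them.
      linked-both : ∀ {γ γ′} → Normal γ 2F → Normal γ′ 1F → Share W γ 0F γ′ 0F →
                    (ω ω′ : Walk 1F 2F len) → Has 0F ω → Has 0F ω′ → C γ ω 0F ≡ C γ ω′ 0F
      linked-both N N′ share ω ω′ has has′
        with σ , s ← retarget (≢-sym 0≢2) (≢-sym 0≢1) ω has | σ′ , s′ ← retarget (≢-sym 0≢2) (≢-sym 0≢1) ω′ has′ =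
        trans (C-share N N′ ω σ share s) (trans (straight₁ N′ σ σ′ 0F) (sym (C-share N N′ ω′ σ′ share s′)))

      -- If the values at 0 differed, `ω′` would have at `z̄` the value that `ω` has at 0. Inserting
      -- a 0 into `ω′` while keeping the class of `z̄` would then produce a walk with equal values
      -- at 0 and `z̄`.
      linked-one : ∀ {γ γ′} → Normal γ 2F → Normal γ′ 1F → Share W γ 0F γ′ 0F →
                   (ω ω′ : Walk 1F 2F len) → Same z ω ω′ → Has 0F ω → ¬ Has 0F ω′ → C γ ω 0F ≡ C γ ω′ 0F
      linked-one {γ} N N′ share ω ω′ same has avoids with ω″ , same″ , has″ ← insert-0 ω′ avoids =
        decidable-stable (C γ ω 0F ≟ᶜ C γ ω′ 0F) λ neq →
          z̄≢0 (C-inj N ω″ (trans (sym (C-ω N N ω′ ω″ same″))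
            (trans (exchange (C-inj N ω′) (C-inj N ω) z≢0 z≢z̄ (≢-sym z̄≢0) (sym (C-ω N N ω ω′ same)) (≢-sym neq))
              (linked-both N N′ share ω ω″ has has″))))

      linked : ∀ {γ γ′} → Normal γ 2F → Normal γ′ 1F → Share W γ 0F γ′ 0F →
               (ω ω′ : Walk 1F 2F len) → Same z ω ω′ → C γ ω 0F ≡ C γ ω′ 0F
      linked N N′ share ω ω′ same with has? 0F ω | has? 0F ω′
      ... | yes p | yes q = linked-both N N′ share ω ω′ p q
      ... | yes p | no q  = linked-one N N′ share ω ω′ same p q
      ... | no p  | yes q = sym (linked-one N N′ share ω′ ω (same-sym {ω = ω} {ω′} same) q p)
      ... | no p  | no q  = C-ω N N ω ω′ (same-avoiding {ω = ω} {ω′} p q)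

      compare : ∀ {γ} → Normal γ 2F → (ω ω′ : Walk 1F 2F len) → Same z ω ω′ → ∀ i → C γ ω i ≡ C γ ω′ i
      compare {γ₀} N₀ ω ω′ same = agree₃ (C-inj N₀ ω) (C-inj N₀ ω′) z≢0 (C-ω N₀ N₀ ω ω′ same) at-0
        where
        twisted : ∀ {P Q : Set} → Dec P → Dec Q → Bool
        twisted (yes _) (no _)  = true
        twisted (yes _) (yes _) = false
        twisted (no _)  _       = false
        -- `T` marks the colourings of the second kind for which `ω` and `ω′` have different values
        -- at 0. It is an invariant, and it is false on the colourings of the first kind, some of
        -- which exist.
        T : EdgeColouring → Bool
        T γ = twisted (γ hᵛ ≟ᶜ 2F) (C γ ω 0F ≟ᶜ C γ ω′ 0F)
        T₁ : ∀ {γ} → Normal γ 1F → T γ ≡ false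
        T₁ {γ} N with γ hᵛ ≟ᶜ 2F
        ... | yes p = ⊥-elim (1≢2 (trans (sym (Normal.at-hᵛ N)) p))
        ... | no _  = refl
        T-eq : ∀ {γ} → C γ ω 0F ≡ C γ ω′ 0F → T γ ≡ false
        T-eq {γ} eq with γ hᵛ ≟ᶜ 2F | C γ ω 0F ≟ᶜ C γ ω′ 0F
        ... | yes _ | yes _ = refl
        ... | yes _ | no ¬p = ⊥-elim (¬p eq)
        ... | no _  | _     = refl
        T-cong : ∀ {γ γ′} → Normal γ 2F → Normal γ′ 2F → C γ ω 0F ≡ C γ ω′ 0F ⇆ C γ′ ω 0F ≡ C γ′ ω′ 0F → T γ ≡ T γ′
        T-cong {γ} {γ′} N N′ (f , g) with γ hᵛ ≟ᶜ 2F | γ′ hᵛ ≟ᶜ 2F | C γ ω 0F ≟ᶜ C γ ω′ 0F | C γ′ ω 0F ≟ᶜ C γ′ ω′ 0F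
        ... | no ¬p | _     | _     | _     = ⊥-elim (¬p (Normal.at-hᵛ N))
        ... | yes _ | no ¬p | _     | _     = ⊥-elim (¬p (Normal.at-hᵛ N′))
        ... | yes _ | yes _ | yes _ | yes _ = refl
        ... | yes _ | yes _ | no _  | no _  = refl
        ... | yes _ | yes _ | yes p | no q  = ⊥-elim (q (f p))
        ... | yes _ | yes _ | no p  | yes q = ⊥-elim (p (g q))
        to-z̄ : ∀ {γ} → Normal γ 2F → C γ ω 0F ≡ C γ ω′ 0F → C γ ω z̄ ≡ C γ ω′ z̄
        to-z̄ N eq = agree₃ (C-inj N ω) (C-inj N ω′) z≢0 (C-ω N N ω ω′ same) eq z̄
        from-z̄ : ∀ {γ} → Normal γ 2F → C γ ω z̄ ≡ C γ ω′ z̄ → C γ ω 0F ≡ C γ ω′ 0F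
        from-z̄ N eq = agree₃ (C-inj N ω) (C-inj N ω′) z≢z̄ (C-ω N N ω ω′ same) eq 0F
        T₂ : ∀ {γ γ′ i} → Normal γ 2F → Normal γ′ 2F → Share W γ i γ′ i → i ≢ z → T γ ≡ T γ′
        T₂ {γ} {γ′} {i} N N′ share i≢z with i ≟ᶜ 0F
        ... | yes refl = T-cong N N′
          ((λ eq → trans (sym (C-γ N N′ ω share)) (trans eq (C-γ N N′ ω′ share))) ,
           (λ eq → trans (C-γ N N′ ω share) (trans eq (sym (C-γ N N′ ω′ share)))))
        ... | no i≢0 with refl ← remaining-colour z 0F z̄ i z≢0 z≢z̄ (≢-sym z̄≢0) i≢z i≢0 = T-cong N N′
          ((λ eq → from-z̄ N′ (trans (sym (C-γ N N′ ω share)) (trans (to-z̄ N eq) (C-γ N N′ ω′ share)))) ,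
           (λ eq → from-z̄ N (trans (C-γ N N′ ω share) (trans (to-z̄ N′ eq) (sym (C-γ N N′ ω′ share))))))
        closed : ∀ {γ γ′ b b′ i} → Normal γ b → Normal γ′ b′ → Share W γ i γ′ i → i ≢ γ h → T γ ≡ T γ′
        closed {γ} {γ′} N N′ share i≢ with kind N | kind N′
        ... | inj₁ refl | inj₁ refl = trans (T₁ N) (sym (T₁ N′))
        ... | inj₂ refl | inj₂ refl = T₂ N N′ share (λ eq → i≢ (trans eq (sym (at-h N))))
        ... | inj₂ refl | inj₁ refl with refl ← mixed⇒0 N N′ (≢-sym 1≢2) share =
          trans (T-eq (linked N N′ share ω ω′ same)) (sym (T₁ N′))
        ... | inj₁ refl | inj₂ refl with refl ← mixed⇒0 N N′ 1≢2 share =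
          trans (T₁ N) (sym (T-eq (linked N′ N (share-sym {γ = γ} share) ω ω′ same)))
        untwisted : T γ₀ ≡ false → C γ₀ ω 0F ≡ C γ₀ ω′ 0F
        untwisted eq with γ₀ hᵛ ≟ᶜ 2F | C γ₀ ω 0F ≟ᶜ C γ₀ ω′ 0F
        ... | no ¬p | _     = ⊥-elim (¬p (Normal.at-hᵛ N₀))
        ... | yes _ | yes p = p
        at-0 : C γ₀ ω 0F ≡ C γ₀ ω′ 0F
        at-0 = decidable-stable (C γ₀ ω 0F ≟ᶜ C γ₀ ω′ 0F) λ neq → exists₁ sep λ (γ₁ , N₁) →
          neq (untwisted (trans (invariant T closed N₀ N₁) (T₁ N₁)))

    straight₂ : Straight 2F
    straight₂ {γ} N ω ω′ i = along (connect len (≢-sym 0≢1) (≢-sym 0≢2) ω ω′)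
      where
      module Keep₁ = Compare 1F 2F (≢-sym 0≢1) 1≢2 (≢-sym 0≢2) (λ ω av → insertKeepingEnd 1≢2 ω av) {hᵘ} invariantᵘ Normal.at-hᵘ
      module Keep₂ = Compare 2F 1F (≢-sym 0≢2) (≢-sym 1≢2) (≢-sym 0≢1) (λ ω av → insertKeepingStart ω av) {hᵛ} invariantᵛ Normal.at-hᵛ
      along : ∀ {ω ω′} → Star (Move 0F) ω ω′ → C γ ω i ≡ C γ ω′ i
      along ε = refl
      along (_◅_ {ω} {ω₁} (0F , 0≢0 , same) r) = ⊥-elim (0≢0 refl)
      along (_◅_ {ω} {ω₁} (1F , _ , same) r) = trans (Keep₁.compare N ω ω₁ same i) (along r)
      along (_◅_ {ω} {ω₁} (2F , _ , same) r) = trans (Keep₂.compare N ω ω₁ same i) (along r)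

    represented : ¬ ¬ (∃[ y ] GivenBy c y)
    represented none with ω₁ , ω₂ , same , _ ← forkedWalks m (≢-sym 0≢1) (≢-sym 0≢1) (≢-sym 0≢2) =
      rep (Section.restricted ω₁ ω₂ same) λ (y , y∈ , const) → none (y , W⊆W′ y∈ , λ y∼e proper proper′ →
        trans (follows ω₁ ω₂ same proper _) (trans (const y∼e (proper-shrink proper) (proper-shrink proper′))
          (sym (follows ω₁ ω₂ same proper′ _))))
      where
      follows : ∀ ω₁ ω₂ same {γ} → Proper W′ γ → ∀ i → value c γ i ≡ value (Section.restricted ω₁ ω₂ same) γ i
      follows ω₁ ω₂ same {γ} proper i = trans (proj₂ (proj₂ (from-C proper i))) (case (kind N) N (proj₁ (from-C proper i)))
        where
        open Section ω₁ ω₂ same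
        N : Normal (normalised γ) (π γ (γ hᵛ))
        N = normal (proper-shrink proper)
        case : ∀ {b} → b ≡ 1F ⊎ b ≡ 2F → Normal (normalised γ) b → (ω : Walk 1F b len) → C (normalised γ) ω (π γ i) ≡ Cˢ (normalised γ) (π γ i)
        case (inj₁ refl) N ω = trans (straight₁ N ω ω₁ _) (sym (Cˢ₁ N _))
        case (inj₂ refl) N ω = trans (straight₂ N ω ω₂ _) (sym (Cˢ₂ N _))

  module TwistedCase (weak : WeaklyConnected W hᵘ hᵛ) where
    swap₀₁ : Colour → Colour
    swap₀₁ 0F = 1F
    swap₀₁ 1F = 0F
    swap₀₁ 2F = 2F

    swap₀₁-involutive : ∀ i → swap₀₁ (swap₀₁ i) ≡ i
    swap₀₁-involutive 0F = refl
    swap₀₁-involutive 1F = refl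
    swap₀₁-involutive 2F = refl

    swap₀₁-inj : Injective₃ swap₀₁
    swap₀₁-inj {i} {j} eq = trans (sym (swap₀₁-involutive i)) (trans (cong swap₀₁ eq) (swap₀₁-involutive j))

    Special : Edge → Set
    Special g = g ≡ e ⊎ g ≡ hᵘ ⊎ g ≡ hᵛ

    special? : ∀ g → Dec (Special g)
    special? g = (g ≟ e) ⊎-dec ((g ≟ hᵘ) ⊎-dec (g ≟ hᵛ))

    -- Exchange the colours 0 and 1 outside the digon that e would form with hᵘ and hᵛ joined.
    σ : EdgeColouring → EdgeColouring
    σ γ g with special? g
    ... | yes _ = γ g
    ... | no _  = swap₀₁ (γ g)

    σ-special : ∀ γ {g} → Special g → σ γ g ≡ γ g
    σ-special γ {g} sp with special? g
    ... | yes _ = refl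
    ... | no ¬p = ⊥-elim (¬p sp)

    σ-other : ∀ γ {g} → ¬ Special g → σ γ g ≡ swap₀₁ (γ g)
    σ-other γ {g} ¬sp with special? g
    ... | yes p = ⊥-elim (¬sp p)
    ... | no _  = refl

    special-end : ∀ {g z} → Special g → z ∈ W → z ∼ g → z ≡ u ⊎ z ≡ v
    special-end (inj₁ refl)        z∈ z∼g = ends-two u∼e v∼e z∼g u≢v
    special-end (inj₂ (inj₁ refl)) z∈ z∼g = inj₁ (first-only z∈ z∼g)
    special-end (inj₂ (inj₂ refl)) z∈ z∼g = inj₂ (last-only z∈ z∼g)

    module _ {γ : EdgeColouring} (N : Normal γ 1F) where
      open Normal N

      special≢2 : ∀ {g} → Special g → γ g ≢ 2F
      special≢2 (inj₁ refl)        eq = 0≢2 (trans (sym at-e) eq)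
      special≢2 (inj₂ (inj₁ refl)) eq = 1≢2 (trans (sym at-hᵘ) eq)
      special≢2 (inj₂ (inj₂ refl)) eq = 1≢2 (trans (sym at-hᵛ) eq)

      beside-special : ∀ {f g z} → z ∈ W → z ∼ f → z ∼ g → Special f → ¬ Special g → γ g ≡ 2F
      beside-special {g = g} z∈ z∼f z∼g sp ¬sp with special-end sp z∈ z∼f
      ... | inj₁ refl = remaining-colour 0F 1F 2F (γ g) 0≢1 0≢2 1≢2
        (λ eq → proper z∈ z∼g u∼e (λ g≡e → ¬sp (inj₁ g≡e)) (trans eq (sym at-e)))
        (λ eq → proper z∈ z∼g u∼x (λ g≡h → ¬sp (inj₂ (inj₁ g≡h))) (trans eq (sym at-hᵘ)))
      ... | inj₂ refl = remaining-colour 0F 1F 2F (γ g) 0≢1 0≢2 1≢2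
        (λ eq → proper z∈ z∼g v∼e (λ g≡e → ¬sp (inj₁ g≡e)) (trans eq (sym at-e)))
        (λ eq → proper z∈ z∼g v∼x (λ g≡h → ¬sp (inj₂ (inj₂ g≡h))) (trans eq (sym at-hᵛ)))

      mixed-≢ : ∀ {f g z} → z ∈ W → z ∼ f → z ∼ g → Special f → ¬ Special g → γ f ≢ swap₀₁ (γ g)
      mixed-≢ z∈ z∼f z∼g sp ¬sp eq = special≢2 sp (trans eq (cong swap₀₁ (beside-special z∈ z∼f z∼g sp ¬sp)))

      σ-normal : Normal (σ γ) 1F
      σ-normal = record
        { proper = σ-proper ; at-e = trans (σ-special γ (inj₁ refl)) at-e
        ; at-hᵘ = trans (σ-special γ (inj₂ (inj₁ refl))) at-hᵘ ; at-hᵛ = trans (σ-special γ (inj₂ (inj₂ refl))) at-hᵛ }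
        where
        σ-proper : Proper W (σ γ)
        σ-proper {a = f} {g} z∈ z∼f z∼g f≢g with special? f | special? g
        ... | yes _ | yes _ = proper z∈ z∼f z∼g f≢g
        ... | yes p | no q  = mixed-≢ z∈ z∼f z∼g p q
        ... | no p  | yes q = ≢-sym (mixed-≢ z∈ z∼g z∼f q p)
        ... | no _  | no _  = ≢⇒≢ swap₀₁-inj (proper z∈ z∼f z∼g f≢g)

      σ-share : Share W γ 2F (σ γ) 2F
      σ-share {g} _ with special? g
      ... | yes _ = id , id
      ... | no _  = cong swap₀₁ , λ eq → swap₀₁-inj eq

    σ-share-swap : ∀ {γ γ′ i} → Normal γ 1F → Normal γ′ 1F → Share W γ i γ′ i → Share W (σ γ) (swap₀₁ i) (σ γ′) (swap₀₁ i)
    σ-share-swap {γ} {γ′} N N′ share {g} g∈ with special? g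
    ... | no _  = (λ eq → cong swap₀₁ (proj₁ (share g∈) (swap₀₁-inj eq))) , (λ eq → cong swap₀₁ (proj₂ (share g∈) (swap₀₁-inj eq)))
    ... | yes p = trans (sym (same p)) , trans (same p)
      where
      same : Special g → γ g ≡ γ′ g
      same (inj₁ refl)        = trans (Normal.at-e N) (sym (Normal.at-e N′))
      same (inj₂ (inj₁ refl)) = trans (Normal.at-hᵘ N) (sym (Normal.at-hᵘ N′))
      same (inj₂ (inj₂ refl)) = trans (Normal.at-hᵛ N) (sym (Normal.at-hᵛ N′))

    -- Sharing the class of one of 0 and 1 reduces by σ to sharing those of 2 and of the other.
    weak-normal : ∀ z → z ≢ 2F → (V : EdgeColouring → Set) →
      (∀ {γ γ′ i} → Normal γ 1F → Normal γ′ 1F → i ≢ z → Share W γ i γ′ i → V γ → V γ′) →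
      ∀ {γ γ′} → Normal γ 1F → Normal γ′ 1F → V γ → V γ′
    weak-normal z z≢2 V closed {γ} {γ′} N N′ Vγ =
      closed (normalised-normal N′) N′ (≢-sym z≢2) (share-sym {γ = γ′} (agree⇒share 2F (agree-normalised N′)))
        (weak (V ∘ normalised) any-share (Normal.proper N) (Normal.proper N′)
          (trans (Normal.at-hᵘ N) (sym (Normal.at-hᵛ N))) (trans (Normal.at-hᵘ N′) (sym (Normal.at-hᵛ N′)))
          (closed N (normalised-normal N) (≢-sym z≢2) (agree⇒share 2F (agree-normalised N)) Vγ))
      where
      share-any : ∀ {γ γ′ i} → Normal γ 1F → Normal γ′ 1F → Share W γ i γ′ i → V γ → V γ′
      share-any {γ} {γ′} {i} N N′ share Vγ with i ≟ᶜ z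
      ... | no i≢z   = closed N N′ i≢z share Vγ
      ... | yes refl = closed (σ-normal N′) N′ (≢-sym z≢2) (share-sym {γ = γ′} (σ-share N′))
        (closed (σ-normal N) (σ-normal N′) (moved z z≢2) (σ-share-swap N N′ share)
          (closed N (σ-normal N) (≢-sym z≢2) (σ-share N) Vγ))
        where
        moved : ∀ z → z ≢ 2F → swap₀₁ z ≢ z
        moved 0F _   ()
        moved 1F _   ()
        moved 2F z≢2 _ = z≢2 refl
      normal₁ : ∀ {γ} → Proper W γ → γ hᵘ ≡ γ hᵛ → Normal (normalised γ) 1F
      normal₁ {γ} proper eq = subst (Normal (normalised γ)) (trans (cong (π γ) (sym eq)) (norm-q (γe≢γhᵘ proper))) (normal proper)
      any-share : ∀ {γ γ′ i j} → Proper W γ → Proper W γ′ → γ hᵘ ≡ γ hᵛ → γ′ hᵘ ≡ γ′ hᵛ → Share W γ i γ′ j →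
              V (normalised γ) → V (normalised γ′)
      any-share {γ} {γ′} proper proper′ eq eq′ share = share-any (normal₁ proper eq) (normal₁ proper′ eq′) (normalised-share {γ} {γ′} proper proper′ share)

    RowConstant : ∀ {b} → Walk 1F b len → Set
    RowConstant {b} ω = ∀ {γ γ′} → Normal γ b → Normal γ′ b → ∀ i → C γ ω i ≡ C γ′ ω i

    -- When two colourings share a class other than that of `z`, their values for `ω′` agree there;
    -- at `z` they agree because `ω` has the same values. Weak connectivity reaches all colourings
    -- in this way.
    row-move : ∀ {ω ω′ : Walk 1F 1F len} z → z ≢ 2F → Same z ω ω′ → RowConstant ω → RowConstant ω′
    row-move {ω} {ω′} z z≢2 same row {γ} {γ′} N N′ = weak-normal z z≢2 (λ δ → ∀ i → C γ ω′ i ≡ C δ ω′ i) closed N N′ (λ _ → refl)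
      where
      closed : ∀ {δ δ′ i} → Normal δ 1F → Normal δ′ 1F → i ≢ z → Share W δ i δ′ i →
               (∀ i → C γ ω′ i ≡ C δ ω′ i) → ∀ i → C γ ω′ i ≡ C δ′ ω′ i
      closed M M′ i≢z share V k = trans (V k) (agree₃ (C-inj M ω′) (C-inj M′ ω′) i≢z (C-γ M M′ ω′ share)
        (trans (sym (C-ω M M ω ω′ same)) (trans (row M M′ z) (C-ω M′ M′ ω ω′ same))) k)

    -- The values for `ω` and `ω′` agree at `z` and differ at every other colour `i`. After a step
    -- that shares the class of `i`, these two different values persist, and the common value at `z`
    -- must be the remaining colour.
    first-row : ∀ {γ} → Normal γ 1F → (ω ω′ : Walk 1F 1F len) → ∀ z → z ≢ 2F → Same z ω ω′ → C γ ω 2F ≢ C γ ω′ 2F → RowConstant ω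
    first-row {γ₀} N₀ ω ω′ z z≢2 same neq N N′ i = trans (sym (proj₁ (reached N) i)) (proj₁ (reached N′) i)
      where
      V : EdgeColouring → Set
      V δ = (∀ i → C γ₀ ω i ≡ C δ ω i) × (∀ i → C γ₀ ω′ i ≡ C δ ω′ i)
      differ : ∀ {i} → i ≢ z → C γ₀ ω i ≢ C γ₀ ω′ i
      differ i≢z eq = neq (agree₃ (C-inj N₀ ω) (C-inj N₀ ω′) i≢z eq (C-ω N₀ N₀ ω ω′ same) 2F)
      closed : ∀ {δ δ′ i} → Normal δ 1F → Normal δ′ 1F → i ≢ z → Share W δ i δ′ i → V δ → V δ′
      closed {δ} {δ′} {i} M M′ i≢z share (V₁ , V₂) =
        agree₃ (C-inj N₀ ω) (C-inj M′ ω) i≢z at-i (sym at-z) ,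
        agree₃ (C-inj N₀ ω′) (C-inj M′ ω′) i≢z at-i′
          (trans (sym (C-ω N₀ N₀ ω ω′ same)) (trans (sym at-z) (C-ω M′ M′ ω ω′ same)))
        where
        at-i : C γ₀ ω i ≡ C δ′ ω i
        at-i = trans (V₁ i) (C-γ M M′ ω share)
        at-i′ : C γ₀ ω′ i ≡ C δ′ ω′ i
        at-i′ = trans (V₂ i) (C-γ M M′ ω′ share)
        at-z : C δ′ ω z ≡ C γ₀ ω z
        at-z = remaining-colour (C γ₀ ω i) (C γ₀ ω′ i) (C γ₀ ω z) (C δ′ ω z) (differ i≢z)
          (≢⇒≢ (C-inj N₀ ω) i≢z)
          (λ eq → ≢⇒≢ (C-inj N₀ ω′) i≢z (trans eq (C-ω N₀ N₀ ω ω′ same)))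
          (λ eq → ≢⇒≢ (C-inj M′ ω) (≢-sym i≢z) (trans eq at-i))
          (λ eq → ≢⇒≢ (C-inj M′ ω′) (≢-sym i≢z) (trans (sym (C-ω M′ M′ ω ω′ same)) (trans eq at-i′)))
      reached : ∀ {γ} → Normal γ 1F → V γ
      reached N = weak-normal z z≢2 V closed N₀ N ((λ _ → refl) , (λ _ → refl))

    -- A failure of `Straight 1F` along a single move; since the walks are connected by moves, every
    -- failure implies one of this form.
    Twist : Set
    Twist = ∃[ γ ] Normal γ 1F × Σ[ ω ∈ Walk 1F 1F len ] Σ[ ω′ ∈ Walk 1F 1F len ] ∃[ z ]
            z ≢ 2F × Same z ω ω′ × C γ ω 2F ≢ C γ ω′ 2F

    untwisted⇒straight : ¬ Twist → Straight 1F
    untwisted⇒straight none {γ} N ω ω′ i = along (connect len 1≢2 1≢2 ω ω′)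
      where
      along : ∀ {ω ω′} → Star (Move 2F) ω ω′ → C γ ω i ≡ C γ ω′ i
      along ε = refl
      along (_◅_ {ω} {ω₁} (z , z≢2 , same) r) = trans
        (agree₃ (C-inj N ω) (C-inj N ω₁) z≢2 (C-ω N N ω ω₁ same)
          (decidable-stable (C γ ω 2F ≟ᶜ C γ ω₁ 2F) λ neq → none (γ , N , ω , ω₁ , z , z≢2 , same , neq)) i)
        (along r)

    module Twisted (twist : Twist) where
      rows₁ : (ω : Walk 1F 1F len) → RowConstant ω
      rows₁ ω = start twist
        where
        along : ∀ {ω ω′ : Walk 1F 1F len} → Star (Move 2F) ω ω′ → RowConstant ω → RowConstant ω′
        along ε row = row
        along (_◅_ {ω} {ω₁} (z , z≢2 , same) r) row = along r (row-move {ω} {ω₁} z z≢2 same row)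
        start : Twist → RowConstant ω
        start (γ , N , ω₀ , ω₁ , z , z≢2 , same , neq) =
          along (connect len 1≢2 1≢2 ω₀ ω) (first-row N ω₀ ω₁ z z≢2 same neq)

      -- Suppose that the values vary. A vertex representing the section is neither `u` nor `v`, as
      -- each of these sees two edges with fixed colours. Hence `σ` turns its edge of colour 0 into
      -- one of colour 1; since `σ` does not affect the values for `ω₁`, those at 0 and 1 would
      -- coincide.
      rows₂-has : (ω : Walk 1F 2F len) → Has 0F ω → RowConstant ω
      rows₂-has ω has {γ} {γ′} N N′ i with ω₁ , same ← retarget (≢-sym 0≢2) (≢-sym 0≢1) ω has =
        decidable-stable (C γ ω i ≟ᶜ C γ′ ω i) λ neq → rep restricted λ (z , z∈ , const) →
          let at-edge : ∀ {g j} → z ∼ g → γ g ≡ j → γ′ g ≡ j → C γ ω j ≡ C γ′ ω j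
              at-edge {g} {j} z∼g γg γ′g = trans (sym (value₂ N j)) (trans (cong (value restricted γ) (sym γg))
                (trans (const z∼g (Normal.proper N) (Normal.proper N′)) (trans (cong (value restricted γ′) γ′g) (value₂ N′ j))))
              z≢u : z ≢ u
              z≢u z≡u = neq (agree₃ (C-inj N ω) (C-inj N′ ω) 0≢1
                (at-edge (subst (_∼ e) (sym z≡u) u∼e) (Normal.at-e N) (Normal.at-e N′))
                (at-edge (subst (_∼ hᵘ) (sym z≡u) u∼x) (Normal.at-hᵘ N) (Normal.at-hᵘ N′)) i)
              z≢v : z ≢ v
              z≢v z≡v = neq (agree₃ (C-inj N ω) (C-inj N′ ω) 0≢2
                (at-edge (subst (_∼ e) (sym z≡v) v∼e) (Normal.at-e N) (Normal.at-e N′))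
                (at-edge (subst (_∼ hᵛ) (sym z≡v) v∼x) (Normal.at-hᵛ N) (Normal.at-hᵛ N′)) i)
          in exists₁ sep λ (δ , M) →
            let (g , z∼g , δg) = hits (Normal.proper M) z∈ 0F
                ¬sp : ¬ Special g
                ¬sp sp = [ z≢u , z≢v ]′ (special-end sp z∈ z∼g)
            in 0≢1 (C-inj M ω₁ (trans (sym (value₁ M 0F)) (trans (cong (value restricted δ) (sym δg))
                 (trans (const z∼g (Normal.proper M) (Normal.proper (σ-normal M)))
                 (trans (cong (value restricted (σ δ)) (trans (σ-other δ ¬sp) (cong swap₀₁ δg)))
                 (trans (value₁ (σ-normal M) 1F) (rows₁ ω₁ (σ-normal M) M 1F)))))))
        where
        open Section ω₁ ω (same-sym {ω = ω} {ω₁} same)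
        value₁ : ∀ {δ} → Normal δ 1F → ∀ j → value restricted δ j ≡ C δ ω₁ j
        value₁ M j = trans (restricted-normal M j) (Cˢ₁ M j)
        value₂ : ∀ {δ} → Normal δ 2F → ∀ j → value restricted δ j ≡ C δ ω j
        value₂ M j = trans (restricted-normal M j) (Cˢ₂ M j)

      rows₂ : (ω : Walk 1F 2F len) → RowConstant ω
      rows₂ ω {γ} {γ′} N N′ with has? 0F ω
      ... | yes has = rows₂-has ω has N N′
      -- Inserting a 0 while keeping the class of 1, and again while keeping that of 2, reduces both
      -- values to walks that use 0.
      ... | no av with ω₁ , same₁ , has₁ ← insertKeepingStart ω av | ω₂ , same₂ , has₂ ← insertKeepingEnd 1≢2 ω av =
        agree₃ (C-inj N ω) (C-inj N′ ω) 1≢2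
          (trans (C-ω N N ω ω₁ same₁) (trans (rows₂-has ω₁ has₁ N N′ 1F) (sym (C-ω N′ N′ ω ω₁ same₁))))
          (trans (C-ω N N ω ω₂ same₂) (trans (rows₂-has ω₂ has₂ N N′ 2F) (sym (C-ω N′ N′ ω ω₂ same₂))))

      module _ {γ₁ γ₂} (N₁ : Normal γ₁ 1F) (N₂ : Normal γ₂ 2F) where
        -- Some colourings of the two kinds share the class of e, since otherwise their kind would be an invariant.
        linked : (ω₁ : Walk 1F 1F len) (ω₂ : Walk 1F 2F len) → Same 0F ω₁ ω₂ → C γ₁ ω₁ 0F ≡ C γ₂ ω₂ 0F
        linked ω₁ ω₂ same = decidable-stable (C γ₁ ω₁ 0F ≟ᶜ C γ₂ ω₂ 0F) λ neq →
          true≢false (trans (sym (T₁ N₁)) (trans (invariantᵘ T (closed neq) N₁ N₂) (T₂ N₂)))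
          where
          true≢false : true ≢ false
          true≢false ()
          T : EdgeColouring → Bool
          T γ = does (γ hᵛ ≟ᶜ 1F)
          T₁ : ∀ {γ} → Normal γ 1F → T γ ≡ true
          T₁ {γ} N with γ hᵛ ≟ᶜ 1F
          ... | yes _ = refl
          ... | no ¬p = ⊥-elim (¬p (Normal.at-hᵛ N))
          T₂ : ∀ {γ} → Normal γ 2F → T γ ≡ false
          T₂ {γ} N with γ hᵛ ≟ᶜ 1F
          ... | yes p = ⊥-elim (1≢2 (trans (sym p) (Normal.at-hᵛ N)))
          ... | no _  = refl
          meet : ∀ {γ γ′} → Normal γ 1F → Normal γ′ 2F → Share W γ 0F γ′ 0F → C γ₁ ω₁ 0F ≡ C γ₂ ω₂ 0F
          meet N N′ share = trans (rows₁ ω₁ N₁ N 0F) (trans (C-share N N′ ω₁ ω₂ share same) (rows₂ ω₂ N′ N₂ 0F))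
          closed : C γ₁ ω₁ 0F ≢ C γ₂ ω₂ 0F →
                   ∀ {γ γ′ b b′ i} → Normal γ b → Normal γ′ b′ → Share W γ i γ′ i → i ≢ γ hᵘ → T γ ≡ T γ′
          closed neq {γ} {γ′} N N′ share _ with kind N | kind N′
          ... | inj₁ refl | inj₁ refl = trans (T₁ N) (sym (T₁ N′))
          ... | inj₂ refl | inj₂ refl = trans (T₂ N) (sym (T₂ N′))
          ... | inj₁ refl | inj₂ refl with refl ← mixed⇒0 N N′ 1≢2 share = ⊥-elim (neq (meet N N′ share))
          ... | inj₂ refl | inj₁ refl with refl ← mixed⇒0 N N′ (≢-sym 1≢2) share = ⊥-elim (neq (meet N′ N (share-sym {γ = γ} share)))

        Ĉ : ∀ {b} → b ≡ 1F ⊎ b ≡ 2F → Walk 1F b len → Colour → Colour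
        Ĉ (inj₁ refl) ω = C γ₁ ω
        Ĉ (inj₂ refl) ω = C γ₂ ω

        last-colour : ∀ (i : Colour) → 1F ≡ i ⇆ 2F ≡ i → i ≡ 0F
        last-colour 0F _       = refl
        last-colour 1F (f , _) = ⊥-elim (1≢2 (sym (f refl)))
        last-colour 2F (_ , g) = ⊥-elim (1≢2 (g refl))

        Ĉ-share : ∀ {b b′ i} (k : b ≡ 1F ⊎ b ≡ 2F) (k′ : b′ ≡ 1F ⊎ b′ ≡ 2F) (ω : Walk 1F b len) (ω′ : Walk 1F b′ len) →
                  Same i ω ω′ → Ĉ k ω i ≡ Ĉ k′ ω′ i
        Ĉ-share (inj₁ refl) (inj₁ refl) ω ω′ same = C-ω N₁ N₁ ω ω′ same
        Ĉ-share (inj₂ refl) (inj₂ refl) ω ω′ same = C-ω N₂ N₂ ω ω′ same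
        Ĉ-share {i = i} (inj₁ refl) (inj₂ refl) ω ω′ same
          with refl ← last-colour i (subst₂ (λ a b → a ≡ i ⇆ b ≡ i) (at-last ω) (at-last ω′) (same (fromℕ len))) = linked ω ω′ same
        Ĉ-share k@(inj₂ refl) k′@(inj₁ refl) ω ω′ same = sym (Ĉ-share k′ k ω′ ω (same-sym {ω = ω} {ω′} same))

        kind-of : ∀ {b : Colour} → b ≢ 0F → b ≡ 1F ⊎ b ≡ 2F
        kind-of {0F} b≢0 = ⊥-elim (b≢0 refl)
        kind-of {1F} _   = inj₁ refl
        kind-of {2F} _   = inj₂ refl

        -- The colouring near `W` enters only through its kind, which the walk shows at its end.
        -- Appending the colour 0 of `e` turns the ear into a cycle.
        system : CycleSystem len 0F 1F
        system = record
          { value     = λ ω̂ → let (_ , b≢0 , ω , _) = unsnoc ω̂ in Ĉ (kind-of b≢0) ω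
          ; injective = λ ω̂ → let (_ , b≢0 , ω , _) = unsnoc ω̂ in Ĉ-inj (kind-of b≢0) ω
          ; shared    = λ {ω̂} {ω̂′} i same →
              let (_ , b≢0 , ω , eqs)    = unsnoc ω̂
                  (_ , b′≢0 , ω′ , eqs′) = unsnoc ω̂′
              in Ĉ-share (kind-of b≢0) (kind-of b′≢0) ω ω′ λ k →
                   subst₂ (λ a b → a ≡ i ⇆ b ≡ i) (eqs k) (eqs′ k) (same (inject₁ k)) }
          where
          Ĉ-inj : ∀ {b} (k : b ≡ 1F ⊎ b ≡ 2F) (ω : Walk 1F b len) → Injective₃ (Ĉ k ω)
          Ĉ-inj (inj₁ refl) ω = C-inj N₁ ω
          Ĉ-inj (inj₂ refl) ω = C-inj N₂ ω

        system-value : ∀ (ω̂ : Walk 1F 0F (suc len)) {b} (k : b ≡ 1F ⊎ b ≡ 2F) (ω : Walk 1F b len) →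
                       (∀ j → at ω̂ (inject₁ j) ≡ at ω j) → ∀ i → CycleSystem.value system ω̂ i ≡ Ĉ k ω i
        system-value ω̂ k ω eqs i = Ĉ-share (kind-of (proj₁ (proj₂ (unsnoc ω̂)))) k (proj₁ (proj₂ (proj₂ (unsnoc ω̂)))) ω λ j →
          subst (λ a → a ≡ i ⇆ at ω j ≡ i) (trans (sym (eqs j)) (proj₂ (proj₂ (proj₂ (unsnoc ω̂))) j)) keep

        -- The walk of colours of the edges x₀, …, e of the cycle in a colouring of W′.
        cycle-value : ∀ {γ} → Proper W′ γ → Σ[ ω̂ ∈ Walk 1F 0F (suc len) ]
          (∀ k → at ω̂ (inject₁ k) ≡ π γ (γ (x k))) × (∀ i → value c γ i ≡ CycleSystem.value system ω̂ (π γ i))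
        cycle-value {γ} proper = snoc ω (Normal.b≢0 N) , (λ k → trans (at-snoc ω (Normal.b≢0 N) k) (at-ω k)) , values
          where
          N : Normal (normalised γ) (π γ (γ hᵛ))
          N = normal (proper-shrink proper)
          ω : Walk 1F (π γ (γ hᵛ)) len
          ω = proj₁ (from-C proper 0F)
          at-ω : ∀ k → at ω k ≡ normalised γ (x k)
          at-ω = proj₁ (proj₂ (from-C proper 0F))
          to-Ĉ : ∀ {b} (k : b ≡ 1F ⊎ b ≡ 2F) → Normal (normalised γ) b → (ω : Walk 1F b len) → ∀ i → C (normalised γ) ω i ≡ Ĉ k ω i
          to-Ĉ (inj₁ refl) N ω = rows₁ ω N N₁
          to-Ĉ (inj₂ refl) N ω = rows₂ ω N N₂
          values : ∀ i → value c γ i ≡ CycleSystem.value system (snoc ω (Normal.b≢0 N)) (π γ i)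
          values i = trans eq (trans (to-Ĉ (kind N) N ω′ (π γ i)) (sym
              (system-value (snoc ω (Normal.b≢0 N)) (kind N) ω′ (λ k → trans (at-snoc ω (Normal.b≢0 N) k) (trans (at-ω k) (sym (at-ω′ k)))) (π γ i))))
            where
            ω′ : Walk 1F (π γ (γ hᵛ)) len
            ω′ = proj₁ (from-C proper i)
            at-ω′ : ∀ k → at ω′ k ≡ normalised γ (x k)
            at-ω′ = proj₁ (proj₂ (from-C proper i))
            eq : value c γ i ≡ C (normalised γ) ω′ (π γ i)
            eq = proj₂ (proj₂ (from-C proper i))

        represented : ∃[ z ] GivenBy c z
        represented with constant-or-pinned m (≢-sym 0≢1) system
        -- The prescribed consecutive edges of the cycle are `e` and `hᵘ`, with normalised colours 0
        -- and 1; they meet at `u`.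
        ... | inj₁ (A , const) = u , W⊆W′ u∈W , two-constant c (W⊆W′ u∈W) (proj₂ (thirdEdge u∼e u∼x e≢hᵘ))
              (λ proper proper′ → trans (at-A proper e (norm-p _ _)) (sym (at-A proper′ e (norm-p _ _))))
              (λ proper proper′ → trans (at-A proper hᵘ (norm-q (γe≢γhᵘ (proper-shrink proper))))
                                    (sym (at-A proper′ hᵘ (norm-q (γe≢γhᵘ (proper-shrink proper′))))))
          where
          at-A : ∀ {γ} → Proper W′ γ → ∀ g {i} → π γ (γ g) ≡ i → value c γ (γ g) ≡ A i
          at-A {γ} proper g refl with ω̂ , _ , values ← cycle-value proper = trans (values (γ g)) (const ω̂ _)
        ... | inj₂ (k , s , s′ , pin) = at-position (view k)
          where
          pinned : ∀ {γ} → Proper W′ γ → Σ[ ω̂ ∈ Walk 1F 0F (suc len) ] (∀ k → at ω̂ (inject₁ k) ≡ π γ (γ (x k))) ×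
                   (∀ {g} → at ω̂ (inject₁ k) ≡ π γ (γ g) → value c γ (γ g) ≡ s) × (∀ {g} → at ω̂ (suc k) ≡ π γ (γ g) → value c γ (γ g) ≡ s′)
          pinned proper with ω̂ , letters , values ← cycle-value proper = ω̂ , letters ,
            (λ eq → trans (values _) (trans (cong (CycleSystem.value system ω̂) (sym eq)) (proj₁ (pin ω̂)))) ,
            (λ eq → trans (values _) (trans (cong (CycleSystem.value system ω̂) (sym eq)) (proj₂ (pin ω̂))))
          first-edge : ∀ {γ} → Proper W′ γ → value c γ (γ (x k)) ≡ s
          first-edge proper with ω̂ , letters , at-k , _ ← pinned proper = at-k (letters k)
          const-x : Constant c (x k)
          const-x proper proper′ = trans (first-edge proper) (sym (first-edge proper′))
          -- The last position belongs to `hᵛ`, followed by `e`, which meet at `v`; any other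
          -- position belongs to two consecutive edges of the ear, which meet at an inner vertex.
          at-position : View k → ∃[ z ] GivenBy c z
          at-position ‵fromℕ = v , W⊆W′ v∈W , two-constant c (W⊆W′ v∈W) (proj₂ (thirdEdge v∼x v∼e (≢-sym e≢hᵛ)))
              const-x (λ proper proper′ → trans (second-edge proper) (sym (second-edge proper′)))
            where
            second-edge : ∀ {γ} → Proper W′ γ → value c γ (γ e) ≡ s′
            second-edge {γ} proper with ω̂ , _ , _ , at-k ← pinned proper =
              at-k (trans (at-last ω̂) (sym (norm-p (γ e) (γ hᵘ))))
          at-position (‵inject₁ j) = y j , y∈W′ j , two-constant c (y∈W′ j) (claw-y j)
              const-x (λ proper proper′ → trans (second-edge proper) (sym (second-edge proper′)))
            where
            second-edge : ∀ {γ} → Proper W′ γ → value c γ (γ (x (suc j))) ≡ s′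
            second-edge proper with ω̂ , letters , _ , at-k ← pinned proper = at-k (letters (suc j))

  represented : WeaklyConnected W hᵘ hᵛ → ¬ ¬ (∃[ y ] GivenBy c y)
  represented weak none = ¬¬-excluded-middle {A = Twist} λ where
      (no untwisted) → StraightCase.represented (untwisted⇒straight untwisted) none
      (yes twist)    → exists₁ sep λ (_ , N₁) → exists₂ sep λ (_ , N₂) → none (Twisted.represented twist N₁ N₂)
    where open TwistedCase weak

-- Connectivity of the colourings in which two edges have equal colours

module WeakConnectivity (G : CubicGraph) where
  open GraphKit G
  open Structure G
  open Colouring G

  module ByPendant {W W′ : VSet} (P : Pendant W W′) {f g : Edge} (f∈ : Inc W f) (g∈ : Inc W g) where
    open PendantStep G P
    open Pendant P

    fold : ∀ {γ} → Proper W′ γ → Share W′ γ (γ h) (γ ⁺) (γ h)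
    fold {γ} proper with shape proper
    ... | is-⁺ _ _ agree = agree⇒share (γ h) agree
    ... | is-⁻ _ _ agree = share-trans {γ = γ} {γ′ = γ ⁻} {γ″ = γ ⁺} (agree⇒share (γ h) agree)
      (off-share γ (≢-sym (h≢s old)) (≢-sym (h≢r old)) (≢-sym (h≢r old)) (≢-sym (h≢s old)))
      where
      old : Proper W γ
      old = proper-shrink proper

    step-up : WeaklyConnected W f g → WeaklyConnected W′ f g
    step-up weak V closed {γ} {γ′} proper proper′ eq eq′ Vγ =
      closed (⁺-proper (proper-shrink proper′)) proper′ (eq⁺ γ′ eq′) eq′ (share-sym {γ = γ′} {γ′ = γ′ ⁺} (fold proper′))
        (weak (V ∘ _⁺)
          (λ {δ} {δ′} p p′ q q′ share → closed (⁺-proper p) (⁺-proper p′) (eq⁺ δ q) (eq⁺ δ′ q′) (⁺-share {δ} {γ′ = δ′} share))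
          (proper-shrink proper) (proper-shrink proper′) eq eq′
          (closed proper (⁺-proper (proper-shrink proper)) eq (eq⁺ γ eq) (fold proper) Vγ))
      where
      eq⁺ : ∀ δ → δ f ≡ δ g → (δ ⁺) f ≡ (δ ⁺) g
      eq⁺ δ eq = trans (extend-old δ _ _ f∈) (trans eq (sym (extend-old δ _ _ g∈)))

  module ByEar {W W′ : VSet} (E : Ear W W′) {f g : Edge} (f∈ : Inc W f) (g∈ : Inc W g) where
    open EarStep G E
    open Ear E

    module _ (V : EdgeColouring → Set)
             (closed : ∀ {γ γ′ i j} → Proper W′ γ → Proper W′ γ′ → γ f ≡ γ g → γ′ f ≡ γ′ g → Share W′ γ i γ′ j → V γ → V γ′) where
      move : ∀ {δ δ′ b b′ i} → Normal δ b → Normal δ′ b′ → δ f ≡ δ g → δ′ f ≡ δ′ g → (ω : Walk 1F b len) (ω′ : Walk 1F b′ len) →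
             Share W δ i δ′ i → Same i ω ω′ → V (glue δ ω) → V (glue δ′ ω′)
      move N N′ eq eq′ ω ω′ share same = closed (glue-proper ω fits proper) (glue-proper ω′ fits′ proper′)
        (trans (glue-old ω fits f∈) (trans eq (sym (glue-old ω fits g∈))))
        (trans (glue-old ω′ fits′ f∈) (trans eq′ (sym (glue-old ω′ fits′ g∈))))
        (glue-share ω ω′ fits fits′ share same)
        where
        open Normal N
        open Normal N′ renaming (fits to fits′; proper to proper′) using ()

      fibre : ∀ {δ b} → Normal δ b → δ f ≡ δ g → (ω ω′ : Walk 1F b len) → V (glue δ ω) → V (glue δ ω′)
      fibre {δ} N eq ω ω′ = along (connect len (≢-sym 0≢1) (Normal.b≢0 N) ω ω′)
        where
        along : ∀ {ω ω′} → Star (Move 0F) ω ω′ → V (glue δ ω) → V (glue δ ω′)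
        along ε Vω = Vω
        along (_◅_ {ω} {ω₁} (i , _ , same) r) Vω = along r (move N N eq eq ω ω₁ (share-refl {γ = δ}) same Vω)

      -- Quantifying over all walks turns `V` into a predicate on colourings near `W`, to which weak
      -- connectivity of the smaller set applies.
      All : EdgeColouring → Set
      All γ = (ω : Walk 1F (π γ (γ hᵛ)) len) → V (glue (normalised γ) ω)

      all-closed : ∀ {γ γ′ i j} → Proper W γ → Proper W γ′ → γ f ≡ γ g → γ′ f ≡ γ′ g → Share W γ i γ′ j → All γ → All γ′
      all-closed {γ} {γ′} proper proper′ eq eq′ share all ω′ = across (normal proper) (normal proper′) all ω′
        where
        shareⁿ : Share W (normalised γ) _ (normalised γ′) _
        shareⁿ = normalised-share {γ} {γ′} proper proper′ share
        across : ∀ {b b′} → Normal (normalised γ) b → Normal (normalised γ′) b′ →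
                 ((ω : Walk 1F b len) → V (glue (normalised γ) ω)) → (ω : Walk 1F b′ len) → V (glue (normalised γ′) ω)
        across {b} {b′} N N′ all ω′ with b ≟ᶜ b′
        ... | yes refl = move N N′ (cong (π γ) eq) (cong (π γ′) eq′) ω′ ω′ shareⁿ (same-refl {ω = ω′}) (all ω′)
        -- For colourings of different kinds the common class is that of 0. A pair of forked walks
        -- shares it too, and `fibre` leads from there to the given walk.
        ... | no b≢b′ with σ , σ′ , same , _ ← forkedWalks m (≢-sym 0≢1) (Normal.b≢0 N) (Normal.b≢0 N′) =
          fibre N′ (cong (π γ′) eq′) σ′ ω′ (move N N′ (cong (π γ) eq) (cong (π γ′) eq′) σ σ′
            (subst (λ i → Share W (normalised γ) i (normalised γ′) i) (mixed⇒0 N N′ b≢b′ shareⁿ) shareⁿ) same (all σ))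

      module _ {γ : EdgeColouring} (proper : Proper W′ γ) (eq : γ f ≡ γ g) where
        private
          N : Normal (normalised γ) (π γ (γ hᵛ))
          N = normal (proper-shrink proper)
          properⁿ : Proper W′ (normalised γ)
          properⁿ = proper-relabel {W′} {γ} (π-inj (proper-shrink proper)) proper
          ω : Walk 1F (π γ (γ hᵛ)) len
          ω = proj₁ (read properⁿ (Normal.fits N))
          to-glued : Share W′ γ (γ f) (glue (normalised γ) ω) (π γ (γ f))
          to-glued = share-trans {γ = γ} {γ′ = normalised γ} {γ″ = glue (normalised γ) ω}
            (share-relabel {W′} {γ} (π-inj (proper-shrink proper)))
            (share-sym {γ = glue (normalised γ) ω} (agree⇒share (π γ (γ f)) (glue-read properⁿ (Normal.fits N))))
          eqᵍ : glue (normalised γ) ω f ≡ glue (normalised γ) ω g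
          eqᵍ = trans (glue-old ω (Normal.fits N) f∈) (trans (cong (π γ) eq) (sym (glue-old ω (Normal.fits N) g∈)))

        into : V γ → All γ
        into Vγ ω′ = fibre N (cong (π γ) eq) ω ω′ (closed proper (glue-proper ω (Normal.fits N) (Normal.proper N)) eq eqᵍ to-glued Vγ)

        out-of : All γ → V γ
        out-of all = closed (glue-proper ω (Normal.fits N) (Normal.proper N)) proper eqᵍ eq
          (share-sym {γ = γ} {γ′ = glue (normalised γ) ω} to-glued) (all ω)

    step-up : WeaklyConnected W f g → WeaklyConnected W′ f g
    step-up weak V closed proper proper′ eq eq′ Vγ = out-of V closed proper′ eq′
      (weak (All V closed) (all-closed V closed) (proper-shrink proper) (proper-shrink proper′) eq eq′ (into V closed proper eq Vγ))

  Inc-⊆ : ∀ {W W′ e} → W ⊆ W′ → Inc W e → Inc W′ e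
  Inc-⊆ W⊆ (z , z∈ , z∼e) = z , W⊆ z∈ , z∼e

  class-of-e : ∀ {B e γ γ′} → (∀ {z} → z ∈ B → z ∼ e) → Proper B γ → Proper B γ′ → Share B γ (γ e) γ′ (γ′ e)
  class-of-e {B} {e} {γ} {γ′} B∼e proper proper′ (z , z∈ , z∼g) =
    (λ eq → cong γ′ (only proper eq)) , (λ eq → cong γ (only proper′ eq))
    where
    only : ∀ {δ} → Proper B δ → δ _ ≡ δ e → _ ≡ e
    only proper eq = decidable-stable (_ ≟ _) λ g≢e → proper z∈ z∼g (B∼e z∈) g≢e eq

  -- In the base every vertex is an end of `e`, so the class of `e` consists of `e` alone there and
  -- is shared by any two colourings. Each extension preserves the connectivity.
  weaklyConnected : ∀ {B W e f g} → (∀ {z} → z ∈ B → z ∼ e) → Inc B f → Inc B g → Built B W → WeaklyConnected W f g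
  weaklyConnected B∼e f∈ g∈ base V closed {γ} {γ′} proper proper′ eq eq′ =
    closed proper proper′ eq eq′ (class-of-e {γ = γ} {γ′ = γ′} B∼e proper proper′)
  weaklyConnected B∼e f∈ g∈ (pendant b P) =
    ByPendant.step-up P (Inc-⊆ (built⊇ b) f∈) (Inc-⊆ (built⊇ b) g∈) (weaklyConnected B∼e f∈ g∈ b)
  weaklyConnected B∼e f∈ g∈ (ear b E) =
    ByEar.step-up E (Inc-⊆ (built⊇ b) f∈) (Inc-⊆ (built⊇ b) g∈) (weaklyConnected B∼e f∈ g∈ b)

-- Induction along the construction

module MainInduction (G : CubicGraph) (triangle-free : TriangleFree G) (noK₂₃ : GraphKit.NoK₂₃ G) where
  open GraphKit G
  open Structure G
  open BuildingUp G triangle-free noK₂₃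
  open Colouring G
  open ClassColouring
  open WeakConnectivity G

  ∈-single : ∀ {y z : Vertex} → z ∈ ⁅ y ⁆ → z ≡ y
  ∈-single {y} = x∈⁅y⁆⇒x≡y y

  single-colourable : ∀ y → Colourable ⁅ y ⁆
  single-colourable y with a , b , c , K ← claw y = γ , λ z∈ z∼f z∼g → injective-at (at-y z∈ z∼f) (at-y z∈ z∼g)
    where
    γ : EdgeColouring
    γ g with g ≟ a | g ≟ b
    ... | yes _ | _     = 0F
    ... | no _  | yes _ = 1F
    ... | no _  | no _  = 2F
    at-y : ∀ {z f} → z ∈ ⁅ y ⁆ → z ∼ f → y ∼ f
    at-y z∈ = subst (_∼ _) (∈-single z∈)
    is-c : ∀ {f} → y ∼ f → f ≢ a → f ≢ b → f ≡ c
    is-c y∼f f≢a f≢b = [ (λ eq → ⊥-elim (f≢a eq)) , [ (λ eq → ⊥-elim (f≢b eq)) , id ]′ ]′ (Claw.only K y∼f)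
    injective-at : ∀ {f g} → y ∼ f → y ∼ g → f ≢ g → γ f ≢ γ g
    injective-at {f} {g} y∼f y∼g f≢g with f ≟ a | f ≟ b | g ≟ a | g ≟ b
    ... | yes p | _     | yes q | _     = ⊥-elim (f≢g (trans p (sym q)))
    ... | yes _ | _     | no _  | yes _ = 0≢1
    ... | yes _ | _     | no _  | no _  = 0≢2
    ... | no _  | yes _ | yes _ | _     = ≢-sym 0≢1
    ... | no _  | yes p | no _  | yes q = ⊥-elim (f≢g (trans p (sym q)))
    ... | no _  | yes _ | no _  | no _  = 1≢2
    ... | no _  | no _  | yes _ | _     = ≢-sym 0≢2
    ... | no _  | no _  | no _  | yes _ = ≢-sym 1≢2
    ... | no p  | no p′ | no q  | no q′ = ⊥-elim (f≢g (trans (is-c y∼f p p′) (sym (is-c y∼g q q′))))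

  single-connected : ∀ y → ConnectedSet ⁅ y ⁆
  single-connected y a∈ b∈ with refl ← ∈-single a∈ | refl ← ∈-single b∈ = ε

  single⊆ : ∀ {U y} → y ∈ U → ⁅ y ⁆ ⊆ U
  single⊆ y∈ z∈ = subst (_∈ _) (sym (∈-single z∈)) y∈

  fromVertex : ∀ {U y} → ConnectedSet U → y ∈ U → ¬ ¬ Built ⁅ y ⁆ U
  fromVertex {U} {y} conn y∈ = Within.built U conn (x∈⁅x⁆ y) (single⊆ y∈)
    λ a∈ b∈ _ _ _ _ _ → inj₁ (trans (∈-single a∈) (sym (∈-single b∈)))

  fromEdge : ∀ {U u v} → ConnectedSet U → u ∈ U → v ∈ U → Adjacent u v → ¬ ¬ Built (⁅ u ⁆ ∪ ⁅ v ⁆) U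
  fromEdge {U} {u} {v} conn u∈ v∈ u~v = Within.built U conn (x∈p∪q⁺ (inj₁ (x∈⁅x⁆ u)))
      (λ z∈ → [ single⊆ u∈ , single⊆ v∈ ]′ (x∈p∪q⁻ ⁅ u ⁆ ⁅ v ⁆ z∈)) λ a∈ b∈ _ _ _ _ _ → pair (∈-pair a∈) (∈-pair b∈)
    where
    ∈-pair : ∀ {z} → z ∈ ⁅ u ⁆ ∪ ⁅ v ⁆ → z ≡ u ⊎ z ≡ v
    ∈-pair z∈ = [ inj₁ ∘ ∈-single , inj₂ ∘ ∈-single ]′ (x∈p∪q⁻ ⁅ u ⁆ ⁅ v ⁆ z∈)
    pair : ∀ {a b} → a ≡ u ⊎ a ≡ v → b ≡ u ⊎ b ≡ v → a ≡ b ⊎ Adjacent a b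
    pair (inj₁ refl) (inj₁ refl) = inj₁ refl
    pair (inj₁ refl) (inj₂ refl) = inj₂ u~v
    pair (inj₂ refl) (inj₁ refl) = inj₂ (adj-sym u~v)
    pair (inj₂ refl) (inj₂ refl) = inj₁ refl

  colourable-built : ∀ {y W} → Built ⁅ y ⁆ W → Colourable W
  colourable-built base          = single-colourable _
  colourable-built (pendant b P) = PendantStep.colourable G P (colourable-built b)
  colourable-built (ear b E)     = EarStep.colourable G E (colourable-built b)

  single-represented : ∀ y (c : ClassColouring ⁅ y ⁆) → GivenBy c y
  single-represented y c = x∈⁅x⁆ y , λ {e} y∼e {γ} {γ′} proper proper′ → shared c proper proper′
    (class-of-e {⁅ y ⁆} {e} {γ} {γ′} (λ z∈ → subst (_∼ e) (sym (∈-single z∈)) y∼e) proper proper′)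

  -- The set is built up from an end of `e`, so that `e` is old in the last step and only `f` can be
  -- new. The recursion is on the size, since for other edges the smaller set is built up from other
  -- vertices.
  separated : ∀ n {U} → ∣ U ∣ < n → ConnectedSet U → Separated U
  separated (suc n) {U} (s≤s U≤) conn {e} {f} (y , y∈ , y∼e) f∈ e≢f none = fromVertex conn y∈ λ b → last-step b U≤ f∈ none
    where
    last-step : ∀ {W} → Built ⁅ y ⁆ W → ∣ W ∣ ≤ n → Inc W f → ¬ ¬ (∃[ γ ] Proper W γ × γ e ≢ γ f)
    last-step base _ (z , z∈ , z∼f) none with γ , proper ← single-colourable y =
      none (γ , (λ {v} {a} {b} → proper {v} {a} {b}) , proper (x∈⁅x⁆ y) y∼e (subst (_∼ f) (∈-single z∈) z∼f) e≢f)
    last-step (pendant b P) W≤ f∈ = PendantStep.separated G P (colourable-built b)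
      (separated n (ℕₚ.<-≤-trans (pendant⊂ P) W≤) (built-connected (single-connected y) b))
      (y , built⊇ b (x∈⁅x⁆ y) , y∼e) f∈ e≢f
    last-step (ear b E) W≤ f∈ = EarStep.separated G E
      (separated n (ℕₚ.<-≤-trans (ear⊂ E) W≤) (built-connected (single-connected y) b))
      (y , built⊇ b (x∈⁅x⁆ y) , y∼e) f∈ e≢f

  separated′ : ∀ {U} → ConnectedSet U → Separated U
  separated′ {U} = separated (suc ∣ U ∣) ℕₚ.≤-refl

  -- At an ear the smaller set is built up once more, from the two ends of the edge below the ear;
  -- this supplies the weak connectivity.
  represented : ∀ {y W} → Built ⁅ y ⁆ W → Represented W
  represented base c none = none (_ , single-represented _ c)
  represented {y} (pendant b P) c =
    PendantStep.represented G P (represented b) (separated′ (built-connected (single-connected y) b)) c (colourable-built b)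
  represented {root} (ear {W} b E) c none = fromEdge connW u∈W v∈W (adjacent u≢v u∼e v∼e) λ b′ →
      EarRepresented.represented G E (represented b) (separated′ connW) c
        (weaklyConnected (λ z∈ → [ (λ z∈u → subst (_∼ e) (sym (∈-single z∈u)) u∼e) , (λ z∈v → subst (_∼ e) (sym (∈-single z∈v)) v∼e) ]′
                            (x∈p∪q⁻ ⁅ u ⁆ ⁅ v ⁆ z∈))
          (u , x∈p∪q⁺ (inj₁ (x∈⁅x⁆ u)) , u∼x) (v , x∈p∪q⁺ (inj₂ (x∈⁅x⁆ v)) , v∼x) b′) none
    where
    open Ear E
    connW : ConnectedSet W
    connW = built-connected (single-connected root) b

-- The 3-colouring complex

allSubsets-complete : ∀ {n} (p : Subset n) → p ∈ᴸ allSubsets n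
allSubsets-complete []            = Any.here refl
allSubsets-complete (outside ∷ p) = ∈-++⁺ˡ (∈-map⁺ (outside ∷_) (allSubsets-complete p))
allSubsets-complete (inside ∷ p)  = ∈-++⁺ʳ _ (∈-map⁺ (inside ∷_) (allSubsets-complete p))

allSubsets-unique : ∀ n → Unique (allSubsets n)
allSubsets-unique zero    = All.[] ∷ []
allSubsets-unique (suc n) = Uniqueₚ.++⁺ (Uniqueₚ.map⁺ (λ { refl → refl }) (allSubsets-unique n))
  (Uniqueₚ.map⁺ (λ { refl → refl }) (allSubsets-unique n)) disjoint
  where
  disjoint : ∀ {p : Subset (suc n)} → ¬ (p ∈ᴸ Data.List.Base.map (outside ∷_) (allSubsets n) × p ∈ᴸ Data.List.Base.map (inside ∷_) (allSubsets n))
  disjoint (p∈ , q∈) with ∈-map⁻ (outside ∷_) p∈ | ∈-map⁻ (inside ∷_) q∈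
  ... | _ , _ , refl | _ , _ , ()

lookup-injective : ∀ {A : Set} {xs : List A} → Unique xs → ∀ {i j} → lookupᴸ xs i ≡ lookupᴸ xs j → i ≡ j
lookup-injective (_ ∷ _)  {zero}  {zero}  _  = refl
lookup-injective (x∉ ∷ _) {zero}  {suc j} eq = ⊥-elim (All.lookup x∉ (∈-lookup j) eq)
lookup-injective (x∉ ∷ _) {suc i} {zero}  eq = ⊥-elim (All.lookup x∉ (∈-lookup i) (sym eq))
lookup-injective (_ ∷ u)  {suc i} {suc j} eq = cong suc (lookup-injective u eq)

module ColouringComplex (X : Graph) where
  abstract
    class-injective : ∀ {k l} → class X k ≡ class X l → k ≡ l
    class-injective = lookup-injective (Uniqueₚ.filter⁺ (colorClass? X) (allSubsets-unique (order X)))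

    classOf : ∀ k → ColorClass X (class X k)
    classOf k = proj₂ (∈-filter⁻ (colorClass? X) {xs = allSubsets (order X)} (∈-lookup k))

    indexOf : ∀ {C} → ColorClass X C → ∃[ k ] class X k ≡ C
    indexOf {C} cc = Any.index C∈ , sym (lookup-index C∈)
      where
      C∈ : C ∈ᴸ colorClasses X
      C∈ = ∈-filter⁺ (colorClass? X) (allSubsets-complete C) cc

  ∈φ⁺ : ∀ {k v} → v ∈ class X k → k ∈ φ X v
  ∈φ⁺ {k} {v} v∈ = lookup⇒[]= k (φ X v) (trans (lookup∘tabulate _ k) ([]=⇒lookup v∈))

  ∈φ⁻ : ∀ {k v} → k ∈ φ X v → v ∈ class X k
  ∈φ⁻ {k} {v} k∈ = lookup⇒[]= v (class X k) (trans (sym (lookup∘tabulate _ k)) ([]=⇒lookup k∈))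

  ProperColouring : (Fin (order X) → Colour) → Set
  ProperColouring h = ∀ {u v} → Adj X u v → h u ≢ h v

  fibre : (Fin (order X) → Colour) → Colour → VertexSet X
  fibre h i = ⟦ (λ v → h v ≟ᶜ i) ⟧

  ∈fibre : ∀ h {i v} → h v ≡ i → v ∈ fibre h i
  ∈fibre h {i} = ∈⟦⟧⁺ (λ v → h v ≟ᶜ i)

  fibre∈ : ∀ h {i v} → v ∈ fibre h i → h v ≡ i
  fibre∈ h {i} = ∈⟦⟧⁻ (λ v → h v ≟ᶜ i)

  fibres-coloring : ∀ {h i j k} → ProperColouring h → i ≢ j → i ≢ k → j ≢ k → IsColoring X (fibre h i) (fibre h j) (fibre h k)
  fibres-coloring {h} {i} {j} {k} proper i≢j i≢k j≢k =
    coloring independent independent independent (disjoint i≢j) (disjoint i≢k) (disjoint j≢k) (⊆-antisym ⊆⊤ λ {v} _ → covers v)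
    where
    independent : ∀ {i} → Independent X (fibre h i)
    independent u v u∈ v∈ adj = proper adj (trans (fibre∈ h u∈) (sym (fibre∈ h v∈)))
    disjoint : ∀ {i j} → i ≢ j → Empty (fibre h i ∩ fibre h j)
    disjoint {i} {j} i≢j (v , v∈) = i≢j (trans (sym (fibre∈ h (proj₁ (x∈p∩q⁻ (fibre h i) _ v∈)))) (fibre∈ h (proj₂ (x∈p∩q⁻ (fibre h i) _ v∈))))
    covers : ∀ v → v ∈ fibre h i ∪ fibre h j ∪ fibre h k
    covers v with h v ≟ᶜ i | h v ≟ᶜ j
    ... | yes p | _     = x∈p∪q⁺ (inj₁ (∈fibre h p))
    ... | no _  | yes q = x∈p∪q⁺ (inj₂ (x∈p∪q⁺ (inj₁ (∈fibre h q))))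
    ... | no p  | no q  = x∈p∪q⁺ (inj₂ (x∈p∪q⁺ (inj₂ (∈fibre h (remaining-colour i j k (h v) i≢j i≢k j≢k p q)))))

  fibre-class : ∀ {h} → ProperColouring h → ∀ i → ColorClass X (fibre h i)
  fibre-class {h} proper i = fibre h (third i i) , fibre h (third i (third i i)) , fibres-coloring {h} proper
    (≢-sym (third≢ˡ i i)) (≢-sym (third≢ˡ i (third i i))) (≢-sym (third≢ʳ i (third i i)))

  module _ {C D E} (col : IsColoring X C D E) where
    open IsColoring col

    toColour : Fin (order X) → Colour
    toColour v with v ∈? C | v ∈? D
    ... | yes _ | _     = 0F
    ... | no _  | yes _ = 1F
    ... | no _  | no _  = 2F

    toColour-C : ∀ {v} → v ∈ C ⇆ toColour v ≡ 0F
    toColour-C {v} with v ∈? C | v ∈? D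
    ... | yes p | _     = (λ _ → refl) , (λ _ → p)
    ... | no p  | yes _ = (λ v∈ → ⊥-elim (p v∈)) , λ ()
    ... | no p  | no _  = (λ v∈ → ⊥-elim (p v∈)) , λ ()

    toColour-D : ∀ {v} → v ∈ D ⇆ toColour v ≡ 1F
    toColour-D {v} with v ∈? C | v ∈? D
    ... | yes p | _     = (λ v∈ → ⊥-elim (disj₁₂ (v , x∈p∩q⁺ (p , v∈)))) , λ ()
    ... | no _  | yes q = (λ _ → refl) , (λ _ → q)
    ... | no _  | no q  = (λ v∈ → ⊥-elim (q v∈)) , λ ()

    toColour-proper : ProperColouring toColour
    toColour-proper {u} {v} adj eq with u ∈? C | u ∈? D | v ∈? C | v ∈? D
    ... | yes p | _     | yes q | _     = indep₁ u v p q adj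
    ... | no _  | yes p | no _  | yes q = indep₂ u v p q adj
    ... | no p  | no p′ | no q  | no q′ = indep₃ u v (in-E u p p′) (in-E v q q′) adj
      where
      in-E : ∀ w → w ∉ C → w ∉ D → w ∈ E
      in-E w w∉C w∉D = [ ⊥-elim ∘ w∉C , [ ⊥-elim ∘ w∉D , id ]′ ∘ x∈p∪q⁻ D E ]′
        (x∈p∪q⁻ C (D ∪ E) (subst (w ∈_) (sym cover) ∈⊤))
    ... | yes _ | _     | no _  | yes _ = 0≢1 eq
    ... | yes _ | _     | no _  | no _  = 0≢2 eq
    ... | no _  | yes _ | yes _ | _     = 0≢1 (sym eq)
    ... | no _  | yes _ | no _  | no _  = 1≢2 eq
    ... | no _  | no _  | yes _ | _     = 0≢2 (sym eq)
    ... | no _  | no _  | no _  | yes _ = 1≢2 (sym eq)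

  record AsFibre (C : VertexSet X) : Set where
    field
      colour   : Fin (order X) → Colour
      proper   : ProperColouring colour
      ∈⇆0      : ∀ {v} → v ∈ C ⇆ colour v ≡ 0F
    ≡fibre : C ≡ fibre colour 0F
    ≡fibre = ⊆-antisym (λ v∈ → ∈fibre colour (proj₁ ∈⇆0 v∈)) (λ v∈ → proj₂ ∈⇆0 (fibre∈ colour v∈))

  abstract
    asFibre : ∀ k → AsFibre (class X k)
    asFibre k = from (classOf k)
      where
      from : ∀ {C} → ColorClass X C → AsFibre C
      from (_ , _ , col) = record { colour = toColour col ; proper = toColour-proper col ; ∈⇆0 = toColour-C col }

attains : ∀ {f} → Injective₃ f → ∀ s → ∃[ i ] f i ≡ s
attains {f} f-inj s with s ≟ᶜ f 0F | s ≟ᶜ f 1F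
... | yes p | _     = 0F , sym p
... | no _  | yes q = 1F , sym q
... | no p  | no q  = 2F , sym (remaining-colour (f 0F) (f 1F) (f 2F) s (≢⇒≢ f-inj 0≢1) (≢⇒≢ f-inj 0≢2) (≢⇒≢ f-inj 1≢2) p q)

-- The 3-colouring complex of a line graph

module LineGraph (G : CubicGraph) where
  open GraphKit G
  open Structure G
  open Colouring G
  open ColouringComplex (L G)

  proper⇒ : ∀ {γ} → Proper ⊤ γ → ProperColouring γ
  proper⇒ proper (e≢f , v , v∼e , v∼f) = proper ∈⊤ v∼e v∼f e≢f

  ⇒proper : ∀ {γ} → ProperColouring γ → Proper ⊤ γ
  ⇒proper proper _ v∼a v∼b a≢b = proper (a≢b , _ , v∼a , v∼b)

  someEnd : ∀ e → ∃[ v ] v ∼ e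
  someEnd e with arity e
  ... | inj₁ eq with E ← subst (Enumeration (ends e)) eq (enumerate (ends e)) = Enumeration.elem E 0F , Enumeration.elem∈ E 0F
  ... | inj₂ eq with E ← subst (Enumeration (ends e)) eq (enumerate (ends e)) = Enumeration.elem E 0F , Enumeration.elem∈ E 0F

  Inc-⊤ : ∀ e → Inc ⊤ e
  Inc-⊤ e = proj₁ (someEnd e) , ∈⊤ , proj₂ (someEnd e)

  -- Each class of a 3-edge-colouring contains exactly one of the three edges at `v`, and adjacent
  -- classes are disjoint.
  claw-coloring : ∀ {v a b c} → Claw v a b c → IsColoring (B (L G)) (φ (L G) a) (φ (L G) b) (φ (L G) c)
  claw-coloring {v} {a} {b} {c} K = coloring independent independent independent
      (disjoint a≢b v∼a v∼b) (disjoint a≢c v∼a v∼c) (disjoint b≢c v∼b v∼c) (⊆-antisym ⊆⊤ λ {k} _ → covers k)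
    where
    open Claw K
    independent : ∀ {e} → Independent (B (L G)) (φ (L G) e)
    independent {e} k l k∈ l∈ (_ , _ , col) = IsColoring.disj₁₂ col (e , x∈p∩q⁺ (∈φ⁻ k∈ , ∈φ⁻ l∈))
    disjoint : ∀ {e f} → e ≢ f → v ∼ e → v ∼ f → Empty (φ (L G) e ∩ φ (L G) f)
    disjoint {e} {f} e≢f v∼e v∼f (k , k∈) = proper (e≢f , v , v∼e , v∼f)
        (trans (proj₁ ∈⇆0 (∈φ⁻ (proj₁ both∈))) (sym (proj₁ ∈⇆0 (∈φ⁻ (proj₂ both∈)))))
      where
      open AsFibre (asFibre k)
      both∈ : k ∈ φ (L G) e × k ∈ φ (L G) f
      both∈ = x∈p∩q⁻ (φ (L G) e) (φ (L G) f) k∈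
    covers : ∀ k → k ∈ φ (L G) a ∪ φ (L G) b ∪ φ (L G) c
    covers k = from (hits (⇒proper proper) (∈⊤ {x = v}) 0F)
      where
      open AsFibre (asFibre k)
      from : ∃[ z ] v ∼ z × colour z ≡ 0F → k ∈ φ (L G) a ∪ φ (L G) b ∪ φ (L G) c
      from (z , v∼z , hz) = [ (λ eq → x∈p∪q⁺ (inj₁ (lies eq))) , [ (λ eq → x∈p∪q⁺ (inj₂ (x∈p∪q⁺ (inj₁ (lies eq))))) ,
          (λ eq → x∈p∪q⁺ (inj₂ (x∈p∪q⁺ (inj₂ (lies eq))))) ]′ ]′ (only v∼z)
        where
        lies : ∀ {e} → z ≡ e → k ∈ φ (L G) e
        lies eq = ∈φ⁺ (proj₂ ∈⇆0 (trans (cong colour (sym eq)) hz))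

  φ-class : ∀ e → ColorClass (B (L G)) (φ (L G) e)
  φ-class e = from (clawFrom (proj₂ (someEnd e)))
    where
    from : ∀ {v} → ∃[ b ] ∃[ c ] Claw v e b c → ColorClass (B (L G)) (φ (L G) e)
    from (b , c , K) = φ (L G) b , φ (L G) c , claw-coloring K

  reflexive⇒triangle-free : EdgeReflexive G → TriangleFree G
  reflexive⇒triangle-free (_ , f , class-f , ((f-inj , _) , _)) u v w
    ((u≢v , a , u∼a , v∼a) , (v≢w , b , v∼b , w∼b) , (u≢w , c , u∼c , w∼c)) = not-at u≢v v≢w u≢w u∼a v∼a (subst (w ∼_) (sym a≡d) (Claw.v∼c K))
    where
    not-at : ∀ {u v w g} → u ≢ v → v ≢ w → u ≢ w → u ∼ g → v ∼ g → ¬ (w ∼ g)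
    not-at u≢v v≢w u≢w u∼g v∼g w∼g = [ (λ w≡u → u≢w (sym w≡u)) , (λ w≡v → v≢w (sym w≡v)) ]′ (ends-two u∼g v∼g w∼g u≢v)
    a≢b : a ≢ b
    a≢b refl = not-at u≢v v≢w u≢w u∼a v∼a w∼b
    a≢c : a ≢ c
    a≢c refl = not-at u≢v v≢w u≢w u∼a v∼a w∼c
    b≢c : b ≢ c
    b≢c refl = not-at (≢-sym u≢v) u≢w v≢w v∼b u∼c w∼b
    d : Edge
    d = proj₁ (thirdEdge w∼b w∼c b≢c)
    K : Claw w b c d
    K = proj₂ (thirdEdge w∼b w∼c b≢c)
    same-colour : ∀ {h} → Proper ⊤ h → h a ≡ h d
    same-colour {h} proper = remaining-colour (h b) (h c) (h d) (h a) (proper ∈⊤ w∼b w∼c b≢c)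
      (proper ∈⊤ w∼b (Claw.v∼c K) (Claw.a≢c K)) (proper ∈⊤ w∼c (Claw.v∼c K) (Claw.b≢c K))
      (proper ∈⊤ v∼a v∼b a≢b) (proper ∈⊤ u∼a u∼c a≢c)
    φ≡ : φ (L G) a ≡ φ (L G) d
    φ≡ = ⊆-antisym (λ k∈ → transfer _ (sym ∘ same-colour) k∈) (λ k∈ → transfer _ same-colour k∈)
      where
      transfer : ∀ {e f} k → (∀ {h} → Proper ⊤ h → h f ≡ h e) → k ∈ φ (L G) e → k ∈ φ (L G) f
      transfer k eq k∈ = ∈φ⁺ (proj₂ ∈⇆0 (trans (eq (⇒proper proper)) (proj₁ ∈⇆0 (∈φ⁻ k∈))))
        where open AsFibre (asFibre k)
    a≡d : a ≡ d
    a≡d = f-inj (ColouringComplex.class-injective (B (L G)) (trans (class-f a) (trans φ≡ (sym (class-f d)))))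

  module _ (v₀ : Vertex) (colourable : ¬ ¬ Colourable ⊤) (sep : Separated ⊤) (rep : ¬ ¬ Represented ⊤) where
    private
      module BB = ColouringComplex (B (L G))

    φ-injective : ∀ {e f} → φ (L G) e ≡ φ (L G) f → e ≡ f
    φ-injective {e} {f} eq = decidable-stable (e ≟ f) λ e≢f → sep (Inc-⊤ e) (Inc-⊤ f) e≢f λ (γ , proper , neq) →
      let (k , class-k) = indexOf (fibre-class {γ} (proper⇒ proper) (γ e))
          f∈ = ∈φ⁻ {k} (subst (k ∈_) eq (∈φ⁺ (subst (e ∈_) (sym class-k) (∈fibre γ refl))))
      in neq (sym (fibre∈ γ (subst (f ∈_) class-k f∈)))

    module _ {C D E} (col : IsColoring (B (L G)) C D E) where
      private
        h : Fin (order (B (L G))) → Colour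
        h = BB.toColour col

      valueFrom : ∀ {M} → Dec (∃[ k ] class (L G) k ≡ M) → Colour
      valueFrom (yes (k , _)) = h k
      -- A default for sets that are not colour classes; `valueAt` is only compared at classes.
      valueFrom (no _)        = 0F

      valueFrom-class : ∀ {M} (found : Dec (∃[ k ] class (L G) k ≡ M)) k → class (L G) k ≡ M → valueFrom found ≡ h k
      valueFrom-class (yes (l , eq)) k eq′ = cong h (class-injective (trans eq (sym eq′)))
      valueFrom-class (no none)      k eq′ = ⊥-elim (none (k , eq′))

      abstract
        valueAt : VertexSet (L G) → Colour
        valueAt M = valueFrom (any? λ k → class (L G) k ≟ˢ M)

        valueAt-class : ∀ k → valueAt (class (L G) k) ≡ h k
        valueAt-class k = valueFrom-class (any? λ l → class (L G) l ≟ˢ class (L G) k) k refl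

      val : EdgeColouring → Colour → Colour
      val γ i = valueAt (fibre γ i)

      val-inj : ∀ {γ} → Proper ⊤ γ → Injective₃ (val γ)
      val-inj {γ} proper {i} {j} eq = decidable-stable (i ≟ᶜ j) λ i≢j → BB.toColour-proper col (adjacent-classes i≢j)
          (trans (sym (valueAt-class (proj₁ (index i)))) (trans (cong valueAt (proj₂ (index i)))
            (trans eq (trans (cong valueAt (sym (proj₂ (index j)))) (valueAt-class (proj₁ (index j)))))))
        where
        index : ∀ i → ∃[ k ] class (L G) k ≡ fibre γ i
        index i = indexOf (fibre-class {γ} (proper⇒ proper) i)
        adjacent-classes : i ≢ j → Adj (B (L G)) (proj₁ (index i)) (proj₁ (index j))
        adjacent-classes i≢j = subst₂ (Compatible (L G)) (sym (proj₂ (index i))) (sym (proj₂ (index j)))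
          (differ , fibre γ (third i j) , fibres-coloring {γ} (proper⇒ proper) i≢j (≢-sym (third≢ˡ i j)) (≢-sym (third≢ʳ i j)))
          where
          -- All three colours occur at `v₀`, so no class is empty and different colours have
          -- different classes.
          differ : fibre γ i ≢ fibre γ j
          differ eq = from (hits proper (∈⊤ {x = v₀}) i)
            where
            from : ∃[ z ] v₀ ∼ z × γ z ≡ i → ⊥
            from (z , _ , γz) = i≢j (trans (sym γz) (fibre∈ γ (subst (z ∈_) eq (∈fibre γ γz))))

      induced : ClassColouring ⊤
      induced = record
        { value = val ; injective = val-inj
        ; shared = λ {γ} {γ′} {i} {j} _ _ share → cong valueAt (⊆-antisym
            (λ {e} e∈ → ∈fibre γ′ (proj₁ (share (Inc-⊤ e)) (fibre∈ γ e∈)))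
            (λ {e} e∈ → ∈fibre γ (proj₂ (share (Inc-⊤ e)) (fibre∈ γ′ e∈)))) }

      -- The edge at y of a given value s lies in exactly the classes coloured s.
      edge-of-value : ∀ {y} → ClassColouring.GivenBy induced y → Colourable ⊤ → ∀ s →
                      ∃[ z ] y ∼ z × (∀ k → k ∈ φ (L G) z ⇆ h k ≡ s)
      edge-of-value {y} (_ , const) (γ₀ , proper₀) s = choose (attains (val-inj proper₀) s)
        where
        module _ {z i} (y∼z : y ∼ z) (γz : γ₀ z ≡ i) (val≡s : val γ₀ i ≡ s) where
          value-z : ∀ {γ} → Proper ⊤ γ → val γ (γ z) ≡ s
          value-z proper = trans (const y∼z proper proper₀) (trans (cong (val γ₀) γz) val≡s)
          module _ (k : Fin (order (B (L G)))) where
            open AsFibre (asFibre k)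
            val-k : val colour 0F ≡ h k
            val-k = trans (cong valueAt (sym ≡fibre)) (valueAt-class k)
            forth : k ∈ φ (L G) z → h k ≡ s
            forth k∈ = trans (sym val-k) (trans (cong (val colour) (sym (proj₁ ∈⇆0 (∈φ⁻ k∈)))) (value-z (⇒proper proper)))
            back : h k ≡ s → k ∈ φ (L G) z
            back hk = ∈φ⁺ (proj₂ ∈⇆0 (val-inj (⇒proper proper) (trans (value-z (⇒proper proper)) (trans (sym hk) (sym val-k)))))
        choose : ∃[ i ] val γ₀ i ≡ s → ∃[ z ] y ∼ z × (∀ k → k ∈ φ (L G) z ⇆ h k ≡ s)
        choose (i , val≡s) = pick (hits proper₀ (∈⊤ {x = y}) i)
          where
          pick : ∃[ z ] y ∼ z × γ₀ z ≡ i → ∃[ z ] y ∼ z × (∀ k → k ∈ φ (L G) z ⇆ h k ≡ s)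
          pick (z , y∼z , γz) = z , y∼z , λ k → forth y∼z γz val≡s k , back y∼z γz val≡s k

      -- Surjectivity of the embedding and the reflection of adjacency both follow from this; each
      -- of them is decidable, which removes the double negation.
      from-vertex : ¬ ¬ (∃[ y ] ∃[ z ] ∃[ z′ ] y ∼ z × y ∼ z′ × φ (L G) z ≡ C × φ (L G) z′ ≡ D)
      from-vertex none = colourable λ γ → rep λ represented → represented induced λ (y , given) →
        let (z , y∼z , φz)    = edge-of-value given γ 0F
            (z′ , y∼z′ , φz′) = edge-of-value given γ 1F
        in none (y , z , z′ , y∼z , y∼z′ ,
             ⊆-antisym (λ {k} k∈ → proj₂ (BB.toColour-C col) (proj₁ (φz k) k∈)) (λ {k} k∈ → proj₂ (φz k) (proj₁ (BB.toColour-C col) k∈)) ,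
             ⊆-antisym (λ {k} k∈ → proj₂ (BB.toColour-D col) (proj₁ (φz′ k) k∈)) (λ {k} k∈ → proj₂ (φz′ k) (proj₁ (BB.toColour-D col) k∈)))

    embed : Edge → Fin (order (B (B (L G))))
    embed e = proj₁ (BB.indexOf (φ-class e))

    class-embed : ∀ e → class (B (L G)) (embed e) ≡ φ (L G) e
    class-embed e = proj₂ (BB.indexOf (φ-class e))

    embed-injective : ∀ {e f} → embed e ≡ embed f → e ≡ f
    embed-injective {e} {f} eq =
      φ-injective (trans (sym (class-embed e)) (trans (cong (class (B (L G))) eq) (class-embed f)))

    embed-onto : ∀ j → ∃[ e ] embed e ≡ j
    embed-onto j = proj₁ found , BB.class-injective (trans (class-embed (proj₁ found)) (proj₂ found))
      where
      found : ∃[ e ] φ (L G) e ≡ class (B (L G)) j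
      found = decidable-stable (any? λ e → φ (L G) e ≟ˢ class (B (L G)) j) λ none →
        from-vertex (proj₂ (proj₂ (BB.classOf j))) λ (_ , z , _ , _ , _ , φz , _) → none (z , φz)

    embed-adj : ∀ e f → Adj (L G) e f ⇔ Adj (B (B (L G))) (embed e) (embed f)
    embed-adj e f = mk⇔
      (λ (e≢f , v , v∼e , v∼f) → let (c , K) = thirdEdge v∼e v∼f e≢f in
        (λ eq → e≢f (embed-injective (BB.class-injective eq))) ,
        φ (L G) c , subst₂ (λ C D → IsColoring (B (L G)) C D (φ (L G) c)) (sym (class-embed e)) (sym (class-embed f)) (claw-coloring K))
      (λ (classes≢ , _ , col) → decidable-stable (adj? (L G) e f) λ ¬adj →
        from-vertex col λ (y , z , z′ , y∼z , y∼z′ , φz , φz′) →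
          ¬adj ((λ e≡f → classes≢ (cong (class (B (L G)) ∘ embed) e≡f)) , y ,
            subst (y ∼_) (φ-injective (trans φz (class-embed e))) y∼z ,
            subst (y ∼_) (φ-injective (trans φz′ (class-embed f))) y∼z′))

    edgeReflexive : EdgeReflexive G
    edgeReflexive = decidable-stable (anySubset? (colorClass? (L G)))
        (λ none → colourable λ (γ , proper) → none (_ , fibre-class {γ} (proper⇒ proper) 0F)) ,
      embed , class-embed , (embed-injective , λ j → proj₁ (embed-onto j) , λ { refl → proj₂ (embed-onto j) }) , embed-adj

-- The equivalence for connected outerplanar cubic graphs

someVertex : ∀ n → ℕ.NonZero n → Fin n
someVertex (suc n) _ = zero

theorem9 : (G : CubicGraph) → Connected G → Outerplanar G → EdgeReflexive G ⇔ TriangleFree G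
theorem9 G (nonempty , connected) (D , onOuter) = mk⇔ (LineGraph.reflexive⇒triangle-free G) triangle-free⇒
  where
  open CubicGraph G using (#vertices)
  open GraphKit G using (Reach)
  open Structure G using (ConnectedSet)
  v₀ : Fin #vertices
  v₀ = someVertex #vertices nonempty
  conn : ConnectedSet ⊤
  conn {a} {b} _ _ = gmap id (λ adj → adj , ∈⊤ , ∈⊤) (connected a b)
  triangle-free⇒ : TriangleFree G → EdgeReflexive G
  triangle-free⇒ tf = LineGraph.edgeReflexive G v₀
      (λ none → built λ b → none (colourable-built b)) (separated′ conn) (λ none → built λ b → none (represented b))
    where
    open MainInduction G tf (Theta.noK₂₃ G D connected onOuter)
    built : ¬ ¬ Structure.Built G ⁅ v₀ ⁆ ⊤
    built = fromVertex conn ∈⊤
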